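{- There is an absolute constant $K>0$ such that the following holds. Let $p>2$ be a prime, $n\ge 1$, and let $f:\mathbb{Z}_p^n\to\{+1,-1\}$ be a function with $\|\hat f\|_1 = A$. Then there exists an affine subspace $V\subseteq\mathbb{Z}_p^n$ of co-dimension at most $K A^2$ such that $f$ is constant on $V$.
   Context: Let $\omega=e^{2\pi i/p}$ and, for $\alpha\in\mathbb{Z}_p^n$, $\chi_\alpha(x)=\omega^{\langle\alpha,x\rangle}$. For $f:\mathbb{Z}_p^n\to\mathbb{C}$, $\hat f(\alpha)=\mathbb{E}_x[f(x)\overline{\chi_\alpha(x)}]$ ($x$ uniform in $\mathbb{Z}_p^n$), so $f=\sum_\alpha\hat f(\alpha)\chi_\alpha$, and $\|\hat f\|_1=\sum_{\alpha\in\mathbb{Z}_p^n}|\hat f(\alpha)|$. An affine subspace is a (nonempty) coset of a $\mathbb{Z}_p$-linear subspace. -}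

module Defs where

open import Level using (0ℓ)
open import Algebra.Bundles using (RawMonoid; RawSemiring)
import Algebra.Definitions.RawSemiring as RawSemiringDefs
open import Data.Nat.Base as ℕ using (ℕ; zero; suc; NonZero)
import Data.Nat.Properties as ℕ
open import Data.Nat.DivMod using (_mod_)
import Data.Nat.Coprimality as Coprime
open import Data.Integer.Base as ℤ using (+_; -[1+_])
import Data.Integer.Properties as ℤ
open import Data.Rational.Base hiding (NonZero)
import Data.Rational.Unnormalised.Base as ℚᵘ
import Data.Rational.Unnormalised.Properties as ℚᵘ
open import Data.Rational.Properties
open import Data.Rational.Solver using (module +-*-Solver)
open import Data.Fin.Base using (Fin; toℕ)
open import Data.Vec.Base as Vec using (Vec; []; _∷_; zipWith; replicate; foldr′)
open import Data.Vec.Relation.Unary.All using (All)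
open import Data.Sign.Base using (Sign)
open import Data.Empty using (⊥-elim)
open import Data.Product using (Σ; ∃-syntax; _×_; _,_)
open import Data.Sum.Base using (_⊎_; inj₁; inj₂)
open import Relation.Nullary using (¬_; yes; no)
open import Relation.Binary.PropositionalEquality

open +-*-Solver using (solve; con; _:+_; _:*_; _:-_; :-_; _:=_)

------------------------------------------------------------------------
-- Rational arithmetic

fromℕ : ℕ → ℚ
fromℕ n = mkℚ (+ n) 0 (Coprime.sym (Coprime.1-coprimeTo n))

1/suc : ℕ → ℚ
1/suc n = mkℚ (+ 1) n (Coprime.1-coprimeTo (suc n))

fromℕ-+ : ∀ m n → fromℕ (m ℕ.+ n) ≡ fromℕ m + fromℕ n
fromℕ-+ m n = toℚᵘ-injective (begin
  ℚᵘ.mkℚᵘ (+ (m ℕ.+ n)) 0                   ≈⟨ ℚᵘ.*≡* (cong (ℤ._* + 1) (sym (cong₂ ℤ._+_ (ℤ.*-identityʳ (+ m)) (ℤ.*-identityʳ (+ n))))) ⟩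
  toℚᵘ (fromℕ m) ℚᵘ.+ toℚᵘ (fromℕ n)        ≈⟨ ℚᵘ.≃-sym (toℚᵘ-homo-+ (fromℕ m) (fromℕ n)) ⟩
  toℚᵘ (fromℕ m + fromℕ n)                  ∎)
  where open import Relation.Binary.Reasoning.Setoid ℚᵘ.≃-setoid

fromℕ-* : ∀ m n → fromℕ (m ℕ.* n) ≡ fromℕ m * fromℕ n
fromℕ-* zero    n = sym (*-zeroˡ (fromℕ n))
fromℕ-* (suc m) n = begin
  fromℕ (n ℕ.+ m ℕ.* n)          ≡⟨ fromℕ-+ n (m ℕ.* n) ⟩
  fromℕ n + fromℕ (m ℕ.* n)      ≡⟨ cong (λ t → fromℕ n + t) (fromℕ-* m n) ⟩
  fromℕ n + fromℕ m * fromℕ n    ≡⟨ solve 2 (λ x y → y :+ x :* y := (con 1ℚ :+ x) :* y) refl (fromℕ m) (fromℕ n) ⟩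
  (1ℚ + fromℕ m) * fromℕ n       ≡⟨ cong (_* fromℕ n) (sym (fromℕ-+ 1 m)) ⟩
  fromℕ (suc m) * fromℕ n        ∎
  where open ≡-Reasoning

0≤fromℕ : ∀ n → 0ℚ ≤ fromℕ n
0≤fromℕ n = nonNegative⁻¹ (fromℕ n)

fromℕ-mono : ∀ {m n} → m ℕ.≤ n → fromℕ m ≤ fromℕ n
fromℕ-mono {m} {n} m≤n = subst₂ _≤_ (+-identityʳ (fromℕ m))
  (trans (sym (fromℕ-+ m (n ℕ.∸ m))) (cong fromℕ (ℕ.m+[n∸m]≡n m≤n)))
  (+-monoʳ-≤ (fromℕ m) (0≤fromℕ (n ℕ.∸ m)))

0<1/suc : ∀ n → 0ℚ < 1/suc n
0<1/suc n = positive⁻¹ (1/suc n)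

suc*1/suc : ∀ n → fromℕ (suc n) * 1/suc n ≡ 1ℚ
suc*1/suc n = toℚᵘ-injective (begin
  toℚᵘ (fromℕ (suc n) * 1/suc n)                  ≈⟨ toℚᵘ-homo-* (fromℕ (suc n)) (1/suc n) ⟩
  ℚᵘ.mkℚᵘ (+ suc n) 0 ℚᵘ.* ℚᵘ.mkℚᵘ (+ 1) n        ≈⟨ ℚᵘ.*≡* (cong +_ (lem n)) ⟩
  toℚᵘ 1ℚ                                         ∎)
  where
  open import Relation.Binary.Reasoning.Setoid ℚᵘ.≃-setoid
  lem : ∀ n → (suc n ℕ.* 1) ℕ.* 1 ≡ 1 ℕ.* (1 ℕ.* suc n)
  lem n = trans (ℕ.*-identityʳ _) (trans (ℕ.*-identityʳ _) (sym (trans (ℕ.*-identityˡ _) (ℕ.*-identityˡ _))))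

q≤∣↥q∣ : ∀ q → q ≤ fromℕ ℤ.∣ ↥ q ∣
q≤∣↥q∣ q@(mkℚ (+ a) d _) = *≤* (ℤ.*-monoˡ-≤-nonNeg (+ a) (ℤ.+≤+ (ℕ.s≤s (ℕ.z≤n {d}))))
q≤∣↥q∣ q@(mkℚ -[1+ a ] d _) = ≤-trans (<⇒≤ (negative⁻¹ q)) (0≤fromℕ (suc a))

½+½ : ∀ ε → ½ * ε + ½ * ε ≡ ε
½+½ ε = trans (sym (*-distribʳ-+ ε ½ ½)) (*-identityˡ ε)

0<½ : ∀ {ε} → 0ℚ < ε → 0ℚ < ½ * ε
0<½ {ε} 0<ε = subst (_< ½ * ε) (*-zeroʳ ½) (*-monoʳ-<-pos ½ 0<ε)

0<-* : ∀ {a b} → 0ℚ < a → 0ℚ < b → 0ℚ < a * b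
0<-* {a} {b} 0<a 0<b = subst (_< a * b) (*-zeroʳ a) (*-monoʳ-<-pos a {{positive 0<a}} 0<b)

0≤-* : ∀ {a b} → 0ℚ ≤ a → 0ℚ ≤ b → 0ℚ ≤ a * b
0≤-* {a} {b} 0≤a 0≤b = subst (_≤ a * b) (*-zeroʳ a) (*-monoˡ-≤-nonNeg a {{nonNegative 0≤a}} 0≤b)

*-mono : ∀ {a b c d} → 0ℚ ≤ a → 0ℚ ≤ d → a ≤ b → c ≤ d → a * c ≤ b * d
*-mono {a} {b} {c} {d} 0≤a 0≤d a≤b c≤d = ≤-trans
  (*-monoˡ-≤-nonNeg a {{nonNegative 0≤a}} c≤d)
  (*-monoʳ-≤-nonNeg d {{nonNegative 0≤d}} a≤b)

∣-∣-triangle : ∀ a b c → ∣ a - c ∣ ≤ ∣ a - b ∣ + ∣ b - c ∣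
∣-∣-triangle a b c = subst (λ t → ∣ t ∣ ≤ ∣ a - b ∣ + ∣ b - c ∣)
  (solve 3 (λ a b c → (a :- b) :+ (b :- c) := a :- c) refl a b c)
  (∣p+q∣≤∣p∣+∣q∣ (a - b) (b - c))

∣-∣-sym : ∀ a b → ∣ a - b ∣ ≡ ∣ b - a ∣
∣-∣-sym a b = trans (sym (∣-p∣≡∣p∣ (a - b)))
  (cong ∣_∣ (solve 2 (λ a b → :- (a :- b) := b :- a) refl a b))

p≤∣p∣ : ∀ p → p ≤ ∣ p ∣
p≤∣p∣ p with ≤-total 0ℚ p
... | inj₁ 0≤p = ≤-reflexive (sym (0≤p⇒∣p∣≡p 0≤p))
... | inj₂ p≤0 = ≤-trans p≤0 (0≤∣p∣ p)

∣p-q∣<ε : ∀ {p q ε} → p < q + ε → q < p + ε → ∣ p - q ∣ < ε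
∣p-q∣<ε {p} {q} {ε} p< q< with ∣p∣≡p∨∣p∣≡-p (p - q)
... | inj₁ eq = subst₂ _<_ (sym eq) (solve 2 (λ q e → q :+ e :- q := e) refl q ε) (+-monoˡ-< (- q) p<)
... | inj₂ eq = subst₂ _<_ (trans (solve 2 (λ p q → q :- p := :- (p :- q)) refl p q) (sym eq))
                  (solve 2 (λ p e → p :+ e :- p := e) refl p ε) (+-monoˡ-< (- p) q<)

q<p+ε : ∀ {p q ε} → ∣ p - q ∣ < ε → p < q + ε
q<p+ε {p} {q} {ε} h = subst (_< q + ε) (solve 2 (λ p q → q :+ (p :- q) := p) refl p q)
  (+-monoʳ-< q (≤-<-trans (p≤∣p∣ (p - q)) h))

archimedean : ∀ t {ε} → 0ℚ < ε → ∃[ j ] t < fromℕ (suc j) * ε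
archimedean t {ε} 0<ε = j , subst (_< fromℕ (suc j) * ε) eq (*-monoˡ-<-pos ε {{ε⁺}} u<)
  where
  ε⁺ = positive 0<ε
  instance _ = pos⇒nonZero ε {{ε⁺}}
  u = t * 1/ ε
  j = ℤ.∣ ↥ u ∣
  u< : u < fromℕ (suc j)
  u< = ≤-<-trans (q≤∣↥q∣ u) (subst₂ _<_ (+-identityˡ (fromℕ j)) (sym (fromℕ-+ 1 j))
         (+-monoˡ-< (fromℕ j) (positive⁻¹ 1ℚ)))
  eq : u * ε ≡ t
  eq = trans (*-assoc t (1/ ε) ε) (trans (cong (t *_) (*-inverseˡ ε)) (*-identityʳ t))

scale-down : ∀ {B ε} → 0ℚ < B → 0ℚ < ε → ∃[ δ ] 0ℚ < δ × B * δ ≡ ε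
scale-down {B} {ε} 0<B 0<ε = 1/ B * ε , 0<-* (positive⁻¹ (1/ B) {{1/pos⇒pos B}}) 0<ε
  , trans (sym (*-assoc B (1/ B) ε)) (trans (cong (_* ε) (*-inverseʳ B)) (*-identityˡ ε))
  where
  instance
    B⁺ = positive 0<B
    _  = pos⇒nonZero B

------------------------------------------------------------------------
-- Real numbers

Cauchy : (ℕ → ℚ) → Set
Cauchy x = ∀ ε → 0ℚ < ε → ∃[ N ] ∀ m n → N ℕ.≤ m → N ℕ.≤ n → ∣ x m - x n ∣ < ε

-- ℝ is a setoid: distinct sequences with the same limit are identified only
-- by _≈ᴿ_, and all three relations below depend on the limits alone.
record ℝ : Set where
  constructor mkℝ
  field
    seq    : ℕ → ℚ
    cauchy : Cauchy seq

open ℝ public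

infix 4 _≈ᴿ_ _≤ᴿ_ _<ᴿ_

_≈ᴿ_ : ℝ → ℝ → Set
x ≈ᴿ y = ∀ ε → 0ℚ < ε → ∃[ N ] ∀ n → N ℕ.≤ n → ∣ seq x n - seq y n ∣ < ε

_≤ᴿ_ : ℝ → ℝ → Set
x ≤ᴿ y = ∀ ε → 0ℚ < ε → ∃[ N ] ∀ n → N ℕ.≤ n → seq x n < seq y n + ε

_<ᴿ_ : ℝ → ℝ → Set
x <ᴿ y = ∃[ ε ] 0ℚ < ε × ∃[ N ] ∀ n → N ℕ.≤ n → seq x n + ε < seq y n

cauchy-const : ∀ q → Cauchy (λ _ → q)
cauchy-const q ε 0<ε = 0 , λ _ _ _ _ → subst (_< ε) (sym (cong ∣_∣ (+-inverseʳ q))) 0<ε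

cauchy-+ : ∀ {x y} → Cauchy x → Cauchy y → Cauchy (λ n → x n + y n)
cauchy-+ {x} {y} cx cy ε 0<ε with cx (½ * ε) (0<½ 0<ε) | cy (½ * ε) (0<½ 0<ε)
... | M , hx | N , hy = M ℕ.⊔ N , λ m n ≤m ≤n → ≤-<-trans
  (subst (λ t → ∣ t ∣ ≤ ∣ x m - x n ∣ + ∣ y m - y n ∣)
    (solve 4 (λ a b c d → (a :- b) :+ (c :- d) := (a :+ c) :- (b :+ d)) refl (x m) (x n) (y m) (y n))
    (∣p+q∣≤∣p∣+∣q∣ (x m - x n) (y m - y n)))
  (subst (∣ x m - x n ∣ + ∣ y m - y n ∣ <_) (½+½ ε)
    (+-mono-< (hx m n (ℕ.m⊔n≤o⇒m≤o M N ≤m) (ℕ.m⊔n≤o⇒m≤o M N ≤n))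
              (hy m n (ℕ.m⊔n≤o⇒n≤o M N ≤m) (ℕ.m⊔n≤o⇒n≤o M N ≤n))))

cauchy-neg : ∀ {x} → Cauchy x → Cauchy (λ n → - x n)
cauchy-neg {x} cx ε 0<ε with cx ε 0<ε
... | N , hx = N , λ m n ≤m ≤n → subst (_< ε)
  (trans (sym (∣-p∣≡∣p∣ (x m - x n)))
    (cong ∣_∣ (solve 2 (λ a b → :- (a :- b) := (:- a) :- (:- b)) refl (x m) (x n))))
  (hx m n ≤m ≤n)

eventually-bounded : ∀ {x} → Cauchy x → ∃[ b ] ∃[ N ] ∀ n → N ℕ.≤ n → ∣ x n ∣ < fromℕ (suc b)
eventually-bounded {x} cx with cx 1ℚ (positive⁻¹ 1ℚ)
... | N , hx = b , N , λ n ≤n → ≤-<-trans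
    (subst (λ t → ∣ t ∣ ≤ ∣ x n - x N ∣ + ∣ x N ∣)
      (solve 2 (λ a b → (a :- b) :+ b := a) refl (x n) (x N)) (∣p+q∣≤∣p∣+∣q∣ (x n - x N) (x N)))
    (subst (∣ x n - x N ∣ + ∣ x N ∣ <_) (sym (fromℕ-+ 1 b))
      (+-mono-<-≤ (hx n N ≤n ℕ.≤-refl) (q≤∣↥q∣ ∣ x N ∣)))
  where b = ℤ.∣ ↥ ∣ x N ∣ ∣

0<fromℕsuc : ∀ b → 0ℚ < fromℕ (suc b)
0<fromℕsuc b = <-≤-trans (positive⁻¹ 1ℚ) (fromℕ-mono {1} (ℕ.s≤s ℕ.z≤n))

product-bound : ∀ {A B a b c d δ η} → 0ℚ < A → 0ℚ < B → ∣ a ∣ < A → ∣ d ∣ < B →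
  ∣ c - d ∣ < δ → ∣ a - b ∣ < η → ∣ a * c - b * d ∣ < A * δ + B * η
product-bound {A} {B} {a} {b} {c} {d} {δ} {η} 0<A 0<B a<A d<B cd<δ ab<η = begin-strict
  ∣ a * c - b * d ∣
    ≡⟨ cong ∣_∣ (solve 4 (λ a b c d → a :* c :- b :* d := a :* (c :- d) :+ d :* (a :- b)) refl a b c d) ⟩
  ∣ a * (c - d) + d * (a - b) ∣
    ≤⟨ ∣p+q∣≤∣p∣+∣q∣ (a * (c - d)) (d * (a - b)) ⟩
  ∣ a * (c - d) ∣ + ∣ d * (a - b) ∣
    ≡⟨ cong₂ _+_ (∣p*q∣≡∣p∣*∣q∣ a (c - d)) (∣p*q∣≡∣p∣*∣q∣ d (a - b)) ⟩
  ∣ a ∣ * ∣ c - d ∣ + ∣ d ∣ * ∣ a - b ∣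
    ≤⟨ +-mono-≤ (*-monoʳ-≤-nonNeg ∣ c - d ∣ {{∣-∣-nonNeg (c - d)}} (<⇒≤ a<A))
                (*-monoʳ-≤-nonNeg ∣ a - b ∣ {{∣-∣-nonNeg (a - b)}} (<⇒≤ d<B)) ⟩
  A * ∣ c - d ∣ + B * ∣ a - b ∣
    <⟨ +-mono-< (*-monoʳ-<-pos A {{positive 0<A}} cd<δ) (*-monoʳ-<-pos B {{positive 0<B}} ab<η) ⟩
  A * δ + B * η ∎
  where open ≤-Reasoning

cauchy-* : ∀ {x y} → Cauchy x → Cauchy y → Cauchy (λ n → x n * y n)
cauchy-* {x} {y} cx cy ε 0<ε =
  let a , M₁ , bx  = eventually-bounded cx
      b , N₁ , by  = eventually-bounded cy
      0<A          = 0<fromℕsuc a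
      0<B          = 0<fromℕsuc b
      δ , 0<δ , aδ = scale-down 0<A (0<½ 0<ε)
      η , 0<η , bη = scale-down 0<B (0<½ 0<ε)
      M₂ , hy      = cy δ 0<δ
      N₂ , hx      = cx η 0<η
      l : ∀ {k} → (M₁ ℕ.⊔ N₁) ℕ.⊔ (M₂ ℕ.⊔ N₂) ℕ.≤ k → M₁ ℕ.⊔ N₁ ℕ.≤ k
      l = ℕ.m⊔n≤o⇒m≤o (M₁ ℕ.⊔ N₁) (M₂ ℕ.⊔ N₂)
      r : ∀ {k} → (M₁ ℕ.⊔ N₁) ℕ.⊔ (M₂ ℕ.⊔ N₂) ℕ.≤ k → M₂ ℕ.⊔ N₂ ℕ.≤ k
      r = ℕ.m⊔n≤o⇒n≤o (M₁ ℕ.⊔ N₁) (M₂ ℕ.⊔ N₂)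
  in (M₁ ℕ.⊔ N₁) ℕ.⊔ (M₂ ℕ.⊔ N₂) , λ m n ≤m ≤n →
     subst (∣ x m * y m - x n * y n ∣ <_) (trans (cong₂ _+_ aδ bη) (½+½ ε))
       (product-bound {fromℕ (suc a)} {fromℕ (suc b)} {x m} {x n} {y m} {y n} 0<A 0<B
         (bx m (ℕ.m⊔n≤o⇒m≤o M₁ N₁ (l ≤m)))
         (by n (ℕ.m⊔n≤o⇒n≤o M₁ N₁ (l ≤n)))
         (hy m n (ℕ.m⊔n≤o⇒m≤o M₂ N₂ (r ≤m)) (ℕ.m⊔n≤o⇒m≤o M₂ N₂ (r ≤n)))
         (hx m n (ℕ.m⊔n≤o⇒n≤o M₂ N₂ (r ≤m)) (ℕ.m⊔n≤o⇒n≤o M₂ N₂ (r ≤n))))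

fromℚ : ℚ → ℝ
fromℚ q = mkℝ (λ _ → q) (cauchy-const q)

0ᴿ 1ᴿ : ℝ
0ᴿ = fromℚ 0ℚ
1ᴿ = fromℚ 1ℚ

infixl 6 _+ᴿ_
infixl 7 _*ᴿ_
infix  8 -ᴿ_

_+ᴿ_ : ℝ → ℝ → ℝ
x +ᴿ y = mkℝ (λ n → seq x n + seq y n) (cauchy-+ {seq x} {seq y} (cauchy x) (cauchy y))

-ᴿ_ : ℝ → ℝ
-ᴿ x = mkℝ (λ n → - seq x n) (cauchy-neg {seq x} (cauchy x))

_*ᴿ_ : ℝ → ℝ → ℝ
x *ᴿ y = mkℝ (λ n → seq x n * seq y n) (cauchy-* {seq x} {seq y} (cauchy x) (cauchy y))

------------------------------------------------------------------------
-- Trigonometric functions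

expTerm : ℚ → ℕ → ℚ
expTerm q zero    = 1ℚ
expTerm q (suc k) = expTerm q k * (q * 1/suc k)

-- expTerm q k is qᵏ / k!, so this is Σ_{k < n} c k * qᵏ / k!.
expSeries : (ℕ → ℚ) → ℚ → ℕ → ℚ
expSeries c q zero    = 0ℚ
expSeries c q (suc n) = expSeries c q n + c n * expTerm q n

0≤expTerm : ∀ b k → 0ℚ ≤ expTerm (fromℕ b) k
0≤expTerm b zero    = nonNegative⁻¹ 1ℚ
0≤expTerm b (suc k) = 0≤-* (0≤expTerm b k) (0≤-* (0≤fromℕ b) (<⇒≤ (0<1/suc k)))

∣expTerm∣≤ : ∀ b {q} → ∣ q ∣ ≤ fromℕ b → ∀ k → ∣ expTerm q k ∣ ≤ expTerm (fromℕ b) k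
∣expTerm∣≤ b {q} q≤b zero    = ≤-refl
∣expTerm∣≤ b {q} q≤b (suc k) = begin
  ∣ expTerm q k * (q * 1/suc k) ∣          ≡⟨ ∣p*q∣≡∣p∣*∣q∣ (expTerm q k) (q * 1/suc k) ⟩
  ∣ expTerm q k ∣ * ∣ q * 1/suc k ∣        ≡⟨ cong (∣ expTerm q k ∣ *_) (∣p*q∣≡∣p∣*∣q∣ q (1/suc k)) ⟩
  ∣ expTerm q k ∣ * (∣ q ∣ * 1/suc k)      ≤⟨ *-mono (0≤∣p∣ (expTerm q k))
                                                (0≤-* (0≤fromℕ b) (<⇒≤ (0<1/suc k)))
                                                (∣expTerm∣≤ b q≤b k)
                                                (*-monoʳ-≤-nonNeg (1/suc k) q≤b) ⟩
  expTerm (fromℕ b) k * (fromℕ b * 1/suc k) ∎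
  where open ≤-Reasoning

expTerm-halves : ∀ b k → b ℕ.+ b ℕ.≤ k → expTerm (fromℕ b) (suc k) ≤ ½ * expTerm (fromℕ b) k
expTerm-halves b k 2b≤k = begin
  t * (B * r)  ≤⟨ *-monoˡ-≤-nonNeg t {{nonNegative (0≤expTerm b k)}} Br≤½ ⟩
  t * ½        ≡⟨ *-comm t ½ ⟩
  ½ * t        ∎
  where
  open ≤-Reasoning
  t = expTerm (fromℕ b) k
  B = fromℕ b
  r = 1/suc k
  Br≤½ : B * r ≤ ½
  Br≤½ = begin
    B * r                           ≡⟨ sym (½+½ (B * r)) ⟩
    ½ * (B * r) + ½ * (B * r)       ≡⟨ solve 3 (λ h b r → h :* (b :* r) :+ h :* (b :* r) := h :* ((b :+ b) :* r)) refl ½ B r ⟩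
    ½ * ((B + B) * r)               ≡⟨ cong (λ z → ½ * (z * r)) (sym (fromℕ-+ b b)) ⟩
    ½ * (fromℕ (b ℕ.+ b) * r)       ≤⟨ *-monoˡ-≤-nonNeg ½ (*-monoʳ-≤-nonNeg r (fromℕ-mono (ℕ.m≤n⇒m≤1+n 2b≤k))) ⟩
    ½ * (fromℕ (suc k) * r)         ≡⟨ cong (½ *_) (suc*1/suc k) ⟩
    ½                               ∎

expSeries-tail : ∀ c → (∀ k → ∣ c k ∣ ≤ 1ℚ) → ∀ b N → b ℕ.+ b ℕ.≤ N → ∀ {q} → ∣ q ∣ ≤ fromℕ b → ∀ j →
  ∣ expSeries c q (j ℕ.+ N) - expSeries c q N ∣ + (expTerm (fromℕ b) (j ℕ.+ N) + expTerm (fromℕ b) (j ℕ.+ N))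
    ≤ expTerm (fromℕ b) N + expTerm (fromℕ b) N
expSeries-tail c c≤1 b N 2b≤N {q} q≤b zero = ≤-reflexive (trans
  (cong (λ z → ∣ z ∣ + (expTerm (fromℕ b) N + expTerm (fromℕ b) N)) (+-inverseʳ (expSeries c q N)))
  (+-identityˡ (expTerm (fromℕ b) N + expTerm (fromℕ b) N)))
expSeries-tail c c≤1 b N 2b≤N {q} q≤b (suc j) = begin
  ∣ (S + u) - S₀ ∣ + (t′ + t′)
    ≤⟨ +-mono-≤ (subst (λ z → ∣ z ∣ ≤ ∣ S - S₀ ∣ + ∣ u ∣)
                  (solve 3 (λ s u z → (s :- z) :+ u := (s :+ u) :- z) refl S u S₀)
                  (∣p+q∣≤∣p∣+∣q∣ (S - S₀) u))
         (≤-trans (+-mono-≤ t′≤ t′≤) (≤-reflexive (½+½ t))) ⟩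
  (∣ S - S₀ ∣ + ∣ u ∣) + t
    ≤⟨ +-monoˡ-≤ t (+-monoʳ-≤ ∣ S - S₀ ∣ u≤t) ⟩
  (∣ S - S₀ ∣ + t) + t
    ≡⟨ +-assoc ∣ S - S₀ ∣ t t ⟩
  ∣ S - S₀ ∣ + (t + t)
    ≤⟨ expSeries-tail c c≤1 b N 2b≤N q≤b j ⟩
  expTerm (fromℕ b) N + expTerm (fromℕ b) N ∎
  where
  open ≤-Reasoning
  k  = j ℕ.+ N
  S₀ = expSeries c q N
  S  = expSeries c q k
  t  = expTerm (fromℕ b) k
  t′ = expTerm (fromℕ b) (suc k)
  u  = c k * expTerm q k
  t′≤ : t′ ≤ ½ * t
  t′≤ = expTerm-halves b k (ℕ.≤-trans 2b≤N (ℕ.m≤n+m N j))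
  u≤t : ∣ u ∣ ≤ t
  u≤t = ≤-trans (≤-reflexive (∣p*q∣≡∣p∣*∣q∣ (c k) (expTerm q k)))
    (≤-trans (*-mono (0≤∣p∣ (c k)) (0≤expTerm b k) (c≤1 k) (∣expTerm∣≤ b q≤b k))
      (≤-reflexive (*-identityˡ t)))

expTerm-decay : ∀ b N → b ℕ.+ b ℕ.≤ N → ∀ j →
  expTerm (fromℕ b) (j ℕ.+ N) * fromℕ (suc j) ≤ expTerm (fromℕ b) N
expTerm-decay b N 2b≤N zero    = ≤-reflexive (*-identityʳ (expTerm (fromℕ b) N))
expTerm-decay b N 2b≤N (suc j) = begin
  t′ * fromℕ (suc (suc j))
    ≤⟨ *-monoʳ-≤-nonNeg (fromℕ (suc (suc j))) (expTerm-halves b (j ℕ.+ N) (ℕ.≤-trans 2b≤N (ℕ.m≤n+m N j))) ⟩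
  ½ * t * fromℕ (suc (suc j))
    ≡⟨ trans (cong (_* fromℕ (suc (suc j))) (*-comm ½ t)) (*-assoc t ½ (fromℕ (suc (suc j)))) ⟩
  t * (½ * fromℕ (suc (suc j)))
    ≤⟨ *-monoˡ-≤-nonNeg t {{nonNegative (0≤expTerm b (j ℕ.+ N))}} half ⟩
  t * fromℕ (suc j)
    ≤⟨ expTerm-decay b N 2b≤N j ⟩
  expTerm (fromℕ b) N ∎
  where
  open ≤-Reasoning
  t  = expTerm (fromℕ b) (j ℕ.+ N)
  t′ = expTerm (fromℕ b) (suc (j ℕ.+ N))
  half : ½ * fromℕ (suc (suc j)) ≤ fromℕ (suc j)
  half = begin
    ½ * fromℕ (suc (suc j))                   ≡⟨ cong (½ *_) (fromℕ-+ 1 (suc j)) ⟩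
    ½ * (fromℕ 1 + fromℕ (suc j))             ≤⟨ *-monoˡ-≤-nonNeg ½ (+-monoˡ-≤ (fromℕ (suc j)) (fromℕ-mono {1} {suc j} (ℕ.s≤s ℕ.z≤n))) ⟩
    ½ * (fromℕ (suc j) + fromℕ (suc j))       ≡⟨ *-distribˡ-+ ½ (fromℕ (suc j)) (fromℕ (suc j)) ⟩
    ½ * fromℕ (suc j) + ½ * fromℕ (suc j)     ≡⟨ ½+½ (fromℕ (suc j)) ⟩
    fromℕ (suc j)                             ∎

expTerm-small : ∀ b {ε} → 0ℚ < ε → ∃[ M ] b ℕ.+ b ℕ.≤ M × expTerm (fromℕ b) M < ε
expTerm-small b {ε} 0<ε =
  let N       = b ℕ.+ b
      j , N<  = archimedean (expTerm (fromℕ b) N) 0<ε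
  in j ℕ.+ N , ℕ.m≤n+m N j , *-cancelʳ-<-nonNeg (fromℕ (suc j))
       (≤-<-trans (expTerm-decay b N ℕ.≤-refl j)
         (subst (expTerm (fromℕ b) N <_) (*-comm (fromℕ (suc j)) ε) N<))

expSeries-converges : ∀ c → (∀ k → ∣ c k ∣ ≤ 1ℚ) → ∀ b {ε} → 0ℚ < ε →
  ∃[ M ] ∀ {q} → ∣ q ∣ ≤ fromℕ b → ∀ m → M ℕ.≤ m → ∣ expSeries c q m - expSeries c q M ∣ < ε
expSeries-converges c c≤1 b {ε} 0<ε =
  let M , 2b≤M , t< = expTerm-small b (0<½ 0<ε)
      t             = expTerm (fromℕ b)
  in M , λ {q} q≤b m M≤m → ≤-<-trans
    (subst (λ z → ∣ expSeries c q z - expSeries c q M ∣ ≤ t M + t M) (ℕ.m∸n+n≡m M≤m)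
      (≤-trans (p≤p+q (+-mono-≤ (0≤expTerm b (m ℕ.∸ M ℕ.+ M)) (0≤expTerm b (m ℕ.∸ M ℕ.+ M))))
        (expSeries-tail c c≤1 b M 2b≤M q≤b (m ℕ.∸ M))))
    (subst (t M + t M <_) (½+½ ε) (+-mono-< t< t<))
  where
  p≤p+q : ∀ {p q} → 0ℚ ≤ q → p ≤ p + q
  p≤p+q {p} {q} 0≤q = subst (_≤ p + q) (+-identityʳ p) (+-monoʳ-≤ p 0≤q)

cauchy-expTerm : ∀ {x} → Cauchy x → ∀ k → Cauchy (λ n → expTerm (x n) k)
cauchy-expTerm cx zero = cauchy-const 1ℚ
cauchy-expTerm {x} cx (suc k) = cauchy-* {λ n → expTerm (x n) k} {λ n → x n * 1/suc k}
  (cauchy-expTerm cx k) (cauchy-* {x} {λ _ → 1/suc k} cx (cauchy-const (1/suc k)))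

cauchy-expSeries-fixed : ∀ c {x} → Cauchy x → ∀ M → Cauchy (λ n → expSeries c (x n) M)
cauchy-expSeries-fixed c cx zero = cauchy-const 0ℚ
cauchy-expSeries-fixed c {x} cx (suc M) = cauchy-+ {λ n → expSeries c (x n) M} {λ n → c M * expTerm (x n) M}
  (cauchy-expSeries-fixed c cx M)
  (cauchy-* {λ _ → c M} {λ n → expTerm (x n) M} (cauchy-const (c M)) (cauchy-expTerm cx M))

cauchy-expSeries : ∀ c → (∀ k → ∣ c k ∣ ≤ 1ℚ) → ∀ {x} → Cauchy x → Cauchy (λ n → expSeries c (x n) n)
cauchy-expSeries c c≤1 {x} cx ε 0<ε =
  let h           = ½ * (½ * ε)
      0<h         = 0<½ (0<½ 0<ε)
      b , N₁ , bx = eventually-bounded cx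
      M , conv    = expSeries-converges c c≤1 (suc b) 0<h
      N₂ , fixed  = cauchy-expSeries-fixed c cx M (½ * ε) (0<½ 0<ε)
      N           = N₁ ℕ.⊔ (M ℕ.⊔ N₂)
      i : ∀ {k} → N ℕ.≤ k → N₁ ℕ.≤ k
      i = ℕ.m⊔n≤o⇒m≤o N₁ (M ℕ.⊔ N₂)
      ii : ∀ {k} → N ℕ.≤ k → M ℕ.≤ k
      ii ≤k = ℕ.m⊔n≤o⇒m≤o M N₂ (ℕ.m⊔n≤o⇒n≤o N₁ (M ℕ.⊔ N₂) ≤k)
      iii : ∀ {k} → N ℕ.≤ k → N₂ ℕ.≤ k
      iii ≤k = ℕ.m⊔n≤o⇒n≤o M N₂ (ℕ.m⊔n≤o⇒n≤o N₁ (M ℕ.⊔ N₂) ≤k)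
      S = λ k n → expSeries c (x k) n
  in N , λ m n ≤m ≤n → ≤-<-trans
    (≤-trans (∣-∣-triangle (S m m) (S m M) (S n n))
      (+-monoʳ-≤ ∣ S m m - S m M ∣ (∣-∣-triangle (S m M) (S n M) (S n n))))
    (subst (∣ S m m - S m M ∣ + (∣ S m M - S n M ∣ + ∣ S n M - S n n ∣) <_) (total ε)
      (+-mono-< (conv (<⇒≤ (bx m (i ≤m))) m (ii ≤m))
        (+-mono-< (fixed m n (iii ≤m) (iii ≤n))
          (subst (_< h) (∣-∣-sym (S n n) (S n M)) (conv (<⇒≤ (bx n (i ≤n))) n (ii ≤n))))))
  where
  total : ∀ ε → ½ * (½ * ε) + (½ * ε + ½ * (½ * ε)) ≡ ε
  total ε = trans (solve 2 (λ a b → a :+ (b :+ a) := (a :+ a) :+ b) refl (½ * (½ * ε)) (½ * ε))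
    (trans (cong (λ z → z + ½ * ε) (½+½ (½ * ε))) (½+½ ε))

-- The k-th derivatives of cos and sin at 0.
cosCoeff sinCoeff : ℕ → ℚ
cosCoeff 0             = 1ℚ
cosCoeff 1             = 0ℚ
cosCoeff (suc (suc k)) = - cosCoeff k
sinCoeff 0             = 0ℚ
sinCoeff 1             = 1ℚ
sinCoeff (suc (suc k)) = - sinCoeff k

∣cosCoeff∣≤1 : ∀ k → ∣ cosCoeff k ∣ ≤ 1ℚ
∣cosCoeff∣≤1 0             = ≤-refl
∣cosCoeff∣≤1 1             = nonNegative⁻¹ 1ℚ
∣cosCoeff∣≤1 (suc (suc k)) = ≤-trans (≤-reflexive (∣-p∣≡∣p∣ (cosCoeff k))) (∣cosCoeff∣≤1 k)

∣sinCoeff∣≤1 : ∀ k → ∣ sinCoeff k ∣ ≤ 1ℚ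
∣sinCoeff∣≤1 0             = nonNegative⁻¹ 1ℚ
∣sinCoeff∣≤1 1             = ≤-refl
∣sinCoeff∣≤1 (suc (suc k)) = ≤-trans (≤-reflexive (∣-p∣≡∣p∣ (sinCoeff k))) (∣sinCoeff∣≤1 k)

-- The n-th rational approximation is the n-th Taylor polynomial at the
-- n-th approximation of the argument.
cos sin : ℝ → ℝ
cos x = mkℝ (λ n → expSeries cosCoeff (seq x n) n) (cauchy-expSeries cosCoeff ∣cosCoeff∣≤1 {seq x} (cauchy x))
sin x = mkℝ (λ n → expSeries sinCoeff (seq x n) n) (cauchy-expSeries sinCoeff ∣sinCoeff∣≤1 {seq x} (cauchy x))

-- This determines π up to _≈ᴿ_ as the least positive zero of sin.
record IsPi (π : ℝ) : Set where
  field
    positive-π : 0ᴿ <ᴿ π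
    sin-π      : sin π ≈ᴿ 0ᴿ
    least      : ∀ x → 0ᴿ <ᴿ x → x <ᴿ π → ¬ (sin x ≈ᴿ 0ᴿ)

------------------------------------------------------------------------
-- Square root

-- The greatest k ≤ bound with (k * η) ^ 2 ≤ q, or 0 if there is none.
sqrtSearch : ℚ → ℚ → ℕ → ℕ
sqrtSearch q η zero    = zero
sqrtSearch q η (suc k) with (fromℕ (suc k) * η) * (fromℕ (suc k) * η) ≤? q
... | yes _ = suc k
... | no  _ = sqrtSearch q η k

sqrtBound : ℚ → ℕ → ℕ
sqrtBound q n = (ℤ.∣ ↥ q ∣ ℕ.+ 1) ℕ.* suc n

-- √ (q ⊔ 0) rounded down to a multiple of 1 / (n + 1).
sqrtℚ : ℚ → ℕ → ℚ
sqrtℚ q n = fromℕ (sqrtSearch q (1/suc n) (sqrtBound q n)) * 1/suc n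

sqrtSearch-lower : ∀ q η k → let r = sqrtSearch q η k in r ≡ 0 ⊎ (fromℕ r * η) * (fromℕ r * η) ≤ q
sqrtSearch-lower q η zero = inj₁ refl
sqrtSearch-lower q η (suc k) with (fromℕ (suc k) * η) * (fromℕ (suc k) * η) ≤? q
... | yes ≤q = inj₂ ≤q
... | no  _  = sqrtSearch-lower q η k

sqrtSearch-upper : ∀ q η k → q < (fromℕ (suc k) * η) * (fromℕ (suc k) * η) →
  let r = sqrtSearch q η k in q < (fromℕ (suc r) * η) * (fromℕ (suc r) * η)
sqrtSearch-upper q η zero    q< = q<
sqrtSearch-upper q η (suc k) q< with (fromℕ (suc k) * η) * (fromℕ (suc k) * η) ≤? q
... | yes _  = q<
... | no  ≰q = sqrtSearch-upper q η k (≰⇒> ≰q)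

0≤sqrtℚ : ∀ q n → 0ℚ ≤ sqrtℚ q n
0≤sqrtℚ q n = 0≤-* (0≤fromℕ (sqrtSearch q (1/suc n) (sqrtBound q n))) (<⇒≤ (0<1/suc n))

sqrtℚ-lower : ∀ q n → sqrtℚ q n ≡ 0ℚ ⊎ sqrtℚ q n * sqrtℚ q n ≤ q
sqrtℚ-lower q n with sqrtSearch-lower q (1/suc n) (sqrtBound q n)
... | inj₁ eq = inj₁ (trans (cong (λ r → fromℕ r * 1/suc n) eq) (*-zeroˡ (1/suc n)))
... | inj₂ ≤q = inj₂ ≤q

sqrtBound-large : ∀ q n → let k = sqrtBound q n in
  q < (fromℕ (suc k) * 1/suc n) * (fromℕ (suc k) * 1/suc n)
sqrtBound-large q n = begin-strict
  q                        ≤⟨ q≤∣↥q∣ q ⟩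
  fromℕ a                  <⟨ subst₂ _<_ (+-identityʳ (fromℕ a)) (sym (fromℕ-+ a 1)) (+-monoʳ-< (fromℕ a) (positive⁻¹ 1ℚ)) ⟩
  C                        ≡⟨ sym (*-identityʳ C) ⟩
  C * 1ℚ                   ≤⟨ *-mono (0≤fromℕ (a ℕ.+ 1)) 0≤K C≤K (≤-trans (fromℕ-mono {1} {a ℕ.+ 1} (ℕ.m≤n+m 1 a)) C≤K) ⟩
  K * K                    ∎
  where
  open ≤-Reasoning
  a = ℤ.∣ ↥ q ∣
  C = fromℕ (a ℕ.+ 1)
  K = fromℕ (suc (sqrtBound q n)) * 1/suc n
  C≤K : C ≤ K
  C≤K = begin
    C                                        ≡⟨ sym (*-identityʳ C) ⟩
    C * 1ℚ                                   ≡⟨ cong (C *_) (sym (suc*1/suc n)) ⟩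
    C * (fromℕ (suc n) * 1/suc n)            ≡⟨ sym (*-assoc C (fromℕ (suc n)) (1/suc n)) ⟩
    (C * fromℕ (suc n)) * 1/suc n            ≡⟨ cong (_* 1/suc n) (sym (fromℕ-* (a ℕ.+ 1) (suc n))) ⟩
    fromℕ ((a ℕ.+ 1) ℕ.* suc n) * 1/suc n        ≤⟨ *-monoʳ-≤-nonNeg (1/suc n) (fromℕ-mono (ℕ.n≤1+n (sqrtBound q n))) ⟩
    K                                        ∎
  0≤K : 0ℚ ≤ K
  0≤K = ≤-trans (0≤fromℕ (a ℕ.+ 1)) C≤K

sqrtℚ-upper : ∀ q n → q < (sqrtℚ q n + 1/suc n) * (sqrtℚ q n + 1/suc n)
sqrtℚ-upper q n = subst (λ z → q < z * z) step (sqrtSearch-upper q (1/suc n) (sqrtBound q n) (sqrtBound-large q n))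
  where
  r = sqrtSearch q (1/suc n) (sqrtBound q n)
  step : fromℕ (suc r) * 1/suc n ≡ sqrtℚ q n + 1/suc n
  step = trans (cong (_* 1/suc n) (fromℕ-+ 1 r))
    (solve 2 (λ r e → (con 1ℚ :+ r) :* e := r :* e :+ e) refl (fromℕ r) (1/suc n))

sqrtℚ-close : ∀ {p q δ} m n → 0ℚ < δ → p < q + δ * δ → sqrtℚ p m < (sqrtℚ q n + 1/suc n) + δ
sqrtℚ-close {p} {q} {δ} m n 0<δ p<q+δ² with sqrtℚ p m <? (sqrtℚ q n + 1/suc n) + δ
... | yes a<  = a<
... | no  a≮ with sqrtℚ-lower p m
...   | inj₁ a≡0 = subst (_< (sqrtℚ q n + 1/suc n) + δ) (sym a≡0)
    (+-mono-≤-< (+-mono-≤ (0≤sqrtℚ q n) (<⇒≤ (0<1/suc n))) 0<δ)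
...   | inj₂ a²≤p = ⊥-elim (<-irrefl {a * a} refl (begin-strict
    a * a                                   ≤⟨ a²≤p ⟩
    p                                       <⟨ p<q+δ² ⟩
    q + δ * δ                               ≤⟨ +-monoˡ-≤ (δ * δ) (<⇒≤ (sqrtℚ-upper q n)) ⟩
    b * b + δ * δ                           ≡⟨ sym (+-identityʳ (b * b + δ * δ)) ⟩
    (b * b + δ * δ) + 0ℚ                    ≤⟨ +-monoʳ-≤ (b * b + δ * δ) (+-mono-≤ 0≤bδ 0≤bδ) ⟩
    (b * b + δ * δ) + (b * δ + b * δ)       ≡⟨ solve 2 (λ b d → (b :* b :+ d :* d) :+ (b :* d :+ b :* d) := (b :+ d) :* (b :+ d)) refl b δ ⟩
    (b + δ) * (b + δ)                       ≤⟨ *-mono 0≤b+δ (0≤sqrtℚ p m) (≮⇒≥ a≮) (≮⇒≥ a≮) ⟩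
    a * a                                   ∎))
  where
  open ≤-Reasoning
  a = sqrtℚ p m
  b = sqrtℚ q n + 1/suc n
  0≤b : 0ℚ ≤ b
  0≤b = +-mono-≤ (0≤sqrtℚ q n) (<⇒≤ (0<1/suc n))
  0≤bδ : 0ℚ ≤ b * δ
  0≤bδ = 0≤-* 0≤b (<⇒≤ 0<δ)
  0≤b+δ : 0ℚ ≤ b + δ
  0≤b+δ = +-mono-≤ 0≤b (<⇒≤ 0<δ)

1/suc-small : ∀ {ε} → 0ℚ < ε → ∃[ N ] ∀ n → N ℕ.≤ n → 1/suc n < ε
1/suc-small {ε} 0<ε =
  let j , 1< = archimedean 1ℚ 0<ε
  in j , λ n j≤n → *-cancelˡ-<-nonNeg (fromℕ (suc n))
    (subst (_< fromℕ (suc n) * ε) (sym (suc*1/suc n))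
      (<-≤-trans 1< (*-monoʳ-≤-nonNeg ε {{nonNegative (<⇒≤ 0<ε)}} (fromℕ-mono (ℕ.s≤s j≤n)))))

cauchy-sqrt : ∀ {x} → Cauchy x → Cauchy (λ n → sqrtℚ (x n) n)
cauchy-sqrt {x} cx ε 0<ε =
  let h         = ½ * ε
      0<h       = 0<½ 0<ε
      N₁ , hx   = cx (h * h) (0<-* 0<h 0<h)
      N₂ , η<   = 1/suc-small 0<h
      N         = N₁ ℕ.⊔ N₂
      l : ∀ {k} → N ℕ.≤ k → N₁ ℕ.≤ k
      l = ℕ.m⊔n≤o⇒m≤o N₁ N₂
      r : ∀ {k} → N ℕ.≤ k → N₂ ℕ.≤ k
      r = ℕ.m⊔n≤o⇒n≤o N₁ N₂
      one-sided : ∀ m n → N ℕ.≤ m → N ℕ.≤ n → sqrtℚ (x m) m < sqrtℚ (x n) n + ε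
      one-sided m n ≤m ≤n = <-trans (sqrtℚ-close {x m} {x n} m n 0<h (q<p+ε {x m} {x n} (hx m n (l ≤m) (l ≤n))))
        (subst ((sqrtℚ (x n) n + 1/suc n) + h <_)
          (trans (+-assoc (sqrtℚ (x n) n) h h) (cong (λ z → sqrtℚ (x n) n + z) (½+½ ε)))
          (+-monoˡ-< h (+-monoʳ-< (sqrtℚ (x n) n) (η< n (r ≤n)))))
  in N , λ m n ≤m ≤n → ∣p-q∣<ε {sqrtℚ (x m) m} {sqrtℚ (x n) n} (one-sided m n ≤m ≤n) (one-sided n m ≤n ≤m)

-- √ (max 0 x)
sqrt : ℝ → ℝ
sqrt x = mkℝ (λ n → sqrtℚ (seq x n) n) (cauchy-sqrt {seq x} (cauchy x))

------------------------------------------------------------------------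
-- Complex numbers

record ℂ : Set where
  constructor mkℂ
  field
    re im : ℝ

open ℂ public

infix  4 _≈ᶜ_
infixl 6 _+ᶜ_
infixl 7 _*ᶜ_

_≈ᶜ_ : ℂ → ℂ → Set
z ≈ᶜ w = re z ≈ᴿ re w × im z ≈ᴿ im w

fromℝ : ℝ → ℂ
fromℝ x = mkℂ x 0ᴿ

_+ᶜ_ : ℂ → ℂ → ℂ
z +ᶜ w = mkℂ (re z +ᴿ re w) (im z +ᴿ im w)

_*ᶜ_ : ℂ → ℂ → ℂ
z *ᶜ w = mkℂ (re z *ᴿ re w +ᴿ -ᴿ (im z *ᴿ im w)) (re z *ᴿ im w +ᴿ im z *ᴿ re w)

conj : ℂ → ℂ
conj z = mkℂ (re z) (-ᴿ im z)

modulus : ℂ → ℝ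
modulus z = sqrt (re z *ᴿ re z +ᴿ im z *ᴿ im z)

ℝ-rawSemiring ℂ-rawSemiring : RawSemiring 0ℓ 0ℓ
ℝ-rawSemiring = record { Carrier = ℝ ; _≈_ = _≈ᴿ_ ; _+_ = _+ᴿ_ ; _*_ = _*ᴿ_ ; 0# = 0ᴿ ; 1# = 1ᴿ }
ℂ-rawSemiring = record { Carrier = ℂ ; _≈_ = _≈ᶜ_ ; _+_ = _+ᶜ_ ; _*_ = _*ᶜ_ ; 0# = fromℝ 0ᴿ ; 1# = fromℝ 1ᴿ }

open RawSemiringDefs ℂ-rawSemiring public using () renaming (_^_ to _^ᶜ_)

-- e^{iθ}
expi : ℝ → ℂ
expi θ = mkℂ (cos θ) (sin θ)

------------------------------------------------------------------------
-- The vector space ℤₚⁿ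

ℤmod : ℕ → Set
ℤmod = Fin

Space : ℕ → ℕ → Set
Space p n = Vec (ℤmod p) n

module _ {p : ℕ} .{{_ : NonZero p}} where

  infixl 6 _⊕_
  infixl 7 _⊗_

  0ₚ : ℤmod p
  0ₚ = 0 mod p

  _⊕_ _⊗_ : ℤmod p → ℤmod p → ℤmod p
  a ⊕ b = (toℕ a ℕ.+ toℕ b) mod p
  a ⊗ b = (toℕ a ℕ.* toℕ b) mod p

  infixl 6 _+ᵛ_
  infixr 7 _·ᵛ_

  0ᵛ : ∀ {n} → Space p n
  0ᵛ = replicate _ 0ₚ

  _+ᵛ_ : ∀ {n} → Space p n → Space p n → Space p n
  _+ᵛ_ = zipWith _⊕_

  _·ᵛ_ : ∀ {n} → ℤmod p → Space p n → Space p n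
  a ·ᵛ v = Vec.map (a ⊗_) v

  ⟨_,_⟩ : ∀ {n} → Space p n → Space p n → ℤmod p
  ⟨ α , x ⟩ = foldr′ _⊕_ 0ₚ (zipWith _⊗_ α x)

  linComb : ∀ {n d} → Vec (ℤmod p) d → Vec (Space p n) d → Space p n
  linComb c b = foldr′ _+ᵛ_ 0ᵛ (zipWith _·ᵛ_ c b)

record LinearSubspace (p n : ℕ) .{{_ : NonZero p}} : Set₁ where
  field
    _∈ᴸ       : Space p n → Set
    0-closed  : 0ᵛ ∈ᴸ
    +-closed  : ∀ {v w} → v ∈ᴸ → w ∈ᴸ → (v +ᵛ w) ∈ᴸ
    ·-closed  : ∀ a {v} → v ∈ᴸ → (a ·ᵛ v) ∈ᴸ

record IsBasis {p n d : ℕ} .{{_ : NonZero p}}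
               (W : LinearSubspace p n) (b : Vec (Space p n) d) : Set where
  open LinearSubspace W
  field
    members     : All _∈ᴸ b
    independent : ∀ c → linComb c b ≡ 0ᵛ → c ≡ replicate d 0ₚ
    spanning    : ∀ {v} → v ∈ᴸ → ∃[ c ] linComb c b ≡ v

-- The coset base + direction.
record AffineSubspace (p n : ℕ) .{{_ : NonZero p}} : Set₁ where
  field
    base      : Space p n
    direction : LinearSubspace p n

infix 4 _∈ᴬ_

_∈ᴬ_ : ∀ {p n} .{{_ : NonZero p}} → Space p n → AffineSubspace p n → Set
x ∈ᴬ V = ∃[ w ] w ∈ᴸ × x ≡ base +ᵛ w
  where
  open AffineSubspace V
  open LinearSubspace direction

HasCodimension : ∀ {p n} .{{_ : NonZero p}} → AffineSubspace p n → ℕ → Set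
HasCodimension {p} {n} V k =
  ∃[ d ] Σ (Vec (Space p n) d) (IsBasis (AffineSubspace.direction V)) × d ℕ.+ k ≡ n

IsConstantOn : ∀ {p n} .{{_ : NonZero p}} {A : Set} → (Space p n → A) → AffineSubspace p n → Set
IsConstantOn f V = ∀ x y → x ∈ᴬ V → y ∈ᴬ V → f x ≡ f y

------------------------------------------------------------------------
-- Fourier analysis on ℤₚⁿ

sumOver : ∀ {c ℓ} (M : RawMonoid c ℓ) (p n : ℕ) → (Space p n → RawMonoid.Carrier M) → RawMonoid.Carrier M
sumOver M p zero    g = g []
sumOver M p (suc n) g = sum (λ a → sumOver M p n (λ v → g (a ∷ v)))
  where open import Algebra.Definitions.RawMonoid M using (sum)

fromSign : Sign → ℂ
fromSign Sign.+ = fromℝ 1ᴿ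
fromSign Sign.- = fromℝ (-ᴿ 1ᴿ)

module Fourier (π : ℝ) (p : ℕ) .{{_ : NonZero p}} where

  -- e^{2πi/p} when IsPi π
  ω : ℂ
  ω = expi (fromℚ (+ 2 / p) *ᴿ π)

  χ : ∀ {n} → Space p n → Space p n → ℂ
  χ α x = ω ^ᶜ toℕ ⟨ α , x ⟩

  𝔼 : ∀ {n} → (Space p n → ℂ) → ℂ
  𝔼 {n} g = fromℝ (fromℚ (_/_ (+ 1) (p ℕ.^ n) {{ℕ.m^n≢0 p n}})) *ᶜ sumOver (RawSemiring.+-rawMonoid ℂ-rawSemiring) p n g

  fourier : ∀ {n} → (Space p n → ℂ) → Space p n → ℂ
  fourier f α = 𝔼 (λ x → f x *ᶜ conj (χ α x))

  spectralNorm : ∀ {n} → (Space p n → ℂ) → ℝ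
  spectralNorm {n} f = sumOver (RawSemiring.+-rawMonoid ℝ-rawSemiring) p n (λ α → modulus (fourier f α))

{-# OPTIONS --safe #-}
module Submission where

{- Let f be nonconstant with Fourier coefficients F, μ = F(0), H = F off the origin and H(0) = 0 (the transform of f − μ),
and let β maximise |H|, v = |H(β)| > 0. Restricting f to the hyperplanes ⟨β,x⟩ = c adds up F, with phases, along the cosets
of ⟨β⟩. On a coset with ℓ¹-norm s, Parseval bounds the average m over c of the restricted |coefficient| by the ℓ²-norm, and
as |H| ≤ v this gives Σ |H(α)||H(α+δ)| ≤ 4v(s − m) for every shift δ ≠ 0 along the coset. Hence, with D = Σ (s − m) the
average drop of the spectral norm A,

  Σ_α |H(α)||H(α+δ)| ≤ 4vD   for every nonzero multiple δ of β.

For δ = 2β the term α = −β is v², as f is real; for δ = β the left side is at least |Σ H(α) conj H(α+β)| = 2|μ|v, as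
|f − μ|² = 1 + μ² − 2μf. So every |F(α)| is at most 4D, and 1 = Σ |F|² ≤ 4DA: some restriction has spectral norm
A′ ≤ A − 1/(4A), whence 4A′² + 1 ≤ 4A², and codimension 4A² suffices.

This argument is classical, but k ≤ 4A² is stable under double negation, and a constant flat of largest dimension can be found
by a finite search. -}

-- Subtracting the mean makes the bound by v valid on the coset through the origin as well, where
-- |F(0)| may exceed every other coefficient; the price is that F(0) is bounded separately, by the
-- autocorrelation at β. The factor 4 is 2 · 2: one 2 comes from splitting s = |F(α)| + (s -
-- |F(α)|), the other from s² - m² ≤ 2s(s - m).
--
-- Two obstacles shape the form. The order of the reals is undecidable, so a maximal coefficient or
-- a best slice is available only under double negation; the ordered ring is therefore axiomatised
-- with a stable `≤`, and "positive" is rendered as `¬ (x ≤ 0#)`. Such an x can be cancelled but not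
-- inverted, so the induction carries 4A² and never forms 1/(4A).
--
-- The analysis of π is confined to three facts about e^{2πi/p}: it has modulus 1, its p-th power is
-- 1, and it is not 1. They come from the addition theorem, sin π = 0 and the minimality of π.

open import Algebra.Bundles using (CommutativeRing)

-- A ring solver with integer coefficients

module IntegerSolver {c ℓ} (R : CommutativeRing c ℓ) where

  open import Algebra.Bundles using (RawRing)
  open import Algebra.Solver.Ring.AlmostCommutativeRing using (fromCommutativeRing; _-Raw-AlmostCommutative⟶_)
  import Algebra.Properties.AbelianGroup
  import Algebra.Properties.Ring
  import Algebra.Properties.Semiring.Mult.TCOptimised
  import Algebra.Solver.Ring
  open import Data.Integer.Base as ℤ using (ℤ; +_; -[1+_])
  import Data.Integer.Properties as ℤ
  open import Data.Maybe.Base using (Maybe; just; nothing)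
  open import Data.Nat.Base as ℕ using (ℕ; zero; suc)
  import Data.Nat.Properties as ℕ
  import Relation.Binary.PropositionalEquality as ≡
  open import Relation.Nullary using (yes; no)
  open ≡ using (_≡_)

  open CommutativeRing R
  open Algebra.Properties.Ring ring using (-‿distribˡ-*; -‿distribʳ-*; -0#≈0#)
  open Algebra.Properties.AbelianGroup +-abelianGroup using () renaming (⁻¹-involutive to -‿involutive; ⁻¹-∙-comm to -‿+-comm)
  open Algebra.Properties.Semiring.Mult.TCOptimised semiring using (_×_; ×-homo-+; ×1-homo-*)
  open import Relation.Binary.Reasoning.Setoid setoid

  private
    ⟦_⟧ℤ : ℤ → Carrier
    ⟦ + n ⟧ℤ      = n × 1#
    ⟦ -[1+ n ] ⟧ℤ = - (suc n × 1#)

    suc-× : ∀ n → suc n × 1# ≈ 1# + n × 1#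
    suc-× n = ×-homo-+ 1# 1 n

    ⊖-homo : ∀ m n → ⟦ m ℤ.⊖ n ⟧ℤ ≈ m × 1# + - (n × 1#)
    ⊖-homo zero    zero    = sym (trans (+-identityˡ _) -0#≈0#)
    ⊖-homo zero    (suc n) = sym (+-identityˡ _)
    ⊖-homo (suc m) zero    = sym (trans (+-congˡ -0#≈0#) (+-identityʳ _))
    ⊖-homo (suc m) (suc n) = begin
      ⟦ suc m ℤ.⊖ suc n ⟧ℤ  ≡⟨ ≡.cong ⟦_⟧ℤ (ℤ.[1+m]⊖[1+n]≡m⊖n m n) ⟩
      ⟦ m ℤ.⊖ n ⟧ℤ  ≈⟨ ⊖-homo m n ⟩
      m × 1# + - (n × 1#)  ≈⟨ +-identityˡ _ ⟨
      0# + (m × 1# + - (n × 1#))  ≈⟨ +-congʳ (-‿inverseʳ 1#) ⟨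
      (1# + - 1#) + (m × 1# + - (n × 1#))  ≈⟨ +-assoc _ _ _ ⟩
      1# + (- 1# + (m × 1# + - (n × 1#)))  ≈⟨ +-congˡ (+-assoc _ _ _) ⟨
      1# + ((- 1# + m × 1#) + - (n × 1#))  ≈⟨ +-congˡ (+-congʳ (+-comm _ _)) ⟩
      1# + ((m × 1# + - 1#) + - (n × 1#))  ≈⟨ +-congˡ (+-assoc _ _ _) ⟩
      1# + (m × 1# + (- 1# + - (n × 1#)))  ≈⟨ +-assoc _ _ _ ⟨
      (1# + m × 1#) + (- 1# + - (n × 1#))  ≈⟨ +-cong (sym (suc-× m)) (-‿+-comm _ _) ⟩
      suc m × 1# + - (1# + n × 1#)  ≈⟨ +-congˡ (-‿cong (suc-× n)) ⟨
      suc m × 1# + - (suc n × 1#)  ∎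

    -‿homo : ∀ i → ⟦ ℤ.- i ⟧ℤ ≈ - ⟦ i ⟧ℤ
    -‿homo (+ zero)    = sym -0#≈0#
    -‿homo (+ suc n)   = refl
    -‿homo -[1+ n ]    = sym (-‿involutive _)

    +-homo : ∀ i j → ⟦ i ℤ.+ j ⟧ℤ ≈ ⟦ i ⟧ℤ + ⟦ j ⟧ℤ
    +-homo (+ m)     (+ n)     = ×-homo-+ 1# m n
    +-homo (+ m)     -[1+ n ]  = ⊖-homo m (suc n)
    +-homo -[1+ m ]  (+ n)     = trans (⊖-homo n (suc m)) (+-comm _ _)
    +-homo -[1+ m ]  -[1+ n ]  = begin
      - (suc (suc (m ℕ.+ n)) × 1#)  ≡⟨ ≡.cong (λ k → - (k × 1#)) (≡.cong suc (ℕ.+-suc m n)) ⟨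
      - ((suc m ℕ.+ suc n) × 1#)  ≈⟨ -‿cong (×-homo-+ 1# (suc m) (suc n)) ⟩
      - (suc m × 1# + suc n × 1#)  ≈⟨ -‿+-comm _ _ ⟨
      - (suc m × 1#) + - (suc n × 1#)  ∎

    ++-homo : ∀ m n → ⟦ + m ℤ.* + n ⟧ℤ ≈ m × 1# * (n × 1#)
    ++-homo m n = trans (reflexive (≡.cong ⟦_⟧ℤ (≡.sym (ℤ.pos-* m n)))) (×1-homo-* m n)

    +*-homo : ∀ m j → ⟦ + m ℤ.* j ⟧ℤ ≈ m × 1# * ⟦ j ⟧ℤ
    +*-homo m (+ n) = ++-homo m n
    +*-homo m -[1+ n ] = begin
      ⟦ + m ℤ.* -[1+ n ] ⟧ℤ  ≡⟨ ≡.cong ⟦_⟧ℤ (ℤ.neg-distribʳ-* (+ m) (+ suc n)) ⟨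
      ⟦ ℤ.- (+ m ℤ.* + suc n) ⟧ℤ  ≈⟨ -‿homo (+ m ℤ.* + suc n) ⟩
      - ⟦ + m ℤ.* + suc n ⟧ℤ  ≈⟨ -‿cong (++-homo m (suc n)) ⟩
      - (m × 1# * (suc n × 1#))  ≈⟨ -‿distribʳ-* _ _ ⟩
      m × 1# * - (suc n × 1#)  ∎

    *-homo : ∀ i j → ⟦ i ℤ.* j ⟧ℤ ≈ ⟦ i ⟧ℤ * ⟦ j ⟧ℤ
    *-homo (+ m) j = +*-homo m j
    *-homo -[1+ m ] j = begin
      ⟦ -[1+ m ] ℤ.* j ⟧ℤ  ≡⟨ ≡.cong ⟦_⟧ℤ (ℤ.neg-distribˡ-* (+ suc m) j) ⟨
      ⟦ ℤ.- (+ suc m ℤ.* j) ⟧ℤ  ≈⟨ -‿homo (+ suc m ℤ.* j) ⟩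
      - ⟦ + suc m ℤ.* j ⟧ℤ  ≈⟨ -‿cong (+*-homo (suc m) j) ⟩
      - (suc m × 1# * ⟦ j ⟧ℤ)  ≈⟨ -‿distribˡ-* _ _ ⟩
      - (suc m × 1#) * ⟦ j ⟧ℤ  ∎

    homomorphism : ℤ.+-*-rawRing -Raw-AlmostCommutative⟶ fromCommutativeRing R
    homomorphism = record
      { ⟦_⟧    = ⟦_⟧ℤ
      ; +-homo = +-homo
      ; *-homo = *-homo
      ; -‿homo = -‿homo
      ; 0-homo = refl
      ; 1-homo = refl
      }

    -- Coefficients are compared as integers, because equality in `R`, for instance of reals, cannot
    -- be decided; distinct integers with equal images are simply not identified.
    _≟ℤ_ : ∀ i j → Maybe (⟦ i ⟧ℤ ≈ ⟦ j ⟧ℤ)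
    i ≟ℤ j with i ℤ.≟ j
    ... | yes i≡j = just (reflexive (≡.cong ⟦_⟧ℤ i≡j))
    ... | no  _   = nothing

  open Algebra.Solver.Ring ℤ.+-*-rawRing (fromCommutativeRing R) homomorphism _≟ℤ_ public
    using (solve; con; _:=_; _:+_; _:*_; _:-_; :-_)

open import Data.Empty using (⊥-elim)
open import Data.Fin.Base using (Fin; zero; suc; toℕ)
import Data.Fin.Properties as Fin
open import Data.Nat.Base as ℕ using (ℕ; zero; suc; NonZero)
open import Data.Nat.Primality using (Prime)
import Data.Nat.Properties as ℕ
open import Data.Product using (∃-syntax; Σ; _×_; _,_; proj₁; proj₂)
open import Data.Sign.Base using (Sign)
open import Data.Vec.Base as Vec using (Vec; []; _∷_; insertAt; replicate)
open import Function using (_∘_)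
open import Level using (0ℓ)
open import Relation.Binary.PropositionalEquality as ≡ using (_≡_; _≢_)
open import Relation.Nullary using (¬_; Dec; yes; no)

-- Arithmetic of the residue ring modulo p

module ModArith (p : ℕ) .{{_ : NonZero p}} where

  open import Defs using (ℤmod; 0ₚ; _⊕_; _⊗_)
  open import Data.Fin.Properties as Fin using (toℕ-injective; toℕ-fromℕ<; toℕ<n)
  open import Data.Integer.Base using (+_)
  open import Data.Nat.Coprimality using (prime⇒coprime; coprime-Bézout)
  open import Data.Nat.DivMod using (_mod_; _%_; m%n<n; m<n⇒m%n≡m; n%n≡0; %-distribˡ-+; %-distribˡ-*; m*n%n≡0)
  open import Data.Nat.GCD using (module Bézout)
  open import Relation.Binary.PropositionalEquality

  infix 8 ⊖_

  ⊖_ : ℤmod p → ℤmod p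
  ⊖ a = (p ℕ.∸ toℕ a) mod p

  1ₚ : ℤmod p
  1ₚ = 1 mod p

  toℕ-mod : ∀ m → toℕ (m mod p) ≡ m % p
  toℕ-mod m = toℕ-fromℕ< (m%n<n m p)

  mod-cong : ∀ {m n} → m % p ≡ n % p → m mod p ≡ n mod p
  mod-cong {m} {n} eq = toℕ-injective (trans (toℕ-mod m) (trans eq (sym (toℕ-mod n))))

  mod-toℕ : ∀ a → toℕ a mod p ≡ a
  mod-toℕ a = toℕ-injective (trans (toℕ-mod (toℕ a)) (m<n⇒m%n≡m (toℕ<n a)))

  -- Reduction is a homomorphism, and every residue is `toℕ a mod p`; the ring laws are transported
  -- from ℕ along it.
  mod-+ : ∀ m n → (m ℕ.+ n) mod p ≡ (m mod p) ⊕ (n mod p)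
  mod-+ m n = mod-cong (trans (%-distribˡ-+ m n p)
    (sym (cong₂ (λ x y → (x ℕ.+ y) % p) (toℕ-mod m) (toℕ-mod n))))

  mod-* : ∀ m n → (m ℕ.* n) mod p ≡ (m mod p) ⊗ (n mod p)
  mod-* m n = mod-cong (trans (%-distribˡ-* m n p)
    (sym (cong₂ (λ x y → (x ℕ.* y) % p) (toℕ-mod m) (toℕ-mod n))))

  ⊕-comm : ∀ a b → a ⊕ b ≡ b ⊕ a
  ⊕-comm a b = cong (_mod p) (ℕ.+-comm (toℕ a) (toℕ b))

  ⊗-comm : ∀ a b → a ⊗ b ≡ b ⊗ a
  ⊗-comm a b = cong (_mod p) (ℕ.*-comm (toℕ a) (toℕ b))

  ⊕-assoc : ∀ a b c → (a ⊕ b) ⊕ c ≡ a ⊕ (b ⊕ c)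
  ⊕-assoc a b c = begin
    (a ⊕ b) ⊕ c  ≡⟨ cong ((a ⊕ b) ⊕_) (mod-toℕ c) ⟨
    (a ⊕ b) ⊕ (toℕ c mod p)  ≡⟨ mod-+ (toℕ a ℕ.+ toℕ b) (toℕ c) ⟨
    (toℕ a ℕ.+ toℕ b ℕ.+ toℕ c) mod p  ≡⟨ cong (_mod p) (ℕ.+-assoc (toℕ a) (toℕ b) (toℕ c)) ⟩
    (toℕ a ℕ.+ (toℕ b ℕ.+ toℕ c)) mod p  ≡⟨ mod-+ (toℕ a) (toℕ b ℕ.+ toℕ c) ⟩
    (toℕ a mod p) ⊕ (b ⊕ c)  ≡⟨ cong (_⊕ (b ⊕ c)) (mod-toℕ a) ⟩
    a ⊕ (b ⊕ c)  ∎
    where open ≡-Reasoning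

  ⊗-assoc : ∀ a b c → (a ⊗ b) ⊗ c ≡ a ⊗ (b ⊗ c)
  ⊗-assoc a b c = begin
    (a ⊗ b) ⊗ c  ≡⟨ cong ((a ⊗ b) ⊗_) (mod-toℕ c) ⟨
    (a ⊗ b) ⊗ (toℕ c mod p)  ≡⟨ mod-* (toℕ a ℕ.* toℕ b) (toℕ c) ⟨
    (toℕ a ℕ.* toℕ b ℕ.* toℕ c) mod p  ≡⟨ cong (_mod p) (ℕ.*-assoc (toℕ a) (toℕ b) (toℕ c)) ⟩
    (toℕ a ℕ.* (toℕ b ℕ.* toℕ c)) mod p  ≡⟨ mod-* (toℕ a) (toℕ b ℕ.* toℕ c) ⟩
    (toℕ a mod p) ⊗ (b ⊗ c)  ≡⟨ cong (_⊗ (b ⊗ c)) (mod-toℕ a) ⟩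
    a ⊗ (b ⊗ c)  ∎
    where open ≡-Reasoning

  ⊗-distribˡ-⊕ : ∀ a b c → a ⊗ (b ⊕ c) ≡ a ⊗ b ⊕ a ⊗ c
  ⊗-distribˡ-⊕ a b c = begin
    a ⊗ (b ⊕ c)  ≡⟨ cong (_⊗ (b ⊕ c)) (mod-toℕ a) ⟨
    (toℕ a mod p) ⊗ (b ⊕ c)  ≡⟨ mod-* (toℕ a) (toℕ b ℕ.+ toℕ c) ⟨
    (toℕ a ℕ.* (toℕ b ℕ.+ toℕ c)) mod p  ≡⟨ cong (_mod p) (ℕ.*-distribˡ-+ (toℕ a) (toℕ b) (toℕ c)) ⟩
    (toℕ a ℕ.* toℕ b ℕ.+ toℕ a ℕ.* toℕ c) mod p  ≡⟨ mod-+ (toℕ a ℕ.* toℕ b) (toℕ a ℕ.* toℕ c) ⟩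
    a ⊗ b ⊕ a ⊗ c  ∎
    where open ≡-Reasoning

  ⊕-identityˡ : ∀ a → 0ₚ ⊕ a ≡ a
  ⊕-identityˡ a = trans (cong (0ₚ ⊕_) (sym (mod-toℕ a))) (trans (sym (mod-+ 0 (toℕ a))) (mod-toℕ a))

  ⊗-identityˡ : ∀ a → 1ₚ ⊗ a ≡ a
  ⊗-identityˡ a = trans (cong (1ₚ ⊗_) (sym (mod-toℕ a)))
    (trans (sym (mod-* 1 (toℕ a))) (trans (cong (_mod p) (ℕ.*-identityˡ (toℕ a))) (mod-toℕ a)))

  ⊕-inverseʳ : ∀ a → a ⊕ ⊖ a ≡ 0ₚ
  ⊕-inverseʳ a = begin
    a ⊕ ⊖ a  ≡⟨ cong (_⊕ ⊖ a) (mod-toℕ a) ⟨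
    (toℕ a mod p) ⊕ ⊖ a  ≡⟨ mod-+ (toℕ a) (p ℕ.∸ toℕ a) ⟨
    (toℕ a ℕ.+ (p ℕ.∸ toℕ a)) mod p  ≡⟨ cong (_mod p) (ℕ.m+[n∸m]≡n (ℕ.<⇒≤ (toℕ<n a))) ⟩
    p mod p  ≡⟨ mod-cong (trans (n%n≡0 p) (sym (m<n⇒m%n≡m (ℕ.>-nonZero⁻¹ p)))) ⟩
    0ₚ  ∎
    where open ≡-Reasoning

  ℤmod-commutativeRing : CommutativeRing 0ℓ 0ℓ
  ℤmod-commutativeRing = record
    { Carrier = ℤmod p ; _≈_ = _≡_ ; _+_ = _⊕_ ; _*_ = _⊗_ ; -_ = ⊖_ ; 0# = 0ₚ ; 1# = 1ₚ
    ; isCommutativeRing = record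
      { isRing = record
        { +-isAbelianGroup = record
          { isGroup = record
            { isMonoid = record
              { isSemigroup = record
                { isMagma = isMagma _⊕_
                ; assoc = ⊕-assoc }
              ; identity = ⊕-identityˡ , λ a → trans (⊕-comm a 0ₚ) (⊕-identityˡ a) }
            ; inverse = (λ a → trans (⊕-comm (⊖ a) a) (⊕-inverseʳ a)) , ⊕-inverseʳ
            ; ⁻¹-cong = cong ⊖_ }
          ; comm = ⊕-comm }
        ; *-cong = cong₂ _⊗_
        ; *-assoc = ⊗-assoc
        ; *-identity = ⊗-identityˡ , λ a → trans (⊗-comm a 1ₚ) (⊗-identityˡ a)
        ; distrib = ⊗-distribˡ-⊕ , λ a b c → trans (⊗-comm (b ⊕ c) a)
            (trans (⊗-distribˡ-⊕ a b c) (cong₂ _⊕_ (⊗-comm a b) (⊗-comm a c))) }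
      ; *-comm = ⊗-comm } }
    where open import Relation.Binary.PropositionalEquality.Algebra using (isMagma)

  toℕ-0ₚ : toℕ 0ₚ ≡ 0
  toℕ-0ₚ = trans (toℕ-mod 0) (m<n⇒m%n≡m (ℕ.>-nonZero⁻¹ p))

  invertible : Prime p → ∀ b → b ≢ 0ₚ → ∃[ b′ ] b ⊗ b′ ≡ 1ₚ
  invertible pr b b≢0 = fromBézout (coprime-Bézout (prime⇒coprime pr {{ℕ.≢-nonZero toℕb≢0}} (toℕ<n b)))
    where
    toℕb≢0 : toℕ b ≢ 0
    toℕb≢0 eq = b≢0 (toℕ-injective (trans eq (sym toℕ-0ₚ)))
    p*≡0 : ∀ x → (x ℕ.* p) mod p ≡ 0ₚ
    p*≡0 x = mod-cong (trans (m*n%n≡0 x p) (sym (m<n⇒m%n≡m (ℕ.>-nonZero⁻¹ p))))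
    b⊗ : ∀ y → (y ℕ.* toℕ b) mod p ≡ b ⊗ (y mod p)
    b⊗ y = trans (mod-* y (toℕ b)) (trans (cong ((y mod p) ⊗_) (mod-toℕ b)) (⊗-comm (y mod p) b))
    open CommutativeRing ℤmod-commutativeRing using (+-identityʳ)
    open IntegerSolver ℤmod-commutativeRing
    fromBézout : Bézout.Identity 1 p (toℕ b) → ∃[ b′ ] b ⊗ b′ ≡ 1ₚ
    -- Here the identity reads 1 + y b = x p, so the inverse is -y; in the other case 1 + x p = y b
    -- and it is y.
    fromBézout (Bézout.+- x y eq) = ⊖ (y mod p) , (begin
      b ⊗ ⊖ y′  ≡⟨ solve 3 (λ b y o → b :* (:- y) := o :- (o :+ b :* y)) refl b y′ 1ₚ ⟩
      1ₚ ⊕ ⊖ (1ₚ ⊕ b ⊗ y′)  ≡⟨ cong (λ z → 1ₚ ⊕ ⊖ z) 1+by ⟩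
      1ₚ ⊕ ⊖ 0ₚ  ≡⟨ solve 1 (λ o → o :- con (+ 0) := o) refl 1ₚ ⟩
      1ₚ  ∎)
      where
      open ≡-Reasoning
      y′ = y mod p
      1+by : 1ₚ ⊕ b ⊗ y′ ≡ 0ₚ
      1+by = trans (cong (1ₚ ⊕_) (sym (b⊗ y))) (trans (sym (mod-+ 1 (y ℕ.* toℕ b))) (trans (cong (_mod p) eq) (p*≡0 x)))
    fromBézout (Bézout.-+ x y eq) = y mod p , (begin
      b ⊗ (y mod p)  ≡⟨ b⊗ y ⟨
      (y ℕ.* toℕ b) mod p  ≡⟨ cong (_mod p) eq ⟨
      (1 ℕ.+ x ℕ.* p) mod p  ≡⟨ mod-+ 1 (x ℕ.* p) ⟩
      1ₚ ⊕ ((x ℕ.* p) mod p)  ≡⟨ cong (1ₚ ⊕_) (p*≡0 x) ⟩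
      1ₚ ⊕ 0ₚ  ≡⟨ +-identityʳ 1ₚ ⟩
      1ₚ  ∎)
      where open ≡-Reasoning

-- Vectors over ℤₚ: pivots, hyperplane slices and cosets of a line

module ModSpace (p : ℕ) .{{_ : NonZero p}} where

  open import Defs using (ℤmod; Space; 0ₚ; _⊕_; _⊗_; 0ᵛ; _+ᵛ_; _·ᵛ_; ⟨_,_⟩; linComb; LinearSubspace)
  open ModArith p
  open import Data.Integer.Base using (+_)
  open import Data.Nat.DivMod using (m<n⇒m%n≡m)
  import Data.Vec.Properties as Vec
  open import Relation.Binary.PropositionalEquality

  open IntegerSolver ℤmod-commutativeRing
  open CommutativeRing ℤmod-commutativeRing using (zeroʳ; zeroˡ; +-identityʳ; distribʳ)

  ⊕≢ : ∀ {d} → d ≢ 0ₚ → ∀ k → k ⊕ d ≢ k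
  ⊕≢ {d} d≢0 k eq = d≢0 (begin
    d  ≡⟨ solve 2 (λ k d → d := (k :+ d) :- k) refl k d ⟩
    (k ⊕ d) ⊕ ⊖ k  ≡⟨ cong (_⊕ ⊖ k) eq ⟩
    k ⊕ ⊖ k  ≡⟨ ⊕-inverseʳ k ⟩
    0ₚ  ∎)
    where open ≡-Reasoning

  -- Dividing 2b = 0 by b would give 2 = 0, against 2 < p. This is what keeps the shift 2β away from
  -- the origin.
  double≢0 : Prime p → 2 ℕ.< p → ∀ {b} → b ≢ 0ₚ → b ⊕ b ≢ 0ₚ
  double≢0 pr 2<p {b} b≢0 eq with invertible pr b b≢0
  ... | b′ , bb′≡1 = ℕ.1+n≢0 (trans (sym (trans (toℕ-mod 2) (m<n⇒m%n≡m 2<p)))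
                       (trans (cong Data.Fin.Base.toℕ (trans (mod-+ 1 1) 2≡0)) toℕ-0ₚ))
    where
    open ≡-Reasoning
    import Data.Fin.Base
    2≡0 : 1ₚ ⊕ 1ₚ ≡ 0ₚ
    2≡0 = begin
      1ₚ ⊕ 1ₚ  ≡⟨ cong₂ _⊕_ bb′≡1 bb′≡1 ⟨
      b ⊗ b′ ⊕ b ⊗ b′  ≡⟨ distribʳ b′ b b ⟨
      (b ⊕ b) ⊗ b′  ≡⟨ cong (_⊗ b′) eq ⟩
      0ₚ ⊗ b′  ≡⟨ zeroˡ b′ ⟩
      0ₚ  ∎

  ⊖ᵛ_ : ∀ {n} → Space p n → Space p n
  ⊖ᵛ_ = Vec.map ⊖_

  +ᵛ-assoc : ∀ {n} (x y z : Space p n) → (x +ᵛ y) +ᵛ z ≡ x +ᵛ (y +ᵛ z)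
  +ᵛ-assoc = Vec.zipWith-assoc ⊕-assoc

  +ᵛ-identityˡ : ∀ {n} (x : Space p n) → 0ᵛ +ᵛ x ≡ x
  +ᵛ-identityˡ = Vec.zipWith-identityˡ ⊕-identityˡ

  +ᵛ-identityʳ : ∀ {n} (x : Space p n) → x +ᵛ 0ᵛ ≡ x
  +ᵛ-identityʳ = Vec.zipWith-identityʳ +-identityʳ

  ⊖ᵛ+ᵛdouble : ∀ {n} (x : Space p n) → (⊖ᵛ x) +ᵛ (x +ᵛ x) ≡ x
  ⊖ᵛ+ᵛdouble []       = refl
  ⊖ᵛ+ᵛdouble (a ∷ x) = cong₂ _∷_ (solve 1 (λ a → (:- a) :+ (a :+ a) := a) refl a) (⊖ᵛ+ᵛdouble x)

  +ᵛ-interchange : ∀ {n} (w x y z : Space p n) → (w +ᵛ x) +ᵛ (y +ᵛ z) ≡ (w +ᵛ y) +ᵛ (x +ᵛ z)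
  +ᵛ-interchange []      []      []      []      = refl
  +ᵛ-interchange (a ∷ w) (b ∷ x) (c ∷ y) (d ∷ z) = cong₂ _∷_
    (solve 4 (λ a b c d → (a :+ b) :+ (c :+ d) := (a :+ c) :+ (b :+ d)) refl a b c d) (+ᵛ-interchange w x y z)

  ·ᵛ-zeroˡ : ∀ {n} (x : Space p n) → 0ₚ ·ᵛ x ≡ 0ᵛ
  ·ᵛ-zeroˡ []      = refl
  ·ᵛ-zeroˡ (a ∷ x) = cong₂ _∷_ (zeroˡ a) (·ᵛ-zeroˡ x)

  ·ᵛ-zeroʳ : ∀ {n} a → a ·ᵛ 0ᵛ {n = n} ≡ 0ᵛ
  ·ᵛ-zeroʳ {zero}  a = refl
  ·ᵛ-zeroʳ {suc n} a = cong₂ _∷_ (zeroʳ a) (·ᵛ-zeroʳ a)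

  ·ᵛ-distribˡ : ∀ {n} a (x y : Space p n) → a ·ᵛ (x +ᵛ y) ≡ a ·ᵛ x +ᵛ a ·ᵛ y
  ·ᵛ-distribˡ a []      []      = refl
  ·ᵛ-distribˡ a (b ∷ x) (c ∷ y) = cong₂ _∷_ (⊗-distribˡ-⊕ a b c) (·ᵛ-distribˡ a x y)

  ·ᵛ-distribʳ : ∀ {n} a b (x : Space p n) → (a ⊕ b) ·ᵛ x ≡ a ·ᵛ x +ᵛ b ·ᵛ x
  ·ᵛ-distribʳ a b []      = refl
  ·ᵛ-distribʳ a b (c ∷ x) = cong₂ _∷_ (distribʳ c a b) (·ᵛ-distribʳ a b x)

  ·ᵛ-assoc : ∀ {n} a b (x : Space p n) → (a ⊗ b) ·ᵛ x ≡ a ·ᵛ (b ·ᵛ x)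
  ·ᵛ-assoc a b []      = refl
  ·ᵛ-assoc a b (c ∷ x) = cong₂ _∷_ (⊗-assoc a b c) (·ᵛ-assoc a b x)

  ·ᵛ-identity : ∀ {n} (x : Space p n) → 1ₚ ·ᵛ x ≡ x
  ·ᵛ-identity []      = refl
  ·ᵛ-identity (c ∷ x) = cong₂ _∷_ (⊗-identityˡ c) (·ᵛ-identity x)

  ⟨⟩-+ˡ : ∀ {n} (α β x : Space p n) → ⟨ α +ᵛ β , x ⟩ ≡ ⟨ α , x ⟩ ⊕ ⟨ β , x ⟩
  ⟨⟩-+ˡ []      []      []      = sym (⊕-identityˡ 0ₚ)
  ⟨⟩-+ˡ (a ∷ α) (b ∷ β) (c ∷ x) = trans (cong ((a ⊕ b) ⊗ c ⊕_) (⟨⟩-+ˡ α β x))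
    (solve 5 (λ a b c u v → (a :+ b) :* c :+ (u :+ v) := (a :* c :+ u) :+ (b :* c :+ v)) refl a b c ⟨ α , x ⟩ ⟨ β , x ⟩)

  ⟨⟩-·ˡ : ∀ {n} a (α x : Space p n) → ⟨ a ·ᵛ α , x ⟩ ≡ a ⊗ ⟨ α , x ⟩
  ⟨⟩-·ˡ a []      []      = sym (zeroʳ a)
  ⟨⟩-·ˡ a (b ∷ α) (c ∷ x) = trans (cong ((a ⊗ b) ⊗ c ⊕_) (⟨⟩-·ˡ a α x))
    (solve 4 (λ a b c u → (a :* b) :* c :+ a :* u := a :* (b :* c :+ u)) refl a b c ⟨ α , x ⟩)

  ⟨⟩-⊖ˡ : ∀ {n} (α x : Space p n) → ⟨ ⊖ᵛ α , x ⟩ ≡ ⊖ ⟨ α , x ⟩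
  ⟨⟩-⊖ˡ []      []      = solve 0 (con (+ 0) := :- con (+ 0)) refl
  ⟨⟩-⊖ˡ (a ∷ α) (c ∷ x) = trans (cong ((⊖ a) ⊗ c ⊕_) (⟨⟩-⊖ˡ α x))
    (solve 3 (λ a c u → (:- a) :* c :+ (:- u) := :- (a :* c :+ u)) refl a c ⟨ α , x ⟩)

  ⟨⟩-zeroˡ : ∀ {n} (x : Space p n) → ⟨ 0ᵛ , x ⟩ ≡ 0ₚ
  ⟨⟩-zeroˡ []      = refl
  ⟨⟩-zeroˡ (c ∷ x) = trans (cong₂ _⊕_ (zeroˡ c) (⟨⟩-zeroˡ x)) (⊕-identityˡ 0ₚ)

  ⟨⟩-comm : ∀ {n} (α x : Space p n) → ⟨ α , x ⟩ ≡ ⟨ x , α ⟩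
  ⟨⟩-comm []      []      = refl
  ⟨⟩-comm (a ∷ α) (c ∷ x) = cong₂ _⊕_ (⊗-comm a c) (⟨⟩-comm α x)

  ⟨⟩-+ʳ : ∀ {n} (α x y : Space p n) → ⟨ α , x +ᵛ y ⟩ ≡ ⟨ α , x ⟩ ⊕ ⟨ α , y ⟩
  ⟨⟩-+ʳ α x y = trans (⟨⟩-comm α (x +ᵛ y)) (trans (⟨⟩-+ˡ x y α) (cong₂ _⊕_ (⟨⟩-comm x α) (⟨⟩-comm y α)))

  ⟨⟩-·ʳ : ∀ {n} a (α x : Space p n) → ⟨ α , a ·ᵛ x ⟩ ≡ a ⊗ ⟨ α , x ⟩
  ⟨⟩-·ʳ a α x = trans (⟨⟩-comm α (a ·ᵛ x)) (trans (⟨⟩-·ˡ a x α) (cong (a ⊗_) (⟨⟩-comm x α)))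

  insertAt-+ᵛ : ∀ {n} (x y : Space p n) i a b → insertAt x i a +ᵛ insertAt y i b ≡ insertAt (x +ᵛ y) i (a ⊕ b)
  insertAt-+ᵛ x       y       zero    a b = refl
  insertAt-+ᵛ (c ∷ x) (d ∷ y) (suc i) a b = cong ((c ⊕ d) ∷_) (insertAt-+ᵛ x y i a b)

  insertAt-·ᵛ : ∀ {n} c (x : Space p n) i a → c ·ᵛ insertAt x i a ≡ insertAt (c ·ᵛ x) i (c ⊗ a)
  insertAt-·ᵛ c x i a = Vec.map-insertAt (c ⊗_) a x i

  insertAt-0ᵛ : ∀ {n} i → insertAt (0ᵛ {n = n}) i 0ₚ ≡ 0ᵛ
  insertAt-0ᵛ {n}     zero    = refl
  insertAt-0ᵛ {suc n} (suc i) = cong (0ₚ ∷_) (insertAt-0ᵛ i)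

  insertAt-⟨⟩ : ∀ {n} (α x : Space p n) i a b → ⟨ insertAt α i a , insertAt x i b ⟩ ≡ a ⊗ b ⊕ ⟨ α , x ⟩
  insertAt-⟨⟩ α       x       zero    a b = refl
  insertAt-⟨⟩ (c ∷ α) (d ∷ x) (suc i) a b = trans (cong (c ⊗ d ⊕_) (insertAt-⟨⟩ α x i a b))
    (solve 3 (λ u v w → u :+ (v :+ w) := v :+ (u :+ w)) refl (c ⊗ d) (a ⊗ b) ⟨ α , x ⟩)

  -- A nonzero vector is b · (τ with 1 inserted at the pivot i).
  pivot : Prime p → ∀ {n} (β : Space p (suc n)) → β ≢ 0ᵛ →
    ∃[ i ] ∃[ τ ] ∃[ b ] b ≢ 0ₚ × β ≡ insertAt (b ·ᵛ τ) i b
  pivot pr (b ∷ β) β≢0 with b Fin.≟ 0ₚ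
  ... | no b≢0 with invertible pr b b≢0
  ...   | b′ , bb′≡1 = zero , b′ ·ᵛ β , b , b≢0 , cong (b ∷_)
          (trans (sym (·ᵛ-identity β)) (trans (cong (_·ᵛ β) (sym bb′≡1)) (·ᵛ-assoc b b′ β)))
  pivot pr {zero}  (b ∷ []) β≢0 | yes b≡0 = ⊥-elim (β≢0 (cong (_∷ []) b≡0))
  pivot pr {suc n} (b ∷ β)  β≢0 | yes b≡0 with pivot pr β (λ β≡0 → β≢0 (cong₂ _∷_ b≡0 β≡0))
  ... | i , τ , c , c≢0 , eq = suc i , 0ₚ ∷ τ , c , c≢0 , cong₂ _∷_ (trans b≡0 (sym (zeroʳ c))) eq

  linComb-+ : ∀ {n d} (c e : Vec (ℤmod p) d) (b : Vec (Space p n) d) →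
    linComb c b +ᵛ linComb e b ≡ linComb (Vec.zipWith _⊕_ c e) b
  linComb-+ []      []      []      = +ᵛ-identityˡ 0ᵛ
  linComb-+ (c ∷ cs) (e ∷ es) (v ∷ b) = begin
    (c ·ᵛ v +ᵛ linComb cs b) +ᵛ (e ·ᵛ v +ᵛ linComb es b)  ≡⟨ +ᵛ-interchange (c ·ᵛ v) (linComb cs b) (e ·ᵛ v) (linComb es b) ⟩
    (c ·ᵛ v +ᵛ e ·ᵛ v) +ᵛ (linComb cs b +ᵛ linComb es b)  ≡⟨ cong₂ _+ᵛ_ (sym (·ᵛ-distribʳ c e v)) (linComb-+ cs es b) ⟩
    (c ⊕ e) ·ᵛ v +ᵛ linComb (Vec.zipWith _⊕_ cs es) b  ∎
    where open ≡-Reasoning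

  linComb-0 : ∀ {n d} (b : Vec (Space p n) d) → linComb (replicate d 0ₚ) b ≡ 0ᵛ
  linComb-0 []      = refl
  linComb-0 (v ∷ b) = trans (cong₂ _+ᵛ_ (·ᵛ-zeroˡ v) (linComb-0 b)) (+ᵛ-identityˡ 0ᵛ)

  record IsLinear {m n} (L : Space p m → Space p n) : Set where
    field
      +-homo : ∀ x y → L (x +ᵛ y) ≡ L x +ᵛ L y
      ·-homo : ∀ a x → L (a ·ᵛ x) ≡ a ·ᵛ L x

    0-homo : L 0ᵛ ≡ 0ᵛ
    0-homo = trans (cong L (sym (·ᵛ-zeroˡ 0ᵛ))) (trans (·-homo 0ₚ 0ᵛ) (·ᵛ-zeroˡ (L 0ᵛ)))

    linComb-map : ∀ {d} c (b : Vec (Space p m) d) → linComb c (Vec.map L b) ≡ L (linComb c b)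
    linComb-map []       []      = sym 0-homo
    linComb-map (c ∷ cs) (v ∷ b) = trans (cong₂ _+ᵛ_ (sym (·-homo c v)) (linComb-map cs b))
      (sym (+-homo (c ·ᵛ v) (linComb cs b)))

  linComb-· : ∀ {n d} a (c : Vec (ℤmod p) d) (b : Vec (Space p n) d) → a ·ᵛ linComb c b ≡ linComb (Vec.map (a ⊗_) c) b
  linComb-· a []       []      = ·ᵛ-zeroʳ a
  linComb-· a (c ∷ cs) (v ∷ b) = trans (·ᵛ-distribˡ a (c ·ᵛ v) (linComb cs b))
    (cong₂ _+ᵛ_ (sym (·ᵛ-assoc a c v)) (linComb-· a cs b))

  span : ∀ {n d} → Vec (Space p n) d → LinearSubspace p n
  span b = record
    { _∈ᴸ      = λ v → ∃[ c ] linComb c b ≡ v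
    ; 0-closed = replicate _ 0ₚ , linComb-0 b
    ; +-closed = λ { (c , refl) (e , refl) → Vec.zipWith _⊕_ c e , sym (linComb-+ c e b) }
    ; ·-closed = λ { a (c , refl) → Vec.map (a ⊗_) c , sym (linComb-· a c b) }
    }

  -- slice i τ c parametrises the hyperplane xᵢ + ⟨τ , x without xᵢ⟩ = c.
  slice : ∀ {n} → Fin (suc n) → Space p n → ℤmod p → Space p n → Space p (suc n)
  slice i τ c y = insertAt y i (c ⊕ ⊖ ⟨ τ , y ⟩)

  slice-linear : ∀ {n} i (τ : Space p n) → IsLinear (slice i τ 0ₚ)
  slice-linear i τ = record
    { +-homo = λ x y → trans
        (cong (insertAt (x +ᵛ y) i) (trans (cong (λ t → 0ₚ ⊕ ⊖ t) (⟨⟩-+ʳ τ x y))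
          (solve 2 (λ u v → con (+ 0) :- (u :+ v) := (con (+ 0) :- u) :+ (con (+ 0) :- v)) refl ⟨ τ , x ⟩ ⟨ τ , y ⟩)))
        (sym (insertAt-+ᵛ x y i _ _))
    ; ·-homo = λ a x → trans
        (cong (insertAt (a ·ᵛ x) i) (trans (cong (λ t → 0ₚ ⊕ ⊖ t) (⟨⟩-·ʳ a τ x))
          (solve 2 (λ a u → con (+ 0) :- a :* u := a :* (con (+ 0) :- u)) refl a ⟨ τ , x ⟩)))
        (sym (insertAt-·ᵛ a x i _))
    }

  slice-affine : ∀ {n} i (τ : Space p n) c x y → slice i τ c (x +ᵛ y) ≡ slice i τ c x +ᵛ slice i τ 0ₚ y
  slice-affine i τ c x y = trans
    (cong (insertAt (x +ᵛ y) i) (trans (cong (λ t → c ⊕ ⊖ t) (⟨⟩-+ʳ τ x y))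
      (solve 3 (λ c u v → c :- (u :+ v) := (c :- u) :+ (con (+ 0) :- v)) refl c ⟨ τ , x ⟩ ⟨ τ , y ⟩)))
    (sym (insertAt-+ᵛ x y i _ _))

  slice-injective : ∀ {n} i (τ : Space p n) x → slice i τ 0ₚ x ≡ 0ᵛ → x ≡ 0ᵛ
  slice-injective i τ x eq = trans (sym (Vec.removeAt-insertAt x i _))
    (trans (cong (λ z → Vec.removeAt z i) (trans eq (sym (insertAt-0ᵛ i)))) (Vec.removeAt-insertAt 0ᵛ i 0ₚ))

  -- As k varies, `insertAt (η +ᵛ k ·ᵛ τ) i k` runs through a coset of the line spanned by (τ with 1
  -- inserted at i), k being its i-th coordinate; adding a multiple of the generator therefore just
  -- translates k.
  line-shift : ∀ {n} i (η τ : Space p n) k d →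
    insertAt (η +ᵛ k ·ᵛ τ) i k +ᵛ insertAt (d ·ᵛ τ) i d ≡ insertAt (η +ᵛ (k ⊕ d) ·ᵛ τ) i (k ⊕ d)
  line-shift i η τ k d = trans (insertAt-+ᵛ (η +ᵛ k ·ᵛ τ) (d ·ᵛ τ) i k d)
    (cong (λ z → insertAt z i (k ⊕ d)) (trans (+ᵛ-assoc η (k ·ᵛ τ) (d ·ᵛ τ))
      (cong (η +ᵛ_) (sym (·ᵛ-distribʳ k d τ)))))

  -- The terms k⟨τ , y⟩ cancel. On a slice all frequencies of one coset thus become the single
  -- frequency η, up to a phase k c that is constant on the slice.
  line-slice : ∀ {n} i (η τ : Space p n) k c y →
    ⟨ insertAt (η +ᵛ k ·ᵛ τ) i k , slice i τ c y ⟩ ≡ ⟨ η , y ⟩ ⊕ k ⊗ c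
  line-slice i η τ k c y = trans (insertAt-⟨⟩ (η +ᵛ k ·ᵛ τ) y i k _)
    (trans (cong (k ⊗ (c ⊕ ⊖ ⟨ τ , y ⟩) ⊕_) (trans (⟨⟩-+ˡ η (k ·ᵛ τ) y) (cong (⟨ η , y ⟩ ⊕_) (⟨⟩-·ˡ k τ y))))
      (solve 4 (λ k c t e → k :* (c :- t) :+ (e :+ k :* t) := e :+ k :* c) refl k c ⟨ τ , y ⟩ ⟨ η , y ⟩))

-- Flats on which a function is constant, found by finite search

module ConstantFlats (p : ℕ) .{{_ : NonZero p}} where

  open import Defs using (Space; 0ₚ; 0ᵛ; _+ᵛ_; _·ᵛ_; linComb; AffineSubspace; HasCodimension; IsConstantOn)
  open ModArith p
  open ModSpace p
  import Data.Sign.Properties as Sign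
  import Data.Vec.Properties as Vec
  open import Data.Vec.Relation.Unary.All as All using (All; []; _∷_)
  open import Relation.Nullary using (¬?; _×-dec_; _→-dec_)
  open import Relation.Nullary.Decidable using (map′; decidable-stable)
  open import Relation.Unary using (Decidable)
  open import Relation.Binary.PropositionalEquality

  -- Finiteness, in a form that passes from residues to vectors, and from vectors to tuples of
  -- vectors.
  Searchable : Set → Set₁
  Searchable A = ∀ {P : A → Set} → Decidable P → Dec (∃[ x ] P x)

  search-all : ∀ {A} → Searchable A → {P : A → Set} → Decidable P → Dec (∀ x → P x)
  search-all search P? with search (¬? ∘ P?)
  ... | yes (x , ¬Px) = no λ ∀P → ¬Px (∀P x)
  ... | no  ¬∃       = yes λ x → decidable-stable (P? x) λ ¬Px → ¬∃ (x , ¬Px)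

  search-Vec : ∀ {A} → Searchable A → ∀ {n} → Searchable (Vec A n)
  search-Vec search {zero}  P? = map′ ([] ,_) (λ { ([] , P[]) → P[] }) (P? [])
  search-Vec search {suc n} P? = map′ (λ { (x , xs , Pxs) → x ∷ xs , Pxs }) (λ { (x ∷ xs , Pxs) → x , xs , Pxs })
    (search λ x → search-Vec search λ xs → P? (x ∷ xs))

  search-Space : ∀ {n} → Searchable (Space p n)
  search-Space = search-Vec Fin.any?

  _≟ᵛ_ : ∀ {n} (x y : Space p n) → Dec (x ≡ y)
  _≟ᵛ_ = Vec.≡-dec Fin._≟_

  Independent : ∀ {n d} → Vec (Space p n) d → Set
  Independent {d = d} b = ∀ c → linComb c b ≡ 0ᵛ → c ≡ replicate d 0ₚ

  -- A flat is encoded by a base point and a basis of its direction. This is finite data, so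
  -- existence is decidable, whereas membership in an `AffineSubspace` is an arbitrary predicate.
  ConstantFlat : ∀ {n d} → (Space p n → Sign) → Space p n → Vec (Space p n) d → Set
  ConstantFlat f base b = Independent b × ∀ c e → f (base +ᵛ linComb c b) ≡ f (base +ᵛ linComb e b)

  HasConstantFlat : ∀ {n} → (Space p n → Sign) → ℕ → Set
  HasConstantFlat {n} f d = ∃[ base ] Σ (Vec (Space p n) d) (ConstantFlat f base)

  hasConstantFlat? : ∀ {n} (f : Space p n → Sign) → Decidable (HasConstantFlat f)
  hasConstantFlat? f d = search-Space λ base → search-Vec search-Space λ b →
    search-all search-Space (λ c → linComb c b ≟ᵛ 0ᵛ →-dec c ≟ᵛ replicate d 0ₚ)
    ×-dec search-all search-Space (λ c → search-all search-Space λ e →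
      f (base +ᵛ linComb c b) Sign.≟ f (base +ᵛ linComb e b))

  standardBasis : ∀ n → Vec (Space p n) n
  standardBasis zero    = []
  standardBasis (suc n) = (1ₚ ∷ 0ᵛ) ∷ Vec.map (0ₚ ∷_) (standardBasis n)

  0∷-linear : ∀ {n} → IsLinear {n} (0ₚ ∷_)
  0∷-linear = record
    { +-homo = λ x y → cong (_∷ (x +ᵛ y)) (sym (⊕-identityˡ 0ₚ))
    ; ·-homo = λ a x → cong (_∷ (a ·ᵛ x)) (sym (zeroʳ a))
    }
    where open CommutativeRing ℤmod-commutativeRing using (zeroʳ)

  linComb-standardBasis : ∀ {n} (c : Space p n) → linComb c (standardBasis n) ≡ c
  linComb-standardBasis []      = refl
  linComb-standardBasis {suc n} (a ∷ c) = begin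
    a ·ᵛ (1ₚ ∷ 0ᵛ) +ᵛ linComb c (Vec.map (0ₚ ∷_) (standardBasis n))
      ≡⟨ cong₂ _+ᵛ_ (cong₂ _∷_ (*-identityʳ a) (·ᵛ-zeroʳ a)) (IsLinear.linComb-map 0∷-linear c (standardBasis n)) ⟩
    (a ∷ 0ᵛ) +ᵛ (0ₚ ∷ linComb c (standardBasis n))
      ≡⟨ cong₂ _∷_ (+-identityʳ a) (trans (+ᵛ-identityˡ _) (linComb-standardBasis c)) ⟩
    a ∷ c ∎
    where
    open ≡-Reasoning
    open CommutativeRing ℤmod-commutativeRing using (*-identityʳ; +-identityʳ)

  constant⇒flat : ∀ {n} (f : Space p n → Sign) → (∀ x y → f x ≡ f y) → HasConstantFlat f n
  constant⇒flat {n} f const = 0ᵛ , standardBasis n ,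
    (λ c eq → trans (sym (linComb-standardBasis c)) eq) , λ c e → const _ _

  pointFlat : ∀ {n} (f : Space p n → Sign) → HasConstantFlat f 0
  pointFlat f = 0ᵛ , [] , (λ { [] _ → refl }) , λ { [] [] → refl }

  -- The dimension is kept while the ambient dimension grows by one: each slice costs exactly one
  -- codimension. Independence survives because deleting coordinate i undoes `slice i τ 0ₚ`.
  sliceFlat : ∀ {n d} (f : Space p (suc n) → Sign) i τ c → HasConstantFlat (f ∘ slice i τ c) d → HasConstantFlat f d
  sliceFlat f i τ c (base , b , indep , const) = slice i τ c base , Vec.map (slice i τ 0ₚ) b
    , (λ e eq → indep e (slice-injective i τ (linComb e b) (trans (sym (IsLinear.linComb-map (slice-linear i τ) e b)) eq)))
    , λ e e′ → trans (cong f (eq e)) (trans (const e e′) (cong f (sym (eq e′))))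
    where
    eq : ∀ e → slice i τ c base +ᵛ linComb e (Vec.map (slice i τ 0ₚ) b) ≡ slice i τ c (base +ᵛ linComb e b)
    eq e = trans (cong (slice i τ c base +ᵛ_) (IsLinear.linComb-map (slice-linear i τ) e b))
      (sym (slice-affine i τ c base (linComb e b)))

  largest : ∀ {P : ℕ → Set} → Decidable P → P 0 → ∀ n → ∃[ d ] d ℕ.≤ n × P d × ∀ m → m ℕ.≤ n → P m → m ℕ.≤ d
  largest P? P0 zero = 0 , ℕ.z≤n , P0 , λ m m≤0 _ → m≤0
  largest P? P0 (suc n) with P? (suc n)
  ... | yes Pn = suc n , ℕ.≤-refl , Pn , λ m m≤n _ → m≤n
  ... | no ¬Pn with largest P? P0 n
  ...   | d , d≤n , Pd , max = d , ℕ.m≤n⇒m≤1+n d≤n , Pd , λ m m≤ Pm →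
          max m (ℕ.s≤s⁻¹ (ℕ.≤∧≢⇒< m≤ λ { refl → ¬Pn Pm })) Pm

  flatSubspace : ∀ {n d} → Space p n → Vec (Space p n) d → AffineSubspace p n
  flatSubspace base b = record { base = base ; direction = span b }

  basis∈span : ∀ {n d} (b : Vec (Space p n) d) → All (λ v → ∃[ c ] linComb c b ≡ v) b
  basis∈span []      = []
  basis∈span (v ∷ b) = (1ₚ ∷ replicate _ 0ₚ , trans (cong₂ _+ᵛ_ (·ᵛ-identity v) (linComb-0 b)) (+ᵛ-identityʳ v))
    ∷ All.map (λ { (c , eq) → 0ₚ ∷ c , trans (cong₂ _+ᵛ_ (·ᵛ-zeroˡ v) eq) (+ᵛ-identityˡ _) }) (basis∈span b)

  flat-codimension : ∀ {n d} (base : Space p n) (b : Vec (Space p n) d) → Independent b → d ℕ.≤ n →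
    HasCodimension (flatSubspace base b) (n ℕ.∸ d)
  flat-codimension {n} {d} base b indep d≤n = d , (b , record
    { members     = basis∈span b
    ; independent = indep
    ; spanning    = λ v∈ → v∈
    }) , ℕ.m+[n∸m]≡n d≤n

  flat-constant : ∀ {n d} {f : Space p n → Sign} {base} {b : Vec (Space p n) d} → ConstantFlat f base b →
    IsConstantOn f (flatSubspace base b)
  flat-constant (_ , const) x y (_ , (c , refl) , refl) (_ , (e , refl) , refl) = const c e

-- Sums over ℤₚⁿ and their changes of variables

module SpaceSum (p : ℕ) .{{_ : NonZero p}} (R : CommutativeRing 0ℓ 0ℓ) where

  open import Defs using (ℤmod; Space; _⊕_; _⊗_; _+ᵛ_; _·ᵛ_; ⟨_,_⟩; sumOver)
  open ModArith p
  open ModSpace p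
  import Data.Fin.Permutation as Perm

  open CommutativeRing R hiding (zero)
  open import Algebra.Properties.Ring ring using (-1*x≈-x)
  open import Algebra.Properties.Semiring.Sum semiring public
    using (sum; *-distribˡ-sum; *-distribʳ-sum; ∑-distrib-+; ∑-comm; sum-replicate-zero; sum-permute)
    renaming (sum-cong-≋ to sum-cong)
  open import Relation.Binary.Reasoning.Setoid setoid

  Σₛ : ∀ {n} → (Space p n → Carrier) → Carrier
  Σₛ {n} = sumOver +-rawMonoid p n

  sum-single : ∀ {n} c (g : Fin n → Carrier) → (∀ d → d ≢ c → g d ≈ 0#) → sum g ≈ g c
  sum-single {suc n} zero    g off = trans
    (+-congˡ (trans (sum-cong λ d → off (suc d) λ ()) (sum-replicate-zero n))) (+-identityʳ (g zero))
  sum-single {suc n} (suc c) g off = trans (+-cong (off zero λ ()) (sum-single c (g ∘ suc) λ d d≢c → off (suc d)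
    λ { ≡.refl → d≢c ≡.refl })) (+-identityˡ (g (suc c)))

  sum-translate : ∀ t (g : ℤmod p → Carrier) → sum (λ a → g (a ⊕ t)) ≈ sum g
  sum-translate t g = sym (sum-permute g (Perm.permutation (_⊕ t) (_⊕ ⊖ t)
    (λ a → solve 2 (λ a t → (a :- t) :+ t := a) ≡.refl a t)
    (λ a → solve 2 (λ a t → (a :+ t) :- t := a) ≡.refl a t)))
    where
    open IntegerSolver ℤmod-commutativeRing

  sum-scale : ∀ b b′ → b ⊗ b′ ≡ 1ₚ → ∀ (g : ℤmod p → Carrier) → sum (λ a → g (b ⊗ a)) ≈ sum g
  sum-scale b b′ bb′≡1 g = sym (sum-permute g (Perm.permutation (b ⊗_) (b′ ⊗_)
    (λ a → ≡.trans (≡.sym (⊗-assoc b b′ a)) (cancel bb′≡1 a))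
    (λ a → ≡.trans (≡.sym (⊗-assoc b′ b a)) (cancel (≡.trans (⊗-comm b′ b) bb′≡1) a))))
    where
    cancel : ∀ {c} → c ≡ 1ₚ → ∀ a → c ⊗ a ≡ a
    cancel ≡.refl = ⊗-identityˡ

  Σₛ-cong : ∀ {n} {g h : Space p n → Carrier} → (∀ x → g x ≈ h x) → Σₛ g ≈ Σₛ h
  Σₛ-cong {zero}  eq = eq []
  Σₛ-cong {suc n} eq = sum-cong λ a → Σₛ-cong λ x → eq (a ∷ x)

  Σₛ-+ : ∀ {n} (g h : Space p n → Carrier) → Σₛ (λ x → g x + h x) ≈ Σₛ g + Σₛ h
  Σₛ-+ {zero}  g h = refl
  Σₛ-+ {suc n} g h = trans (sum-cong λ a → Σₛ-+ (λ x → g (a ∷ x)) (λ x → h (a ∷ x)))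
    (∑-distrib-+ (λ a → Σₛ (λ x → g (a ∷ x))) (λ a → Σₛ (λ x → h (a ∷ x))))

  Σₛ-*ˡ : ∀ {n} c (g : Space p n → Carrier) → Σₛ (λ x → c * g x) ≈ c * Σₛ g
  Σₛ-*ˡ {zero}  c g = refl
  Σₛ-*ˡ {suc n} c g = trans (sum-cong λ a → Σₛ-*ˡ c (λ x → g (a ∷ x))) (sym (*-distribˡ-sum c (λ a → Σₛ (λ x → g (a ∷ x)))))

  Σₛ-*ʳ : ∀ {n} c (g : Space p n → Carrier) → Σₛ (λ x → g x * c) ≈ Σₛ g * c
  Σₛ-*ʳ c g = trans (Σₛ-cong λ x → *-comm (g x) c) (trans (Σₛ-*ˡ c g) (*-comm c (Σₛ g)))

  Σₛ-neg : ∀ {n} (g : Space p n → Carrier) → Σₛ (λ x → - g x) ≈ - Σₛ g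
  Σₛ-neg g = trans (Σₛ-cong λ x → sym (-1*x≈-x (g x))) (trans (Σₛ-*ˡ (- 1#) g) (-1*x≈-x (Σₛ g)))

  Σₛ-sum-comm : ∀ {n m} (G : Space p n → Fin m → Carrier) → Σₛ (λ x → sum (G x)) ≈ sum (λ a → Σₛ (λ x → G x a))
  Σₛ-sum-comm {zero}  G = refl
  Σₛ-sum-comm {suc n} G = trans (sum-cong λ b → Σₛ-sum-comm (λ x → G (b ∷ x)))
    (∑-comm (λ b a → Σₛ (λ x → G (b ∷ x) a)))

  Σₛ-insertAt : ∀ {n} i (g : Space p (suc n) → Carrier) → Σₛ g ≈ sum (λ a → Σₛ (λ y → g (insertAt y i a)))
  Σₛ-insertAt         zero    g = refl
  Σₛ-insertAt {suc n} (suc i) g = trans (sum-cong λ b → Σₛ-insertAt i (λ x → g (b ∷ x)))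
    (∑-comm (λ b a → Σₛ (λ y → g (b ∷ insertAt y i a))))

  Σₛ-translate : ∀ {n} t (g : Space p n → Carrier) → Σₛ (λ x → g (x +ᵛ t)) ≈ Σₛ g
  Σₛ-translate []      g = refl
  Σₛ-translate (b ∷ t) g = trans (sum-cong λ a → Σₛ-translate t (λ x → g ((a ⊕ b) ∷ x)))
    (sum-translate b (λ a → Σₛ (λ x → g (a ∷ x))))

  -- Summation coset by coset is a shear: for each fixed k the remaining coordinates are translated
  -- by k τ.
  Σₛ-line : ∀ {n} i τ (g : Space p (suc n) → Carrier) →
    Σₛ g ≈ Σₛ (λ η → sum (λ k → g (insertAt (η +ᵛ k ·ᵛ τ) i k)))
  Σₛ-line i τ g = begin
    Σₛ g  ≈⟨ Σₛ-insertAt i g ⟩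
    sum (λ k → Σₛ (λ η → g (insertAt η i k)))  ≈⟨ sum-cong (λ k → sym (Σₛ-translate (k ·ᵛ τ) (λ η → g (insertAt η i k)))) ⟩
    sum (λ k → Σₛ (λ η → g (insertAt (η +ᵛ k ·ᵛ τ) i k)))  ≈⟨ Σₛ-sum-comm (λ η k → g (insertAt (η +ᵛ k ·ᵛ τ) i k)) ⟨
    Σₛ (λ η → sum (λ k → g (insertAt (η +ᵛ k ·ᵛ τ) i k)))  ∎

  -- The dual shear: for each fixed y the i-th coordinate is translated by -⟨τ , y⟩.
  Σₛ-slice : ∀ {n} i τ (g : Space p (suc n) → Carrier) → Σₛ g ≈ sum (λ c → Σₛ (λ y → g (slice i τ c y)))
  Σₛ-slice i τ g = begin
    Σₛ g  ≈⟨ Σₛ-insertAt i g ⟩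
    sum (λ a → Σₛ (λ y → g (insertAt y i a)))  ≈⟨ Σₛ-sum-comm (λ y a → g (insertAt y i a)) ⟨
    Σₛ (λ y → sum (λ a → g (insertAt y i a)))  ≈⟨ Σₛ-cong (λ y → sym (sum-translate (⊖ ⟨ τ , y ⟩) (λ a → g (insertAt y i a)))) ⟩
    Σₛ (λ y → sum (λ c → g (slice i τ c y)))  ≈⟨ Σₛ-sum-comm (λ y c → g (slice i τ c y)) ⟩
    sum (λ c → Σₛ (λ y → g (slice i τ c y)))  ∎

-- Ordered rings with a stable, undecided order

module OrderedRings where

  open import Data.Integer.Base using (+_)
  open import Defs using (Space)

  -- The order is only classical up to double negation: ≤ is stable, so
  -- an inequality may be proved by contradiction and by case distinction.
  record OrderedRing : Set₁ where
    field
      commutativeRing : CommutativeRing 0ℓ 0ℓ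
    open CommutativeRing commutativeRing hiding (zero) public
    infix 4 _≤_
    field
      _≤_         : Carrier → Carrier → Set
      ≤-reflexive : ∀ {x y} → x ≈ y → x ≤ y
      ≤-trans     : ∀ {x y z} → x ≤ y → y ≤ z → x ≤ z
      ≤-antisym   : ∀ {x y} → x ≤ y → y ≤ x → x ≈ y
      +-mono-≤    : ∀ {x y u v} → x ≤ y → u ≤ v → x + u ≤ y + v
      0≤-*        : ∀ {x y} → 0# ≤ x → 0# ≤ y → 0# ≤ x * y
      ≤-stable    : ∀ {x y} → ¬ ¬ (x ≤ y) → x ≤ y
      ≰⇒≥         : ∀ {x y} → ¬ (x ≤ y) → y ≤ x
      *-cancel-0≤ : ∀ {x y} → ¬ (x ≤ 0#) → 0# ≤ x * y → 0# ≤ y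

  module OrderedRingProperties (R : OrderedRing) where

    open OrderedRing R
    open IntegerSolver commutativeRing

    ≤-refl : ∀ {x} → x ≤ x
    ≤-refl = ≤-reflexive refl

    ≤-respˡ : ∀ {x y z} → x ≈ y → x ≤ z → y ≤ z
    ≤-respˡ x≈y = ≤-trans (≤-reflexive (sym x≈y))

    ≤-respʳ : ∀ {x y z} → x ≈ y → z ≤ x → z ≤ y
    ≤-respʳ x≈y z≤x = ≤-trans z≤x (≤-reflexive x≈y)

    -- Excluded middle for `P` holds up to double negation, which a stable conclusion absorbs.
    ≤-by-cases : ∀ {P : Set} {x y} → (P → x ≤ y) → (¬ P → x ≤ y) → x ≤ y
    ≤-by-cases yes⇒ no⇒ = ≤-stable λ ¬≤ → ¬≤ (no⇒ (¬≤ ∘ yes⇒))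

    x≤y⇒0≤y-x : ∀ {x y} → x ≤ y → 0# ≤ y - x
    x≤y⇒0≤y-x {x} x≤y = ≤-respˡ (-‿inverseʳ x) (+-mono-≤ x≤y ≤-refl)

    0≤y-x⇒x≤y : ∀ {x y} → 0# ≤ y - x → x ≤ y
    0≤y-x⇒x≤y {x} {y} 0≤ = ≤-respˡ (+-identityˡ x)
      (≤-respʳ (solve 2 (λ x y → (y :- x) :+ x := y) refl x y) (+-mono-≤ 0≤ (≤-refl {x})))

    neg-mono-≤ : ∀ {x y} → x ≤ y → - y ≤ - x
    neg-mono-≤ {x} {y} x≤y = 0≤y-x⇒x≤y (≤-respʳ (solve 2 (λ x y → y :- x := (:- x) :- (:- y)) refl x y) (x≤y⇒0≤y-x x≤y))

    *-monoˡ-≤ : ∀ {c x y} → 0# ≤ c → x ≤ y → c * x ≤ c * y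
    *-monoˡ-≤ {c} {x} {y} 0≤c x≤y = 0≤y-x⇒x≤y
      (≤-respʳ (solve 3 (λ c x y → c :* (y :- x) := c :* y :- c :* x) refl c x y) (0≤-* 0≤c (x≤y⇒0≤y-x x≤y)))

    *-mono-≤ : ∀ {a b x y} → 0# ≤ a → 0# ≤ y → a ≤ b → x ≤ y → a * x ≤ b * y
    *-mono-≤ {a} {b} {x} {y} 0≤a 0≤y a≤b x≤y = ≤-trans (*-monoˡ-≤ 0≤a x≤y)
      (≤-respˡ (*-comm y a) (≤-respʳ (*-comm y b) (*-monoˡ-≤ 0≤y a≤b)))

    *-cancelˡ-≤ : ∀ {c x y} → ¬ (c ≤ 0#) → c * x ≤ c * y → x ≤ y
    *-cancelˡ-≤ {c} {x} {y} c>0 cx≤cy = 0≤y-x⇒x≤y (*-cancel-0≤ c>0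
      (≤-respʳ (solve 3 (λ c x y → c :* y :- c :* x := c :* (y :- x)) refl c x y) (x≤y⇒0≤y-x cx≤cy)))

    0≤x² : ∀ x → 0# ≤ x * x
    0≤x² x = ≤-by-cases {0# ≤ x} (λ 0≤x → 0≤-* 0≤x 0≤x)
      λ 0≰x → ≤-respʳ (solve 1 (λ x → (con (+ 0) :- x) :* (con (+ 0) :- x) := x :* x) refl x)
        (0≤-* (x≤y⇒0≤y-x (≰⇒≥ 0≰x)) (x≤y⇒0≤y-x (≰⇒≥ 0≰x)))

    0≤-+ : ∀ {x y} → 0# ≤ x → 0# ≤ y → 0# ≤ x + y
    0≤-+ 0≤x 0≤y = ≤-respˡ (+-identityˡ 0#) (+-mono-≤ 0≤x 0≤y)

    ≤-+ʳ : ∀ {x y} → 0# ≤ y → x ≤ x + y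
    ≤-+ʳ {x} 0≤y = ≤-respˡ (+-identityʳ x) (+-mono-≤ ≤-refl 0≤y)

    -- If x ≤ y failed, the positive factor x - y could be cancelled from y² - x² = (x - y)(-(x +
    -- y)) ≥ 0, leaving x ≤ -y ≤ y.
    square-cancel-≤ : ∀ {x y} → 0# ≤ y → x * x ≤ y * y → x ≤ y
    square-cancel-≤ {x} {y} 0≤y x²≤y² = ≤-stable λ x≰y →
      let 0≤-[x+y] = *-cancel-0≤ {x - y} { - (x + y)}
            (λ x-y≤0 → x≰y (0≤y-x⇒x≤y (≤-respʳ (solve 2 (λ x y → (con (+ 0)) :- (x :- y) := y :- x) refl x y) (x≤y⇒0≤y-x x-y≤0))))
            (≤-respʳ (solve 2 (λ x y → y :* y :- x :* x := (x :- y) :* (:- (x :+ y))) refl x y) (x≤y⇒0≤y-x x²≤y²))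
          x≤-y = 0≤y-x⇒x≤y (≤-respʳ (solve 2 (λ x y → :- (x :+ y) := (:- y) :- x) refl x y) 0≤-[x+y])
          -y≤y = 0≤y-x⇒x≤y (≤-respʳ (solve 1 (λ y → y :+ y := y :- (:- y)) refl y) (0≤-+ 0≤y 0≤y))
      in x≰y (≤-trans x≤-y -y≤y)

    square-injective : ∀ {x y} → 0# ≤ x → 0# ≤ y → x * x ≈ y * y → x ≈ y
    square-injective 0≤x 0≤y eq = ≤-antisym (square-cancel-≤ 0≤y (≤-reflexive eq)) (square-cancel-≤ 0≤x (≤-reflexive (sym eq)))

    x²≈0⇒x≈0 : ∀ {x} → x * x ≈ 0# → x ≈ 0#
    x²≈0⇒x≈0 {x} eq = ≤-antisym (square-cancel-≤ ≤-refl (≤-reflexive (trans eq (sym (zeroˡ 0#)))))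
      (≤-respʳ (solve 1 (λ x → :- (:- x) := x) refl x) (≤-respˡ (solve 0 (:- con (+ 0) := con (+ 0)) refl)
        (neg-mono-≤ (square-cancel-≤ { - x} ≤-refl
          (≤-reflexive (trans (solve 1 (λ x → (:- x) :* (:- x) := x :* x) refl x) (trans eq (sym (zeroˡ 0#)))))))))

    x²+y²≈0⇒x≈0 : ∀ {x y} → x * x + y * y ≈ 0# → x ≈ 0#
    x²+y²≈0⇒x≈0 {x} {y} eq = x²≈0⇒x≈0 (≤-antisym (≤-respʳ eq (≤-+ʳ (0≤x² y))) (0≤x² x))

    -- After squaring, what remains is Cauchy-Schwarz, `inner≤`; Lagrange's identity proves it with
    -- the discarded square (a d - b c)². The moduli r, s, t enter only through their squares, so no
    -- square root occurs.
    triangle : ∀ {a b c d r s t} → 0# ≤ r → 0# ≤ s →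
      r * r ≈ a * a + b * b → s * s ≈ c * c + d * d → t * t ≈ (a + c) * (a + c) + (b + d) * (b + d) → t ≤ r + s
    triangle {a} {b} {c} {d} {r} {s} {t} 0≤r 0≤s r² s² t² = square-cancel-≤ (0≤-+ 0≤r 0≤s)
      (≤-respˡ (sym (trans t² (solve 4 (λ a b c d → (a :+ c) :* (a :+ c) :+ (b :+ d) :* (b :+ d) :=
          ((a :* a :+ b :* b) :+ (c :* c :+ d :* d)) :+ ((a :* c :+ b :* d) :+ (a :* c :+ b :* d))) refl a b c d)))
        (≤-respʳ (trans (+-congʳ (+-cong (sym r²) (sym s²)))
            (solve 2 (λ r s → ((r :* r) :+ (s :* s)) :+ (r :* s :+ r :* s) := (r :+ s) :* (r :+ s)) refl r s))
          (+-mono-≤ ≤-refl (+-mono-≤ inner≤ inner≤))))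
      where
      inner≤ : a * c + b * d ≤ r * s
      inner≤ = square-cancel-≤ (0≤-* 0≤r 0≤s) (≤-respʳ
        (trans (solve 4 (λ a b c d → (a :* c :+ b :* d) :* (a :* c :+ b :* d) :+ (a :* d :- b :* c) :* (a :* d :- b :* c)
            := (a :* a :+ b :* b) :* (c :* c :+ d :* d)) refl a b c d)
          (trans (*-cong (sym r²) (sym s²)) (solve 2 (λ r s → (r :* r) :* (s :* s) := (r :* s) :* (r :* s)) refl r s)))
        (≤-+ʳ (0≤x² (a * d - b * c))))

    open import Algebra.Properties.Semiring.Sum semiring
      using (sum; sum-replicate-zero)

    sum-mono-≤ : ∀ {n} {g h : Fin n → Carrier} → (∀ i → g i ≤ h i) → sum g ≤ sum h
    sum-mono-≤ {zero}  g≤h = ≤-refl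
    sum-mono-≤ {suc n} g≤h = +-mono-≤ (g≤h zero) (sum-mono-≤ (g≤h ∘ suc))

    0≤sum : ∀ {n} {g : Fin n → Carrier} → (∀ i → 0# ≤ g i) → 0# ≤ sum g
    0≤sum {n} 0≤g = ≤-respˡ (sum-replicate-zero n) (sum-mono-≤ 0≤g)

    term≤sum : ∀ {n} {g : Fin n → Carrier} → (∀ i → 0# ≤ g i) → ∀ i → g i ≤ sum g
    term≤sum {suc n} 0≤g zero    = ≤-+ʳ (0≤sum (0≤g ∘ suc))
    term≤sum {suc n} 0≤g (suc i) = ≤-respˡ (+-identityˡ _) (+-mono-≤ (0≤g zero) (term≤sum (0≤g ∘ suc) i))

    two-terms≤sum : ∀ {n} {g : Fin n → Carrier} → (∀ i → 0# ≤ g i) → ∀ {i j} → i ≢ j → g i + g j ≤ sum g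
    two-terms≤sum 0≤g {zero}  {zero}  i≢j = ⊥-elim (i≢j ≡.refl)
    two-terms≤sum 0≤g {zero}  {suc j} i≢j = +-mono-≤ ≤-refl (term≤sum (0≤g ∘ suc) j)
    two-terms≤sum 0≤g {suc i} {zero}  i≢j = ≤-respˡ (+-comm _ _) (+-mono-≤ ≤-refl (term≤sum (0≤g ∘ suc) i))
    two-terms≤sum 0≤g {suc i} {suc j} i≢j = ≤-respˡ (+-identityˡ _)
      (+-mono-≤ (0≤g zero) (two-terms≤sum (0≤g ∘ suc) λ { ≡.refl → i≢j ≡.refl }))

    -- Whether `g zero` lies below the minimum of the rest is undecidable. If there were no
    -- minimiser at all, it could not lie below, hence would lie above by `≰⇒≥`, and the minimum of
    -- the rest would be a minimiser.
    argmin : ∀ {n} .{{_ : NonZero n}} (g : Fin n → Carrier) → ¬ ¬ (∃[ i ] ∀ j → g i ≤ g j)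
    argmin {suc zero}    g none = none (zero , λ { zero → ≤-refl })
    argmin {suc (suc n)} g none = argmin (g ∘ suc) λ { (i , min) →
      let g₀≰ : ¬ (g zero ≤ g (suc i))
          g₀≰ g₀≤ = none (zero , λ { zero → ≤-refl ; (suc j) → ≤-trans g₀≤ (min j) })
      in none (suc i , λ { zero → ≰⇒≥ g₀≰ ; (suc j) → min j }) }

    -- Double negation commutes with finite conjunctions; this collects one maximiser for each value
    -- of the first coordinate in `argmax-Space`.
    ¬¬-choice : ∀ {n} {P : Fin n → Set} → (∀ i → ¬ ¬ P i) → ¬ ¬ (∀ i → P i)
    ¬¬-choice {zero}  ¬¬P none = none λ ()
    ¬¬-choice {suc n} ¬¬P none = ¬¬P zero λ P₀ → ¬¬-choice (¬¬P ∘ suc) λ Pₛ → none λ { zero → P₀ ; (suc i) → Pₛ i }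

    argmax : ∀ {n} .{{_ : NonZero n}} (g : Fin n → Carrier) → ¬ ¬ (∃[ i ] ∀ j → g j ≤ g i)
    argmax g none = argmin (-_ ∘ g) λ { (i , min) → none (i , λ j →
      ≤-respˡ (-‿involutive (g j)) (≤-respʳ (-‿involutive (g i)) (neg-mono-≤ (min j)))) }
      where open import Algebra.Properties.AbelianGroup +-abelianGroup using () renaming (⁻¹-involutive to -‿involutive)

    module _ (p : ℕ) .{{_ : NonZero p}} where

      open SpaceSum p commutativeRing using (Σₛ)

      Σₛ-mono-≤ : ∀ {n} {g h : Space p n → Carrier} → (∀ x → g x ≤ h x) → Σₛ g ≤ Σₛ h
      Σₛ-mono-≤ {zero}  g≤h = g≤h []
      Σₛ-mono-≤ {suc n} g≤h = sum-mono-≤ λ a → Σₛ-mono-≤ λ x → g≤h (a ∷ x)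

      0≤Σₛ : ∀ {n} {g : Space p n → Carrier} → (∀ x → 0# ≤ g x) → 0# ≤ Σₛ g
      0≤Σₛ {zero}  0≤g = 0≤g []
      0≤Σₛ {suc n} 0≤g = 0≤sum λ a → 0≤Σₛ λ x → 0≤g (a ∷ x)

      term≤Σₛ : ∀ {n} {g : Space p n → Carrier} → (∀ x → 0# ≤ g x) → ∀ x → g x ≤ Σₛ g
      term≤Σₛ {zero}  0≤g []      = ≤-refl
      term≤Σₛ {suc n} {g} 0≤g (a ∷ x) = ≤-trans (term≤Σₛ {g = λ y → g (a ∷ y)} (λ y → 0≤g (a ∷ y)) x)
        (term≤sum {g = λ b → Σₛ (λ y → g (b ∷ y))} (λ b → 0≤Σₛ λ y → 0≤g (b ∷ y)) a)

      argmax-Space : ∀ {n} (g : Space p n → Carrier) → ¬ ¬ (∃[ x ] ∀ y → g y ≤ g x)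
      argmax-Space {n = zero}  g none = none ([] , λ { [] → ≤-refl })
      argmax-Space {n = suc n} g none = ¬¬-choice (λ a → argmax-Space (λ x → g (a ∷ x))) λ best →
        argmax (λ a → g (a ∷ proj₁ (best a))) λ { (a , max) → none (a ∷ proj₁ (best a) , λ { (b ∷ y) →
          ≤-trans (proj₂ (best b) y) (max b) }) }

open OrderedRings

-- Complex numbers over an ordered ring

module ComplexExtensions where

  open import Data.Integer.Base using (+_)
  open import Defs using (Space)

  -- The interface through which the Fourier argument sees ℂ over ℝ. The modulus is real-valued and
  -- is tied to conjugation by its square alone.
  record ComplexExtension (R : OrderedRing) : Set₁ where
    private module R = OrderedRing R
    field
      commutativeRing : CommutativeRing 0ℓ 0ℓ
    open CommutativeRing commutativeRing public hiding (zero)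
    field
      conj            : Carrier → Carrier
      conj-cong       : ∀ {z w} → z ≈ w → conj z ≈ conj w
      conj-+          : ∀ z w → conj (z + w) ≈ conj z + conj w
      conj-*          : ∀ z w → conj (z * w) ≈ conj z * conj w
      conj-involutive : ∀ z → conj (conj z) ≈ z
      ι               : R.Carrier → Carrier
      ι-cong          : ∀ {x y} → x R.≈ y → ι x ≈ ι y
      ι-injective     : ∀ {x y} → ι x ≈ ι y → x R.≈ y
      ι-+             : ∀ x y → ι (x R.+ y) ≈ ι x + ι y
      ι-*             : ∀ x y → ι (x R.* y) ≈ ι x * ι y
      ι-0             : ι R.0# ≈ 0#
      ι-1             : ι R.1# ≈ 1#
      conj-ι          : ∀ x → conj (ι x) ≈ ι x
      ∣_∣             : Carrier → R.Carrier
      ∣∣-cong         : ∀ {z w} → z ≈ w → ∣ z ∣ R.≈ ∣ w ∣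
      0≤∣∣            : ∀ z → R.0# R.≤ ∣ z ∣
      ∣∣²             : ∀ z → ι (∣ z ∣ R.* ∣ z ∣) ≈ z * conj z
      ∣+∣≤            : ∀ z w → ∣ z + w ∣ R.≤ ∣ z ∣ R.+ ∣ w ∣
      ∣z∣≈0⇒z≈0       : ∀ {z} → ∣ z ∣ R.≈ R.0# → z ≈ 0#

  module ComplexProperties {R : OrderedRing} (C : ComplexExtension R) where

    private module R where
      open OrderedRing R public
      open OrderedRingProperties R public
    open ComplexExtension C
    open IntegerSolver commutativeRing
    open import Relation.Binary.Reasoning.Setoid setoid
    open import Algebra.Properties.Semiring.Sum semiring using (sum) renaming (sum-cong-≋ to sum-cong)
    open import Algebra.Properties.Semiring.Sum R.semiring using () renaming (sum to sumᴿ)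

    -- Nonnegative elements with equal squares agree. The rules for the modulus of products,
    -- conjugates, negatives and reals all come from here.
    ∣∣-unique : ∀ {z r} → R.0# R.≤ r → ι (r R.* r) ≈ z * conj z → ∣ z ∣ R.≈ r
    ∣∣-unique {z} 0≤r eq = R.square-injective (0≤∣∣ z) 0≤r (ι-injective (trans (∣∣² z) (sym eq)))

    ∣*∣ : ∀ z w → ∣ z * w ∣ R.≈ ∣ z ∣ R.* ∣ w ∣
    ∣*∣ z w = ∣∣-unique (R.0≤-* (0≤∣∣ z) (0≤∣∣ w)) (begin
      ι ((∣ z ∣ R.* ∣ w ∣) R.* (∣ z ∣ R.* ∣ w ∣))  ≈⟨ ι-* _ _ ⟩
      ι (∣ z ∣ R.* ∣ w ∣) * ι (∣ z ∣ R.* ∣ w ∣)  ≈⟨ *-cong (ι-* _ _) (ι-* _ _) ⟩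
      (ι ∣ z ∣ * ι ∣ w ∣) * (ι ∣ z ∣ * ι ∣ w ∣)  ≈⟨ solve 2 (λ a b → (a :* b) :* (a :* b) := (a :* a) :* (b :* b)) refl (ι ∣ z ∣) (ι ∣ w ∣) ⟩
      (ι ∣ z ∣ * ι ∣ z ∣) * (ι ∣ w ∣ * ι ∣ w ∣)  ≈⟨ *-cong (ι-* _ _) (ι-* _ _) ⟨
      ι (∣ z ∣ R.* ∣ z ∣) * ι (∣ w ∣ R.* ∣ w ∣)  ≈⟨ *-cong (∣∣² z) (∣∣² w) ⟩
      (z * conj z) * (w * conj w)  ≈⟨ solve 4 (λ z z′ w w′ → (z :* z′) :* (w :* w′) := (z :* w) :* (z′ :* w′)) refl z (conj z) w (conj w) ⟩
      (z * w) * (conj z * conj w)  ≈⟨ *-congˡ (conj-* z w) ⟨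
      (z * w) * conj (z * w)  ∎)

    ∣conj∣ : ∀ z → ∣ conj z ∣ R.≈ ∣ z ∣
    ∣conj∣ z = ∣∣-unique (0≤∣∣ z) (trans (∣∣² z) (trans (*-comm z (conj z)) (*-congˡ (sym (conj-involutive z)))))

    ∣ι∣ : ∀ {r} → R.0# R.≤ r → ∣ ι r ∣ R.≈ r
    ∣ι∣ {r} 0≤r = ∣∣-unique 0≤r (trans (ι-* r r) (*-congˡ (sym (conj-ι r))))

    conj-0 : conj 0# ≈ 0#
    conj-0 = trans (conj-cong (sym ι-0)) (trans (conj-ι _) ι-0)

    conj-1 : conj 1# ≈ 1#
    conj-1 = trans (conj-cong (sym ι-1)) (trans (conj-ι _) ι-1)

    conj-neg : ∀ z → conj (- z) ≈ - conj z
    conj-neg z = begin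
      conj (- z)  ≈⟨ solve 2 (λ a b → a := (a :+ b) :- b) refl (conj (- z)) (conj z) ⟩
      (conj (- z) + conj z) - conj z  ≈⟨ +-congʳ (conj-+ (- z) z) ⟨
      conj (- z + z) - conj z  ≈⟨ +-congʳ (trans (conj-cong (-‿inverseˡ z)) conj-0) ⟩
      0# - conj z  ≈⟨ +-identityˡ _ ⟩
      - conj z  ∎

    conj-sum : ∀ {n} (g : Fin n → Carrier) → conj (sum g) ≈ sum (conj ∘ g)
    conj-sum {zero}  g = conj-0
    conj-sum {suc n} g = trans (conj-+ _ _) (+-congˡ (conj-sum (g ∘ suc)))

    ι-sum : ∀ {n} (g : Fin n → R.Carrier) → ι (sumᴿ g) ≈ sum (ι ∘ g)
    ι-sum {zero}  g = ι-0
    ι-sum {suc n} g = trans (ι-+ _ _) (+-congˡ (ι-sum (g ∘ suc)))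

    ∣-∣-neg : ∀ z → ∣ - z ∣ R.≈ ∣ z ∣
    ∣-∣-neg z = ∣∣-unique (0≤∣∣ z) (trans (∣∣² z) (trans
      (solve 2 (λ a b → a :* b := (:- a) :* (:- b)) refl z (conj z)) (*-congˡ (sym (conj-neg z)))))

    ∣0∣ : ∣ 0# ∣ R.≈ R.0#
    ∣0∣ = R.trans (∣∣-cong (sym ι-0)) (∣ι∣ R.≤-refl)

    ∣sum∣≤ : ∀ {n} (g : Fin n → Carrier) → ∣ sum g ∣ R.≤ sumᴿ (∣_∣ ∘ g)
    ∣sum∣≤ {zero}  g = R.≤-reflexive ∣0∣
    ∣sum∣≤ {suc n} g = R.≤-trans (∣+∣≤ _ _) (R.+-mono-≤ R.≤-refl (∣sum∣≤ (g ∘ suc)))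

    module _ (p : ℕ) .{{_ : NonZero p}} where

      open SpaceSum p commutativeRing using (Σₛ)
      open SpaceSum p R.commutativeRing using () renaming (Σₛ to Σᴿ)

      conj-Σₛ : ∀ {n} (g : Space p n → Carrier) → conj (Σₛ g) ≈ Σₛ (conj ∘ g)
      conj-Σₛ {zero}  g = refl
      conj-Σₛ {suc n} g = trans (conj-sum (λ a → Σₛ (λ x → g (a ∷ x)))) (sum-cong λ a → conj-Σₛ (λ x → g (a ∷ x)))

      ι-Σₛ : ∀ {n} (g : Space p n → R.Carrier) → ι (Σᴿ g) ≈ Σₛ (ι ∘ g)
      ι-Σₛ {zero}  g = refl
      ι-Σₛ {suc n} g = trans (ι-sum (λ a → Σᴿ (λ x → g (a ∷ x)))) (sum-cong λ a → ι-Σₛ (λ x → g (a ∷ x)))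

      ∣Σₛ∣≤ : ∀ {n} (g : Space p n → Carrier) → ∣ Σₛ g ∣ R.≤ Σᴿ (∣_∣ ∘ g)
      ∣Σₛ∣≤ {zero}  g = R.≤-refl
      ∣Σₛ∣≤ {suc n} g = R.≤-trans (∣sum∣≤ (λ a → Σₛ (λ x → g (a ∷ x)))) (R.sum-mono-≤ λ a → ∣Σₛ∣≤ (λ x → g (a ∷ x)))

open ComplexExtensions

-- Fourier transform for an abstract additive character

module AbstractFourier where

  open import Data.Integer.Base using (+_)
  open import Defs using (ℤmod; Space; 0ₚ; _⊕_; _⊗_; 0ᵛ; _+ᵛ_; _·ᵛ_; ⟨_,_⟩)

  -- `e-sum` expresses that the character is nontrivial. `p⁻¹` and `vol n` are 1/p and 1/pⁿ, given
  -- by equations in which p appears as a sum of p ones.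
  record AdditiveCharacter {R : OrderedRing} (C : ComplexExtension R) (p : ℕ) .{{_ : NonZero p}} : Set where
    private
      module R = OrderedRing R
    open ComplexExtension C
    open SpaceSum p commutativeRing using (sum)
    field
      e          : ℤmod p → Carrier
      e-⊕        : ∀ a b → e (a ⊕ b) ≈ e a * e b
      e-unit     : ∀ a → e a * conj (e a) ≈ 1#
      e-sum      : sum e ≈ 0#
      p⁻¹        : R.Carrier
      p⁻¹*p      : ι p⁻¹ * sum {p} (λ _ → 1#) ≈ 1#
      0≤p⁻¹      : R.0# R.≤ p⁻¹
      vol        : ℕ → R.Carrier
      vol-zero   : vol 0 R.≈ R.1#
      vol-suc    : ∀ n → vol (suc n) R.≈ p⁻¹ R.* vol n

  module FourierTransform {R : OrderedRing} {C : ComplexExtension R} {p : ℕ} .{{_ : NonZero p}} (prime : Prime p)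
           (character : AdditiveCharacter C p) where

    private module R where
      open OrderedRing R public
      open OrderedRingProperties R public
    open ComplexExtension C
    open ComplexProperties C
    open AdditiveCharacter character
    open ModArith p
    open ModSpace p
    open SpaceSum p commutativeRing
    open SpaceSum p R.commutativeRing using () renaming (Σₛ to Σᴿ)
    open IntegerSolver commutativeRing
    module ℤₚ = IntegerSolver ℤmod-commutativeRing
    open import Relation.Binary.Reasoning.Setoid setoid

    e-cong : ∀ {a b} → a ≡ b → e a ≈ e b
    e-cong a≡b = reflexive (≡.cong e a≡b)

    e-0 : e 0ₚ ≈ 1#
    e-0 = begin
      e 0ₚ  ≈⟨ *-identityʳ _ ⟨
      e 0ₚ * 1#  ≈⟨ *-congˡ (e-unit 0ₚ) ⟨
      e 0ₚ * (e 0ₚ * conj (e 0ₚ))  ≈⟨ *-assoc _ _ _ ⟨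
      (e 0ₚ * e 0ₚ) * conj (e 0ₚ)  ≈⟨ *-congʳ (e-⊕ 0ₚ 0ₚ) ⟨
      e (0ₚ ⊕ 0ₚ) * conj (e 0ₚ)  ≈⟨ *-congʳ (e-cong (⊕-identityˡ 0ₚ)) ⟩
      e 0ₚ * conj (e 0ₚ)  ≈⟨ e-unit 0ₚ ⟩
      1#  ∎

    e-⊖ : ∀ a → e (⊖ a) ≈ conj (e a)
    e-⊖ a = begin
      e (⊖ a)  ≈⟨ *-identityʳ _ ⟨
      e (⊖ a) * 1#  ≈⟨ *-congˡ (e-unit a) ⟨
      e (⊖ a) * (e a * conj (e a))  ≈⟨ *-assoc _ _ _ ⟨
      (e (⊖ a) * e a) * conj (e a)  ≈⟨ *-congʳ (e-⊕ (⊖ a) a) ⟨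
      e (⊖ a ⊕ a) * conj (e a)  ≈⟨ *-congʳ (trans (e-cong (≡.trans (⊕-comm (⊖ a) a) (⊕-inverseʳ a))) e-0) ⟩
      1# * conj (e a)  ≈⟨ *-identityˡ _ ⟩
      conj (e a)  ∎

    -- As p is prime, multiplication by b ≠ 0 permutes the residues.
    e-sum-scaled : ∀ {b} → b ≢ 0ₚ → sum (λ a → e (b ⊗ a)) ≈ 0#
    e-sum-scaled {b} b≢0 = trans (sum-scale b (proj₁ inv) (proj₂ inv) e) e-sum
      where inv = invertible prime b b≢0

    orthogonality : ∀ {c d} → d ≢ c → sum (λ k → conj (e (k ⊗ c)) * e (k ⊗ d)) ≈ 0#
    orthogonality {c} {d} d≢c = trans (sum-cong λ k → begin
        conj (e (k ⊗ c)) * e (k ⊗ d)  ≈⟨ *-congʳ (e-⊖ (k ⊗ c)) ⟨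
        e (⊖ (k ⊗ c)) * e (k ⊗ d)  ≈⟨ e-⊕ _ _ ⟨
        e (⊖ (k ⊗ c) ⊕ k ⊗ d)  ≈⟨ e-cong (ℤₚ.solve 3 (λ k c d → (ℤₚ.:- (k ℤₚ.:* c)) ℤₚ.:+ k ℤₚ.:* d ℤₚ.:= (d ℤₚ.:- c) ℤₚ.:* k) ≡.refl k c d) ⟩
        e ((d ⊕ ⊖ c) ⊗ k)  ∎)
      (e-sum-scaled λ d-c≡0 → d≢c (≡.trans
        (ℤₚ.solve 2 (λ c d → d ℤₚ.:= (d ℤₚ.:- c) ℤₚ.:+ c) ≡.refl c d)
        (≡.trans (≡.cong (_⊕ c) d-c≡0) (⊕-identityˡ c))))

    dft : (ℤmod p → Carrier) → ℤmod p → Carrier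
    dft G k = ι p⁻¹ * sum (λ c → G c * conj (e (k ⊗ c)))

    -- In the expanded product the sum over k kills all pairs c ≠ d by orthogonality; on the
    -- diagonal it equals p and cancels one of the two factors 1/p.
    dft-parseval : ∀ G H → sum (λ k → dft G k * conj (dft H k)) ≈ ι p⁻¹ * sum (λ c → G c * conj (H c))
    dft-parseval G H = begin
      sum (λ k → dft G k * conj (dft H k))
        ≈⟨ sum-cong expand ⟩
      sum (λ k → q * q * sum (λ c → sum (λ d → G c * conj (H d) * K k c d)))
        ≈⟨ *-distribˡ-sum (q * q) (λ k → sum (λ c → sum (λ d → G c * conj (H d) * K k c d))) ⟨
      q * q * sum (λ k → sum (λ c → sum (λ d → G c * conj (H d) * K k c d)))
        ≈⟨ *-congˡ (∑-comm λ k c → sum (λ d → G c * conj (H d) * K k c d)) ⟩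
      q * q * sum (λ c → sum (λ k → sum (λ d → G c * conj (H d) * K k c d)))
        ≈⟨ *-congˡ (sum-cong λ c → trans (∑-comm λ k d → G c * conj (H d) * K k c d)
             (sum-cong λ d → sym (*-distribˡ-sum (G c * conj (H d)) (λ k → K k c d)))) ⟩
      q * q * sum (λ c → sum (λ d → G c * conj (H d) * sum (λ k → K k c d)))
        ≈⟨ *-congˡ (sum-cong λ c → sum-single c _ λ d d≢c → trans (*-congˡ (orthogonality d≢c)) (zeroʳ _)) ⟩
      q * q * sum (λ c → G c * conj (H c) * sum (λ k → K k c c))
        ≈⟨ *-congˡ (sum-cong λ c → *-congˡ (sum-cong λ k → trans (*-comm _ _) (e-unit (k ⊗ c)))) ⟩
      q * q * sum (λ c → G c * conj (H c) * sum {p} (λ _ → 1#))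
        ≈⟨ *-congˡ (*-distribʳ-sum (sum {p} (λ _ → 1#)) (λ c → G c * conj (H c))) ⟨
      q * q * (sum (λ c → G c * conj (H c)) * sum {p} (λ _ → 1#))
        ≈⟨ solve 3 (λ q s t → q :* q :* (s :* t) := q :* s :* (q :* t)) refl q (sum (λ c → G c * conj (H c))) (sum {p} (λ _ → 1#)) ⟩
      q * sum (λ c → G c * conj (H c)) * (q * sum {p} (λ _ → 1#))
        ≈⟨ trans (*-congˡ p⁻¹*p) (*-identityʳ _) ⟩
      q * sum (λ c → G c * conj (H c)) ∎
      where
      q = ι p⁻¹
      K : ℤmod p → ℤmod p → ℤmod p → Carrier
      K k c d = conj (e (k ⊗ c)) * e (k ⊗ d)
      conj-dft : ∀ k → conj (dft H k) ≈ q * sum (λ d → conj (H d) * e (k ⊗ d))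
      conj-dft k = trans (conj-* _ _) (*-cong (conj-ι p⁻¹) (trans (conj-sum (λ d → H d * conj (e (k ⊗ d))))
        (sum-cong {p} λ d → trans (conj-* _ _) (*-congˡ (conj-involutive _)))))
      expand : ∀ k → dft G k * conj (dft H k) ≈ q * q * sum (λ c → sum (λ d → G c * conj (H d) * K k c d))
      expand k = begin
        dft G k * conj (dft H k)
          ≈⟨ *-congˡ (conj-dft k) ⟩
        q * sum g * (q * sum h)
          ≈⟨ solve 3 (λ q s t → q :* s :* (q :* t) := q :* q :* (s :* t)) refl q (sum g) (sum h) ⟩
        q * q * (sum g * sum h)
          ≈⟨ *-congˡ (trans (*-distribʳ-sum (sum h) g) (sum-cong λ c → *-distribˡ-sum (g c) h)) ⟩
        q * q * sum (λ c → sum (λ d → g c * h d))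
          ≈⟨ *-congˡ (sum-cong λ c → sum-cong λ d →
               solve 4 (λ a b c d → a :* b :* (c :* d) := a :* c :* (b :* d)) refl (G c) (conj (e (k ⊗ c))) (conj (H d)) (e (k ⊗ d))) ⟩
        q * q * sum (λ c → sum (λ d → G c * conj (H d) * K k c d)) ∎
        where
        g h : ℤmod p → Carrier
        g c = G c * conj (e (k ⊗ c))
        h d = conj (H d) * e (k ⊗ d)

    fourier : ∀ {n} → (Space p n → Carrier) → Space p n → Carrier
    fourier {n} g α = ι (vol n) * Σₛ (λ x → g x * conj (e ⟨ α , x ⟩))

    spectralNorm : ∀ {n} → (Space p n → Carrier) → R.Carrier
    spectralNorm g = Σᴿ (λ α → ∣ fourier g α ∣)

    ι-vol-suc : ∀ n → ι (vol (suc n)) ≈ ι p⁻¹ * ι (vol n)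
    ι-vol-suc n = trans (ι-cong (vol-suc n)) (ι-* _ _)

    -- The link between cosets and slices: summing over x slice by slice and splitting the phase by
    -- `line-slice` shows that the coefficients along a coset are the one-dimensional transform, in
    -- c, of the coefficients at η of the restrictions.
    fourier-slice : ∀ {n} (g : Space p (suc n) → Carrier) i τ k η →
      fourier g (insertAt (η +ᵛ k ·ᵛ τ) i k) ≈ dft (λ c → fourier (g ∘ slice i τ c) η) k
    fourier-slice {n} g i τ k η = begin
      ι (vol (suc n)) * Σₛ (λ x → g x * conj (e ⟨ α , x ⟩))
        ≈⟨ *-cong (ι-vol-suc n) (Σₛ-slice i τ (λ x → g x * conj (e ⟨ α , x ⟩))) ⟩
      ι p⁻¹ * ι (vol n) * sum (λ c → Σₛ (λ y → g (slice i τ c y) * conj (e ⟨ α , slice i τ c y ⟩)))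
        ≈⟨ *-congˡ (sum-cong λ c → trans (Σₛ-cong (factor c)) (Σₛ-*ʳ (conj (e (k ⊗ c))) (λ y → g (slice i τ c y) * conj (e ⟨ η , y ⟩)))) ⟩
      ι p⁻¹ * ι (vol n) * sum (λ c → Σₛ (λ y → g (slice i τ c y) * conj (e ⟨ η , y ⟩)) * conj (e (k ⊗ c)))
        ≈⟨ trans (*-assoc _ _ _) (*-congˡ (trans (*-distribˡ-sum (ι (vol n)) (λ c → Σₛ (λ y → g (slice i τ c y) * conj (e ⟨ η , y ⟩)) * conj (e (k ⊗ c))))
             (sum-cong {p} λ c → sym (*-assoc _ _ _)))) ⟩
      dft (λ c → fourier (g ∘ slice i τ c) η) k ∎
      where
      α = insertAt (η +ᵛ k ·ᵛ τ) i k
      factor : ∀ c y → g (slice i τ c y) * conj (e ⟨ α , slice i τ c y ⟩) ≈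
                       g (slice i τ c y) * conj (e ⟨ η , y ⟩) * conj (e (k ⊗ c))
      factor c y = trans (*-congˡ (trans (conj-cong (trans (e-cong (line-slice i η τ k c y)) (e-⊕ _ _))) (conj-* _ _)))
        (sym (*-assoc _ _ _))

    -- Induction on the dimension: slicing off the first coordinate (τ = 0) reduces it to
    -- `dft-parseval` on each coset and the induction hypothesis on each slice.
    parseval : ∀ {n} (g h : Space p n → Carrier) →
      Σₛ (λ α → fourier g α * conj (fourier h α)) ≈ ι (vol n) * Σₛ (λ x → g x * conj (h x))
    parseval {zero} g h = begin
      (v * (g [] * conj (e 0ₚ))) * conj (v * (h [] * conj (e 0ₚ)))  ≈⟨ *-congˡ (trans (conj-* _ _) (*-cong (conj-ι _) (trans (conj-* _ _) (*-congˡ (conj-involutive _))))) ⟩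
      (v * (g [] * conj (e 0ₚ))) * (v * (conj (h []) * e 0ₚ))  ≈⟨ solve 5 (λ v a b c d → (v :* (a :* b)) :* (v :* (c :* d)) := v :* (a :* c) :* (v :* (d :* b))) refl v (g []) (conj (e 0ₚ)) (conj (h [])) (e 0ₚ) ⟩
      v * (g [] * conj (h [])) * (v * (e 0ₚ * conj (e 0ₚ)))  ≈⟨ *-congˡ (*-cong (trans (ι-cong vol-zero) ι-1) (e-unit 0ₚ)) ⟩
      v * (g [] * conj (h [])) * (1# * 1#)  ≈⟨ solve 1 (λ a → a :* (con (+ 1) :* con (+ 1)) := a) refl (v * (g [] * conj (h []))) ⟩
      v * (g [] * conj (h []))  ∎
      where v = ι (vol 0)
    parseval {suc n} g h = begin
      Σₛ F  ≈⟨ Σₛ-line zero 0ᵛ F ⟩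
      Σₛ (λ η → sum (λ k → F (insertAt (η +ᵛ k ·ᵛ 0ᵛ) zero k)))  ≈⟨ Σₛ-cong (λ η → trans (sum-cong λ k → *-cong (fourier-slice g zero 0ᵛ k η) (conj-cong (fourier-slice h zero 0ᵛ k η))) (dft-parseval (λ c → fourier (g ∘ s c) η) (λ c → fourier (h ∘ s c) η))) ⟩
      Σₛ (λ η → ι p⁻¹ * sum (λ c → fourier (g ∘ s c) η * conj (fourier (h ∘ s c) η)))
                        ≈⟨ trans (Σₛ-*ˡ {n} (ι p⁻¹) _) (*-congˡ (Σₛ-sum-comm (λ η c → fourier (g ∘ s c) η * conj (fourier (h ∘ s c) η)))) ⟩
      ι p⁻¹ * sum (λ c → Σₛ (λ η → fourier (g ∘ s c) η * conj (fourier (h ∘ s c) η)))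
                        ≈⟨ *-congˡ (sum-cong λ c → parseval (g ∘ s c) (h ∘ s c)) ⟩
      ι p⁻¹ * sum (λ c → ι (vol n) * Σₛ (λ y → g (s c y) * conj (h (s c y))))
                        ≈⟨ *-congˡ (*-distribˡ-sum (ι (vol n)) (λ c → Σₛ (λ y → g (s c y) * conj (h (s c y))))) ⟨
      ι p⁻¹ * (ι (vol n) * sum (λ c → Σₛ (λ y → g (s c y) * conj (h (s c y)))))
                        ≈⟨ trans (sym (*-assoc _ _ _)) (*-cong (sym (ι-vol-suc n)) (sym (Σₛ-slice zero 0ᵛ (λ x → g x * conj (h x))))) ⟩
      ι (vol (suc n)) * Σₛ (λ x → g x * conj (h x))  ∎
      where
      F : Space p (suc n) → Carrier
      F α = fourier g α * conj (fourier h α)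
      s : ℤmod p → Space p n → Space p (suc n)
      s = slice zero 0ᵛ

    fourier-shift : ∀ {n} (g : Space p n → Carrier) α δ → fourier g (α +ᵛ δ) ≈ fourier (λ x → g x * conj (e ⟨ δ , x ⟩)) α
    fourier-shift g α δ = *-congˡ (Σₛ-cong λ x → begin
      g x * conj (e ⟨ α +ᵛ δ , x ⟩)  ≈⟨ *-congˡ (conj-cong (trans (e-cong (⟨⟩-+ˡ α δ x)) (e-⊕ _ _))) ⟩
      g x * conj (e ⟨ α , x ⟩ * e ⟨ δ , x ⟩)  ≈⟨ *-congˡ (conj-* _ _) ⟩
      g x * (conj (e ⟨ α , x ⟩) * conj (e ⟨ δ , x ⟩))  ≈⟨ solve 3 (λ a b c → a :* (b :* c) := a :* c :* b) refl (g x) (conj (e ⟨ α , x ⟩)) (conj (e ⟨ δ , x ⟩)) ⟩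
      g x * conj (e ⟨ δ , x ⟩) * conj (e ⟨ α , x ⟩)  ∎)

    -- On the slices attached to a pivot of δ the phase is the constant b c, so a one-dimensional
    -- sum with b ≠ 0 splits off.
    e-Σₛ : ∀ {n} {δ : Space p (suc n)} → δ ≢ 0ᵛ → Σₛ (λ x → e ⟨ δ , x ⟩) ≈ 0#
    e-Σₛ {n} {δ} δ≢0 with pivot prime δ δ≢0
    ... | i , τ , b , b≢0 , ≡.refl = begin
      Σₛ (λ x → e ⟨ insertAt (b ·ᵛ τ) i b , x ⟩)  ≈⟨ Σₛ-slice i τ (λ x → e ⟨ insertAt (b ·ᵛ τ) i b , x ⟩) ⟩
      sum (λ c → Σₛ (λ y → e ⟨ insertAt (b ·ᵛ τ) i b , slice i τ c y ⟩))  ≈⟨ sum-cong (λ c → Σₛ-cong λ y → trans (e-cong (phase c y)) (sym (*-identityʳ _))) ⟩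
      sum (λ c → Σₛ {n} (λ y → e (b ⊗ c) * 1#))  ≈⟨ sum-cong (λ c → Σₛ-*ˡ {n} (e (b ⊗ c)) (λ _ → 1#)) ⟩
      sum (λ c → e (b ⊗ c) * Σₛ {n} (λ y → 1#))  ≈⟨ *-distribʳ-sum (Σₛ {n} (λ y → 1#)) (λ c → e (b ⊗ c)) ⟨
      sum (λ c → e (b ⊗ c)) * Σₛ {n} (λ y → 1#)  ≈⟨ trans (*-congʳ (e-sum-scaled b≢0)) (zeroˡ _) ⟩
      0#  ∎
      where
      phase : ∀ c y → ⟨ insertAt (b ·ᵛ τ) i b , slice i τ c y ⟩ ≡ b ⊗ c
      phase c y = ≡.trans (≡.cong (λ z → ⟨ insertAt z i b , slice i τ c y ⟩) (≡.sym (+ᵛ-identityˡ (b ·ᵛ τ))))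
        (≡.trans (line-slice i 0ᵛ τ b c y) (≡.trans (≡.cong (_⊕ b ⊗ c) (⟨⟩-zeroˡ y)) (⊕-identityˡ (b ⊗ c))))

open AbstractFourier

-- The combinatorial inequality behind the drop of the spectral norm

module Descent (R : OrderedRing) where

  open import Data.Integer.Base using (+_)
  open import Defs using (ℤmod; Space; 0ₚ; _⊕_; 0ᵛ; _+ᵛ_; _·ᵛ_)

  open OrderedRing R
  open OrderedRingProperties R
  open IntegerSolver commutativeRing
  open import Algebra.Properties.Semiring.Sum semiring
    using (sum; *-distribˡ-sum; *-distribʳ-sum; ∑-distrib-+; sum-replicate-zero) renaming (sum-cong-≋ to sum-cong)

  quadruple : Carrier → Carrier
  quadruple x = (x + x) + (x + x)

  -- With q = 1/n, the difference of the two sides is the variance of g, a mean of squares.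
  mean-square : ∀ {n q} → 0# ≤ q → q * sum {n} (λ _ → 1#) ≈ 1# → (g : Fin n → Carrier) →
    (q * sum g) * (q * sum g) ≤ q * sum (λ c → g c * g c)
  mean-square {n} {q} 0≤q qn≈1 g = 0≤y-x⇒x≤y (≤-respʳ eq (0≤-* 0≤q (0≤sum λ c → 0≤x² (g c - M))))
    where
    open import Relation.Binary.Reasoning.Setoid setoid
    M = q * sum g
    eq : q * sum (λ c → (g c - M) * (g c - M)) ≈ q * sum (λ c → g c * g c) - M * M
    eq = begin
      q * sum (λ c → (g c - M) * (g c - M))
        ≈⟨ *-congˡ (sum-cong {n} λ c → solve 2 (λ x m → (x :- m) :* (x :- m) := x :* x :+ (x :* (:- (m :+ m)) :+ m :* m :* con (+ 1))) refl (g c) M) ⟩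
      q * sum (λ c → g c * g c + (g c * (- (M + M)) + M * M * 1#))
        ≈⟨ *-congˡ (trans (∑-distrib-+ (λ c → g c * g c) (λ c → g c * (- (M + M)) + M * M * 1#))
             (+-congˡ (trans (∑-distrib-+ (λ c → g c * (- (M + M))) (λ c → M * M * 1#))
               (+-cong (sym (*-distribʳ-sum (- (M + M)) g)) (sym (*-distribˡ-sum {n} (M * M) (λ _ → 1#))))))) ⟩
      q * (sum (λ c → g c * g c) + (sum g * (- (M + M)) + M * M * sum {n} (λ _ → 1#)))
        ≈⟨ solve 5 (λ q x s t m → q :* (x :+ (s :* (:- (m :+ m)) :+ m :* m :* t)) := q :* x :+ (q :* s :* (:- (m :+ m)) :+ m :* m :* (q :* t)))
             refl q (sum (λ c → g c * g c)) (sum g) (sum {n} (λ _ → 1#)) M ⟩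
      q * sum (λ c → g c * g c) + (M * (- (M + M)) + M * M * (q * sum {n} (λ _ → 1#)))
        ≈⟨ +-congˡ (+-congˡ (*-congˡ qn≈1)) ⟩
      q * sum (λ c → g c * g c) + (M * (- (M + M)) + M * M * 1#)
        ≈⟨ solve 2 (λ x m → x :+ (m :* (:- (m :+ m)) :+ m :* m :* con (+ 1)) := x :- m :* m) refl (q * sum (λ c → g c * g c)) M ⟩
      q * sum (λ c → g c * g c) - M * M ∎

  module _ {n : ℕ} (a : Fin n → Carrier) (0≤a : ∀ k → 0# ≤ a k) {m : Carrier} (0≤m : 0# ≤ m)
           (m²≤Σa² : m * m ≤ sum (λ k → a k * a k)) where

    private
      s = sum a
      0≤s : 0# ≤ s
      0≤s = 0≤sum 0≤a

    Σaa≤ss : sum (λ k → a k * a k) ≤ s * s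
    Σaa≤ss = ≤-respʳ (sym (*-distribʳ-sum s a)) (sum-mono-≤ λ k → *-monoˡ-≤ (0≤a k) (term≤sum 0≤a k))

    m≤s : m ≤ s
    m≤s = square-cancel-≤ 0≤s (≤-trans m²≤Σa² Σaa≤ss)

    0≤s-m : 0# ≤ s - m
    0≤s-m = x≤y⇒0≤y-x m≤s

    off-diagonal : sum (λ k → a k * (s - a k)) ≈ s * s - sum (λ k → a k * a k)
    off-diagonal = begin
      sum (λ k → a k * (s - a k))  ≈⟨ solve 2 (λ x y → x := (x :+ y) :- y) refl _ (sum (λ k → a k * a k)) ⟩
      (sum (λ k → a k * (s - a k)) + sum (λ k → a k * a k)) - sum (λ k → a k * a k)
                        ≈⟨ +-congʳ (∑-distrib-+ (λ k → a k * (s - a k)) (λ k → a k * a k)) ⟨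
      sum (λ k → a k * (s - a k) + a k * a k) - sum (λ k → a k * a k)  ≈⟨ +-congʳ (sum-cong {n} λ k → solve 2 (λ x s → x :* (s :- x) :+ x :* x := x :* s) refl (a k) s) ⟩
      sum (λ k → a k * s) - sum (λ k → a k * a k)  ≈⟨ +-congʳ (*-distribʳ-sum s a) ⟨
      s * s - sum (λ k → a k * a k)  ∎
      where open import Relation.Binary.Reasoning.Setoid setoid

    -- Multiplied by s, each term on the left is at most 2 v a_k (s − a_k), since b_{π k} ≤ v
    -- and b_{π k} ≤ a_{π k} ≤ s − a_k; and Σ a_k (s − a_k) = s² − Σ a_k² ≤ s² − m².
    coset-bound : ∀ (b : Fin n → Carrier) {v} (π : Fin n → Fin n) → (∀ k → 0# ≤ b k) → (∀ k → b k ≤ a k) →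
      0# ≤ v → (∀ k → b k ≤ v) → (∀ k → π k ≢ k) → sum (λ k → b k * b (π k)) ≤ quadruple (v * (s - m))
    coset-bound b {v} π 0≤b b≤a 0≤v b≤v πk≢k = ≤-by-cases {s ≤ 0#} degenerate λ s>0 → *-cancelˡ-≤ s>0
      (≤-respˡ (sym (*-distribˡ-sum s (λ k → b k * b (π k)))) (≤-trans (sum-mono-≤ term) total))
      where
      degenerate : s ≤ 0# → sum (λ k → b k * b (π k)) ≤ quadruple (v * (s - m))
      -- Here s cannot be cancelled, but then every `a k`, and with it the left side, is at most 0.
      degenerate s≤0 = ≤-trans
        (≤-respʳ (sum-replicate-zero n) (sum-mono-≤ λ k → ≤-respʳ (zeroˡ _) (*-mono-≤ (0≤b k) (0≤b (π k))
          (≤-trans (b≤a k) (≤-trans (term≤sum 0≤a k) s≤0)) ≤-refl)))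
        (0≤-+ (0≤-+ 0≤T 0≤T) (0≤-+ 0≤T 0≤T))
        where 0≤T = 0≤-* 0≤v 0≤s-m
      term : ∀ k → s * (b k * b (π k)) ≤ (v + v) * (a k * (s - a k))
      -- The factor s is split as (s - a) + a. In the first part b y ≤ a v; in the second b y ≤ v (s
      -- - a). Both parts are at most v a (s - a), hence the factor 2v.
      term k = ≤-respˡ (solve 4 (λ s a b y → (b :* y) :* (s :- a) :+ a :* (b :* y) := s :* (b :* y)) refl s (a k) (b k) y)
        (≤-respʳ (solve 3 (λ v a r → (a :* v) :* r :+ a :* (v :* r) := (v :+ v) :* (a :* r)) refl v (a k) r)
          (+-mono-≤ (*-mono-≤ (0≤-* (0≤b k) (0≤b (π k))) 0≤r (*-mono-≤ (0≤b k) 0≤v (b≤a k) (b≤v (π k))) ≤-refl)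
                    (*-monoˡ-≤ (0≤a k) (*-mono-≤ (0≤b k) 0≤r (b≤v k) y≤r))))
        where
        y = b (π k)
        r = s - a k
        y≤r : y ≤ r
        y≤r = ≤-trans (b≤a (π k)) (0≤y-x⇒x≤y (≤-respʳ
          (solve 3 (λ s x y → s :- (x :+ y) := (s :- x) :- y) refl s (a k) (a (π k)))
          (x≤y⇒0≤y-x (two-terms≤sum 0≤a λ eq → πk≢k k (≡.sym eq)))))
        0≤r : 0# ≤ r
        0≤r = x≤y⇒0≤y-x (term≤sum 0≤a k)
      total : sum (λ k → (v + v) * (a k * (s - a k))) ≤ s * quadruple (v * (s - m))
      -- From s² - m² = (s - m)(s + m) and m ≤ s comes 2s(s - m): the second factor 2 of the
      -- constant 4, and the s that is cancelled.
      total = ≤-respˡ (trans (*-congˡ (sym off-diagonal)) (*-distribˡ-sum (v + v) (λ k → a k * (s - a k))))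
        (≤-respʳ (solve 3 (λ v s m → (v :+ v) :* ((s :- m) :* (s :+ s)) :=
                   s :* ((v :* (s :- m) :+ v :* (s :- m)) :+ (v :* (s :- m) :+ v :* (s :- m)))) refl v s m)
          (*-monoˡ-≤ (0≤-+ 0≤v 0≤v) (≤-trans (+-mono-≤ ≤-refl (neg-mono-≤ m²≤Σa²))
            (≤-respˡ (solve 2 (λ s m → (s :- m) :* (s :+ m) := s :* s :- m :* m) refl s m)
              (*-monoˡ-≤ 0≤s-m (+-mono-≤ ≤-refl m≤s))))))

  module _ (p : ℕ) .{{_ : NonZero p}} where

    open ModArith p
    open ModSpace p
    open SpaceSum p commutativeRing using (Σₛ; Σₛ-cong; Σₛ-+; Σₛ-*ˡ; Σₛ-neg; Σₛ-line; Σₛ-sum-comm)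

    private
      line : ∀ {n} → Fin (suc n) → Space p n → Space p n → ℤmod p → Space p (suc n)
      line i τ η k = insertAt (η +ᵛ k ·ᵛ τ) i k

    -- a, b and G c stand for |ĝ|, |ĝ| off the origin and |ĝ_c|, where g_c is g on the slice c.
    descent : ∀ {n} {q} → 0# ≤ q → q * sum {p} (λ _ → 1#) ≈ 1# →
      (a b : Space p (suc n) → Carrier) (G : ℤmod p → Space p n → Carrier) →
      ∀ i τ d → let β = insertAt (d ·ᵛ τ) i d in d ≢ 0ₚ → d ⊕ d ≢ 0ₚ →
      (∀ α → 0# ≤ b α) → (∀ α → b α ≤ a α) → (∀ α → α ≢ 0ᵛ → a α ≈ b α) →
      (∀ α → b α ≤ b β) → ¬ (b β ≤ 0#) → b (⊖ᵛ β) ≈ b β →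
      (∀ c η → 0# ≤ G c η) →
      (∀ η → sum (λ k → a (line i τ η k) * a (line i τ η k)) ≈ q * sum (λ c → G c η * G c η)) →
      a 0ᵛ * b β ≤ Σₛ (λ α → b α * b (α +ᵛ β)) →
      Σₛ (λ α → a α * a α) ≈ 1# →
      ¬ ¬ (∃[ c ] 1# + quadruple (Σₛ (G c) * Σₛ (G c)) ≤ quadruple (Σₛ a * Σₛ a))
    descent {n} {q} 0≤q qp≈1 a b G i τ d d≢0 2d≢0 0≤b b≤a a≈b b≤v v>0 b-sym 0≤G parseval-line autocorrelation total none =
      ¬¬min λ { (c , min) → none (c , conclusion c min) }
      where
      β = insertAt (d ·ᵛ τ) i d
      v = b β
      A = Σₛ a
      s m : Space p n → Carrier
      s η = sum (λ k → a (line i τ η k))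
      m η = q * sum (λ c → G c η)
      D = Σₛ (λ η → s η - m η)
      T = v * D
      0≤a : ∀ α → 0# ≤ a α
      0≤a α = ≤-trans (0≤b α) (b≤a α)
      0≤m : ∀ η → 0# ≤ m η
      0≤m η = 0≤-* 0≤q (0≤sum λ c → 0≤G c η)
      m²≤ : ∀ η → m η * m η ≤ sum (λ k → a (line i τ η k) * a (line i τ η k))
      m²≤ η = ≤-respʳ (sym (parseval-line η)) (mean-square 0≤q qp≈1 (λ c → G c η))
      0≤D : 0# ≤ D
      0≤D = 0≤Σₛ p λ η → 0≤s-m (λ k → a (line i τ η k)) (λ k → 0≤a _) (0≤m η) (m²≤ η)

      -- Summing `coset-bound` over all cosets, with the shift k ↦ k + d′ in the role of π; it moves
      -- every k because d′ ≠ 0. It serves for both shifts, β and 2β.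
      pair-bound : ∀ d′ → d′ ≢ 0ₚ → Σₛ (λ α → b α * b (α +ᵛ insertAt (d′ ·ᵛ τ) i d′)) ≤ quadruple T
      pair-bound d′ d′≢0 = ≤-respˡ (sym (trans (Σₛ-line i τ (λ α → b α * b (α +ᵛ insertAt (d′ ·ᵛ τ) i d′)))
          (Σₛ-cong λ η → sum-cong {p} λ k → *-congˡ (reflexive (≡.cong b (line-shift i η τ k d′))))))
        (≤-respʳ quadruple-Σₛ
          (Σₛ-mono-≤ p λ η → coset-bound (λ k → a (line i τ η k)) (λ k → 0≤a _) (0≤m η) (m²≤ η)
            (λ k → b (line i τ η k)) (_⊕ d′) (λ k → 0≤b _) (λ k → b≤a _) (0≤b β) (λ k → b≤v _) (⊕≢ d′≢0)))
        where
        t : Space p n → Carrier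
        t η = v * (s η - m η)
        quadruple-Σₛ : Σₛ (λ η → quadruple (t η)) ≈ quadruple T
        quadruple-Σₛ = trans (Σₛ-+ (λ η → t η + t η) (λ η → t η + t η))
          (+-cong double double)
          where
          double : Σₛ (λ η → t η + t η) ≈ T + T
          double = trans (Σₛ-+ t t) (+-cong (Σₛ-*ˡ v (λ η → s η - m η)) (Σₛ-*ˡ v (λ η → s η - m η)))

      cancel-v : ∀ {x} → x * v ≤ quadruple T → x ≤ quadruple D
      cancel-v {x} le = *-cancelˡ-≤ v>0 (≤-respˡ (*-comm x v)
        (≤-respʳ (solve 2 (λ v d → (v :* d :+ v :* d) :+ (v :* d :+ v :* d) := v :* ((d :+ d) :+ (d :+ d))) refl v D) le))

      β+β : β +ᵛ β ≡ insertAt ((d ⊕ d) ·ᵛ τ) i (d ⊕ d)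
      β+β = ≡.trans (insertAt-+ᵛ (d ·ᵛ τ) (d ·ᵛ τ) i d d) (≡.cong (λ z → insertAt z i (d ⊕ d)) (≡.sym (·ᵛ-distribʳ d d τ)))

      v≤4D : v ≤ quadruple D
      v≤4D = cancel-v (≤-respˡ (*-cong b-sym (reflexive (≡.cong b (⊖ᵛ+ᵛdouble β))))
        (≤-trans (term≤Σₛ p {g = λ α → b α * b (α +ᵛ (β +ᵛ β))} (λ α → 0≤-* (0≤b _) (0≤b _)) (⊖ᵛ β))
          (≤-respˡ (Σₛ-cong λ α → *-congˡ {b α} (reflexive (≡.cong (λ z → b (α +ᵛ z)) (≡.sym β+β)))) (pair-bound (d ⊕ d) 2d≢0))))

      a≤4D : ∀ α → a α ≤ quadruple D
      a≤4D α with ConstantFlats._≟ᵛ_ p α 0ᵛ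
      ... | yes ≡.refl = cancel-v (≤-trans autocorrelation (pair-bound d d≢0))
      ... | no  α≢0    = ≤-trans (≤-reflexive (a≈b α α≢0)) (≤-trans (b≤v α) v≤4D)

      1≤4DA : 1# ≤ quadruple D * A
      1≤4DA = ≤-respˡ total (≤-respʳ (Σₛ-*ˡ (quadruple D) a)
        (Σₛ-mono-≤ p λ α → *-mono-≤ (0≤a α) (0≤a α) (a≤4D α) ≤-refl))

      mean-norm : q * sum (λ c → Σₛ (G c)) ≈ A - D
      mean-norm = begin
        q * sum (λ c → Σₛ (G c))  ≈⟨ *-congˡ (Σₛ-sum-comm (λ η c → G c η)) ⟨
        q * Σₛ (λ η → sum (λ c → G c η))
                        ≈⟨ Σₛ-*ˡ q (λ η → sum (λ c → G c η)) ⟨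
        Σₛ m  ≈⟨ solve 2 (λ x y → x := y :- (y :+ (:- x))) refl (Σₛ m) (Σₛ s) ⟩
        Σₛ s - (Σₛ s + (- Σₛ m))  ≈⟨ +-cong (sym (Σₛ-line i τ a)) (-‿cong (trans (+-congˡ (sym (Σₛ-neg m))) (sym (Σₛ-+ s (λ η → - m η))))) ⟩
        A - D  ∎
        where open import Relation.Binary.Reasoning.Setoid setoid

      -- The smallest norm among the slices is at most their average, which is A - D.
      ¬¬min : ¬ ¬ (∃[ c ] Σₛ (G c) ≤ A - D)
      ¬¬min none = argmin (λ c → Σₛ (G c)) λ { (c , min) → none (c , ≤-respˡ (average c)
        (≤-respʳ mean-norm (*-monoˡ-≤ 0≤q (sum-mono-≤ λ c′ → ≤-respˡ (sym (*-identityʳ _)) (min c′))))) }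
        where
        average : ∀ c → q * sum {p} (λ _ → Σₛ (G c) * 1#) ≈ Σₛ (G c)
        average c = trans (*-congˡ (sym (*-distribˡ-sum {p} (Σₛ (G c)) (λ _ → 1#))))
          (trans (solve 3 (λ q x t → q :* (x :* t) := x :* (q :* t)) refl q (Σₛ (G c)) (sum {p} (λ _ → 1#)))
            (trans (*-congˡ qp≈1) (*-identityʳ _)))

      -- Only one factor of the squared new norm is bounded by A - D, the other by A. This gives
      -- 4A′² ≤ 4A² - 4DA, and 1 ≤ 4DA finishes without a reciprocal of A.
      conclusion : ∀ c → Σₛ (G c) ≤ A - D → 1# + quadruple (Σₛ (G c) * Σₛ (G c)) ≤ quadruple (A * A)
      conclusion c A′≤ = ≤-respʳ
          (solve 2 (λ a d → ((d :+ d) :+ (d :+ d)) :* a :+ (((a :- d) :* a :+ (a :- d) :* a) :+ ((a :- d) :* a :+ (a :- d) :* a))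
                      := (a :* a :+ a :* a) :+ (a :* a :+ a :* a)) refl A D)
          (+-mono-≤ 1≤4DA (+-mono-≤ (+-mono-≤ P≤ P≤) (+-mono-≤ P≤ P≤)))
        where
        0≤A′ : 0# ≤ Σₛ (G c)
        0≤A′ = 0≤Σₛ p (0≤G c)
        A′≤A : Σₛ (G c) ≤ A
        A′≤A = ≤-trans A′≤ (0≤y-x⇒x≤y (≤-respʳ (solve 2 (λ a d → d := a :- (a :- d)) refl A D) 0≤D))
        P≤ : Σₛ (G c) * Σₛ (G c) ≤ (A - D) * A
        P≤ = *-mono-≤ 0≤A′ (0≤Σₛ p 0≤a) A′≤ A′≤A

-- One restriction step for a function with values ±1

module SpectralStep {R : OrderedRing} {C : ComplexExtension R} {p : ℕ} .{{_ : NonZero p}} (prime : Prime p) (2<p : 2 ℕ.< p) (character : AdditiveCharacter C p) where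

  open import Data.Integer.Base using (+_)
  open import Defs using (ℤmod; Space; 0ₚ; 0ᵛ; _+ᵛ_; _·ᵛ_; ⟨_,_⟩)

  private module R where
    open OrderedRing R public
    open OrderedRingProperties R public
  open ComplexExtension C
  open ComplexProperties C
  open AdditiveCharacter character
  open FourierTransform prime character
  open ModArith p
  open ModSpace p
  open SpaceSum p commutativeRing
  open SpaceSum p R.commutativeRing using () renaming (Σₛ to Σᴿ; sum to sumᴿ; Σₛ-cong to Σᴿ-cong)
  open IntegerSolver commutativeRing
  open Descent R using (quadruple; descent)
  open import Relation.Binary.Reasoning.Setoid setoid

  vol-total : ∀ n → ι (vol n) * Σₛ {n} (λ _ → 1#) ≈ 1#
  vol-total zero    = trans (*-identityʳ _) (trans (ι-cong vol-zero) ι-1)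
  vol-total (suc n) = begin
    ι (vol (suc n)) * sum {p} (λ _ → S)  ≈⟨ *-cong (ι-vol-suc n) (sum-cong {p} λ _ → sym (*-identityʳ S)) ⟩
    ι p⁻¹ * ι (vol n) * sum {p} (λ _ → S * 1#)  ≈⟨ *-congˡ (*-distribˡ-sum {p} S (λ _ → 1#)) ⟨
    ι p⁻¹ * ι (vol n) * (S * sum {p} (λ _ → 1#))  ≈⟨ solve 4 (λ q v s t → q :* v :* (s :* t) := q :* t :* (v :* s)) refl (ι p⁻¹) (ι (vol n)) S (sum {p} (λ _ → 1#)) ⟩
    ι p⁻¹ * sum {p} (λ _ → 1#) * (ι (vol n) * S)  ≈⟨ *-cong p⁻¹*p (vol-total n) ⟩
    1# * 1#  ≈⟨ *-identityˡ 1# ⟩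
    1#  ∎
    where S = Σₛ {n} (λ _ → 1#)

  p⁻¹*pᴿ : p⁻¹ R.* sumᴿ {p} (λ _ → R.1#) R.≈ R.1#
  p⁻¹*pᴿ = ι-injective (trans (ι-* _ _) (trans (*-congˡ (trans (ι-sum {p} (λ _ → R.1#)) (sum-cong {p} λ _ → ι-1)))
    (trans p⁻¹*p (sym ι-1))))

  module _ {n : ℕ} (g : Space p (suc n) → Carrier) (real : ∀ x → conj (g x) ≈ g x) (g²≈1 : ∀ x → g x * g x ≈ 1#) where

    private
      v : Carrier
      v = ι (vol (suc n))

      μ : Carrier
      μ = fourier g 0ᵛ

      h : Space p (suc n) → Carrier
      h x = g x - μ

      a b : Space p (suc n) → R.Carrier
      a α = ∣ fourier g α ∣
      b α = ∣ fourier h α ∣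

    fourier-0 : ∀ (k : Space p (suc n) → Carrier) → fourier k 0ᵛ ≈ v * Σₛ k
    fourier-0 k = *-congˡ (Σₛ-cong {suc n} λ x → trans (*-congˡ (trans (conj-cong (trans (e-cong (⟨⟩-zeroˡ x)) e-0)) conj-1)) (*-identityʳ (k x)))

    mean-real : conj μ ≈ μ
    mean-real = begin
      conj μ  ≈⟨ conj-cong (fourier-0 g) ⟩
      conj (v * Σₛ g)  ≈⟨ trans (conj-* _ _) (*-cong (conj-ι _) (trans (conj-Σₛ p g) (Σₛ-cong {suc n} real))) ⟩
      v * Σₛ g  ≈⟨ fourier-0 g ⟨
      μ  ∎

    h-real : ∀ x → conj (h x) ≈ h x
    h-real x = trans (conj-+ _ _) (+-cong (real x) (trans (conj-neg μ) (-‿cong mean-real)))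

    fourier-h : ∀ α → fourier h α ≈ fourier g α - μ * (v * Σₛ (λ x → conj (e ⟨ α , x ⟩)))
    fourier-h α = begin
      v * Σₛ (λ x → (g x - μ) * E x)  ≈⟨ *-congˡ (Σₛ-cong {suc n} λ x → solve 3 (λ g m e → (g :- m) :* e := g :* e :+ (:- m) :* e) refl (g x) μ (E x)) ⟩
      v * Σₛ (λ x → g x * E x + - μ * E x)  ≈⟨ *-congˡ (trans (Σₛ-+ (λ x → g x * E x) (λ x → - μ * E x)) (+-congˡ (Σₛ-*ˡ (- μ) E))) ⟩
      v * (Σₛ (λ x → g x * E x) + - μ * Σₛ E)  ≈⟨ solve 4 (λ v s m t → v :* (s :+ (:- m) :* t) := v :* s :- m :* (v :* t)) refl v (Σₛ (λ x → g x * E x)) μ (Σₛ E) ⟩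
      fourier g α - μ * (v * Σₛ E)  ∎
      where
      E : Space p (suc n) → Carrier
      E x = conj (e ⟨ α , x ⟩)

    fourier-h-0 : fourier h 0ᵛ ≈ 0#
    fourier-h-0 = begin
      fourier h 0ᵛ  ≈⟨ fourier-h 0ᵛ ⟩
      μ - μ * (v * Σₛ {suc n} (λ x → conj (e ⟨ 0ᵛ , x ⟩)))  ≈⟨ +-congˡ (-‿cong (*-congˡ (trans (*-congˡ (Σₛ-cong {suc n} λ x → trans (conj-cong (trans (e-cong (⟨⟩-zeroˡ x)) e-0)) conj-1)) (vol-total (suc n))))) ⟩
      μ - μ * 1#  ≈⟨ solve 1 (λ m → m :- m :* con (+ 1) := con (+ 0)) refl μ ⟩
      0#  ∎

    fourier-h-≢0 : ∀ {α} → α ≢ 0ᵛ → fourier h α ≈ fourier g α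
    fourier-h-≢0 {α} α≢0 = begin
      fourier h α  ≈⟨ fourier-h α ⟩
      fourier g α - μ * (v * Σₛ (λ x → conj (e ⟨ α , x ⟩)))  ≈⟨ +-congˡ (-‿cong (*-congˡ (*-congˡ (trans (sym (conj-Σₛ p (λ x → e ⟨ α , x ⟩))) (trans (conj-cong (e-Σₛ α≢0)) conj-0))))) ⟩
      fourier g α - μ * (v * 0#)  ≈⟨ solve 3 (λ f m v → f :- m :* (v :* con (+ 0)) := f) refl (fourier g α) μ v ⟩
      fourier g α  ∎

    b≤a : ∀ α → b α R.≤ a α
    b≤a α with ConstantFlats._≟ᵛ_ p α 0ᵛ
    ... | yes ≡.refl = R.≤-respˡ (R.trans (R.sym ∣0∣) (R.sym (∣∣-cong fourier-h-0))) (0≤∣∣ _)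
    ... | no  α≢0    = R.≤-reflexive (∣∣-cong (fourier-h-≢0 α≢0))

    -- Squared moduli live in the ordered ring, Parseval in its extension; this and `ι-sum∣∣²` pass
    -- between them.
    ι-Σ∣∣² : ∀ {m} (k : Space p m → Carrier) → ι (Σᴿ (λ x → ∣ k x ∣ R.* ∣ k x ∣)) ≈ Σₛ (λ x → k x * conj (k x))
    ι-Σ∣∣² {m} k = trans (ι-Σₛ p (λ x → ∣ k x ∣ R.* ∣ k x ∣)) (Σₛ-cong {m} λ x → ∣∣² (k x))

    ι-sum∣∣² : ∀ (k : ℤmod p → Carrier) → ι (sumᴿ (λ c → ∣ k c ∣ R.* ∣ k c ∣)) ≈ sum (λ c → k c * conj (k c))
    ι-sum∣∣² k = trans (ι-sum (λ c → ∣ k c ∣ R.* ∣ k c ∣)) (sum-cong {p} λ c → ∣∣² (k c))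

    energy : Σᴿ (λ α → a α R.* a α) R.≈ R.1#
    energy = ι-injective (begin
      ι (Σᴿ (λ α → a α R.* a α))  ≈⟨ ι-Σ∣∣² (fourier g) ⟩
      Σₛ (λ α → fourier g α * conj (fourier g α))  ≈⟨ parseval g g ⟩
      v * Σₛ (λ x → g x * conj (g x))  ≈⟨ *-congˡ (Σₛ-cong {suc n} λ x → trans (*-congˡ (real x)) (g²≈1 x)) ⟩
      v * Σₛ {suc n} (λ x → 1#)  ≈⟨ vol-total (suc n) ⟩
      1#  ≈⟨ ι-1 ⟨
      ι R.1#  ∎)

    -- |h|² = 1 + μ² − 2 μ g, and the constant part does not contribute to nonzero frequencies.
    autocorrelation : ∀ {δ} → δ ≢ 0ᵛ →
      Σₛ (λ α → fourier h α * conj (fourier h (α +ᵛ δ))) ≈ - ((μ + μ) * conj (fourier g δ))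
    autocorrelation {δ} δ≢0 = begin
      Σₛ (λ α → fourier h α * conj (fourier h (α +ᵛ δ)))
        ≈⟨ Σₛ-cong {suc n} (λ α → *-congˡ {fourier h α} (conj-cong (fourier-shift h α δ))) ⟩
      Σₛ (λ α → fourier h α * conj (fourier (λ x → h x * conj (E x)) α))
        ≈⟨ parseval h (λ x → h x * conj (E x)) ⟩
      v * Σₛ (λ x → h x * conj (h x * conj (E x)))
        ≈⟨ *-congˡ (Σₛ-cong {suc n} pointwise) ⟩
      v * Σₛ (λ x → (1# + μ * μ) * E x + - (μ + μ) * (g x * E x))
        ≈⟨ *-congˡ (trans (Σₛ-+ (λ x → (1# + μ * μ) * E x) (λ x → - (μ + μ) * (g x * E x)))
             (+-cong (Σₛ-*ˡ (1# + μ * μ) E) (Σₛ-*ˡ (- (μ + μ)) (λ x → g x * E x)))) ⟩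
      v * ((1# + μ * μ) * Σₛ E + - (μ + μ) * Σₛ (λ x → g x * E x))
        ≈⟨ *-congˡ (+-congʳ (*-congˡ (e-Σₛ δ≢0))) ⟩
      v * ((1# + μ * μ) * 0# + - (μ + μ) * Σₛ (λ x → g x * E x))
        ≈⟨ solve 3 (λ v m s → v :* ((con (+ 1) :+ m :* m) :* con (+ 0) :+ (:- (m :+ m)) :* s) := :- ((m :+ m) :* (v :* s))) refl v μ (Σₛ (λ x → g x * E x)) ⟩
      - ((μ + μ) * (v * Σₛ (λ x → g x * E x)))
        ≈⟨ -‿cong (*-congˡ (sym conj-fourier)) ⟩
      - ((μ + μ) * conj (fourier g δ)) ∎
      where
      E : Space p (suc n) → Carrier
      E x = e ⟨ δ , x ⟩
      pointwise : ∀ x → h x * conj (h x * conj (E x)) ≈ (1# + μ * μ) * E x + - (μ + μ) * (g x * E x)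
      pointwise x = begin
        h x * conj (h x * conj (E x))  ≈⟨ *-congˡ (trans (conj-* _ _) (*-cong (h-real x) (conj-involutive (E x)))) ⟩
        h x * (h x * E x)  ≈⟨ solve 3 (λ g m e → (g :- m) :* ((g :- m) :* e) := (g :* g :+ m :* m) :* e :+ (:- (m :+ m)) :* (g :* e)) refl (g x) μ (E x) ⟩
        (g x * g x + μ * μ) * E x + - (μ + μ) * (g x * E x)
                        ≈⟨ +-congʳ (*-congʳ (+-congʳ (g²≈1 x))) ⟩
        (1# + μ * μ) * E x + - (μ + μ) * (g x * E x) ∎
      conj-fourier : conj (fourier g δ) ≈ v * Σₛ (λ x → g x * E x)
      conj-fourier = trans (conj-* _ _) (*-cong (conj-ι _) (trans (conj-Σₛ p (λ x → g x * conj (E x)))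
        (Σₛ-cong {suc n} λ x → trans (conj-* (g x) (conj (E x))) (*-cong (real x) (conj-involutive (E x))))))

    -- By `autocorrelation` the triangle inequality bounds even 2|μ| `b δ` by the right side. Half
    -- of it is enough for the bound on the coefficient at the origin.
    ∣μ∣*b≤ : ∀ {δ} → δ ≢ 0ᵛ → a 0ᵛ R.* b δ R.≤ Σᴿ (λ α → b α R.* b (α +ᵛ δ))
    ∣μ∣*b≤ {δ} δ≢0 = R.≤-trans
      (R.*-mono-≤ (0≤∣∣ μ) (0≤∣∣ _) (R.≤-respʳ (R.sym ∣μ+μ∣) (R.≤-+ʳ (0≤∣∣ μ))) R.≤-refl)
      (R.≤-respˡ (R.trans (∣∣-cong (autocorrelation δ≢0)) (R.trans (∣-∣-neg _) (R.trans (∣*∣ _ _)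
          (R.*-congˡ (R.trans (∣conj∣ _) (∣∣-cong (sym (fourier-h-≢0 δ≢0))))))))
        (R.≤-respʳ (Σᴿ-cong {suc n} λ α → R.trans (∣*∣ (fourier h α) _) (R.*-congˡ (∣conj∣ (fourier h (α +ᵛ δ)))))
          (∣Σₛ∣≤ p (λ α → fourier h α * conj (fourier h (α +ᵛ δ))))))
      where
      ∣μ+μ∣ : ∣ μ + μ ∣ R.≈ ∣ μ ∣ R.+ ∣ μ ∣
      ∣μ+μ∣ = ∣∣-unique (R.0≤-+ (0≤∣∣ μ) (0≤∣∣ μ)) (begin
        ι ((r R.+ r) R.* (r R.+ r))  ≈⟨ trans (ι-* _ _) (*-cong (ι-+ _ _) (ι-+ _ _)) ⟩
        (ι r + ι r) * (ι r + ι r)  ≈⟨ solve 1 (λ r → (r :+ r) :* (r :+ r) := con (+ 4) :* (r :* r)) refl (ι r) ⟩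
        ⟦4⟧ * (ι r * ι r)  ≈⟨ *-congˡ (trans (sym (ι-* _ _)) (∣∣² μ)) ⟩
        ⟦4⟧ * (μ * conj μ)  ≈⟨ solve 2 (λ m c → con (+ 4) :* (m :* c) := (m :+ m) :* (c :+ c)) refl μ (conj μ) ⟩
        (μ + μ) * (conj μ + conj μ)  ≈⟨ *-congˡ (conj-+ μ μ) ⟨
        (μ + μ) * conj (μ + μ)  ∎)
        where
        r = ∣ μ ∣
        ⟦4⟧ = ((1# + 1#) + 1#) + 1#

    -- For real h the coefficient at -β is the conjugate of the one at β.
    b-sym : ∀ β → b (⊖ᵛ β) R.≈ b β
    b-sym β = R.trans (∣∣-cong (begin
      v * Σₛ (λ x → h x * conj (e ⟨ ⊖ᵛ β , x ⟩))  ≈⟨ *-congˡ (Σₛ-cong {suc n} λ x → *-cong (sym (h-real x)) (conj-cong (trans (e-cong (⟨⟩-⊖ˡ β x)) (e-⊖ ⟨ β , x ⟩)))) ⟩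
      v * Σₛ (λ x → conj (h x) * conj (conj (e ⟨ β , x ⟩))) ≈⟨ *-cong (sym (conj-ι _)) (trans (Σₛ-cong {suc n} λ x → sym (conj-* (h x) (conj (e ⟨ β , x ⟩)))) (sym (conj-Σₛ p (λ x → h x * conj (e ⟨ β , x ⟩))))) ⟩
      conj v * conj (Σₛ (λ x → h x * conj (e ⟨ β , x ⟩))) ≈⟨ conj-* _ _ ⟨
      conj (fourier h β)  ∎)) (∣conj∣ _)

    -- Injectivity of the transform by way of Parseval: if all coefficients are 0, so is Σ |h|², and
    -- with it each summand.
    h-vanishes : (∀ α → b α R.≤ R.0#) → ∀ x → h x ≈ 0#
    h-vanishes b≤0 x = ∣z∣≈0⇒z≈0 (R.x²≈0⇒x≈0 (R.≤-antisym
      (R.≤-trans (R.term≤Σₛ p {g = λ x → ∣ h x ∣ R.* ∣ h x ∣} (λ x → R.0≤x² ∣ h x ∣) x) (R.≤-reflexive Σ∣h∣²≈0)) (R.0≤x² _)))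
      where
      S : Carrier
      S = Σₛ {suc n} (λ _ → 1#)
      ĥ≈0 : ∀ α → fourier h α ≈ 0#
      ĥ≈0 α = ∣z∣≈0⇒z≈0 (R.≤-antisym (b≤0 α) (0≤∣∣ _))
      Σ∣h∣²≈0 : Σᴿ (λ x → ∣ h x ∣ R.* ∣ h x ∣) R.≈ R.0#
      Σ∣h∣²≈0 = ι-injective (begin
        ι (Σᴿ (λ x → ∣ h x ∣ R.* ∣ h x ∣))  ≈⟨ trans (ι-Σ∣∣² h) (sym (*-identityˡ _)) ⟩
        1# * Σₛ (λ x → h x * conj (h x))  ≈⟨ *-congʳ (sym (vol-total (suc n))) ⟩
        v * S * Σₛ (λ x → h x * conj (h x))  ≈⟨ solve 3 (λ v s t → v :* s :* t := s :* (v :* t)) refl v S (Σₛ (λ x → h x * conj (h x))) ⟩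
        S * (v * Σₛ (λ x → h x * conj (h x)))  ≈⟨ *-congˡ (parseval h h) ⟨
        S * Σₛ (λ α → fourier h α * conj (fourier h α))  ≈⟨ *-congˡ (Σₛ-cong {suc n} λ α → trans (*-congʳ {conj (fourier h α)} (ĥ≈0 α)) (zeroˡ _)) ⟩
        S * Σₛ {suc n} (λ α → 0#)  ≈⟨ *-congˡ (trans (Σₛ-cong {suc n} λ α → sym (zeroˡ 0#)) (trans (Σₛ-*ˡ {suc n} 0# (λ _ → 0#)) (zeroˡ _))) ⟩
        S * 0#  ≈⟨ zeroʳ S ⟩
        0#  ≈⟨ ι-0 ⟨
        ι R.0#  ∎)

    -- The maximal coefficient of h is positive, for otherwise h = 0 and g equals its mean. Its
    -- frequency β is then not the origin, where the transform of h vanishes, so β has a pivot along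
    -- which to slice.
    spectral-step : ¬ (∀ x y → g x ≈ g y) →
      ¬ ¬ (∃[ i ] ∃[ τ ] ∃[ c ] let A′ = spectralNorm (g ∘ slice i τ c); A = spectralNorm g in
        R.1# R.+ quadruple (A′ R.* A′) R.≤ quadruple (A R.* A))
    spectral-step nonconstant none = R.argmax-Space p b λ { (β , b≤bβ) → maximiser β b≤bβ }
      where
      maximiser : ∀ β → ¬ (∀ α → b α R.≤ b β)
      maximiser β b≤bβ = atPivot (pivot prime β β≢0)
        where
        bβ>0 : ¬ (b β R.≤ R.0#)
        bβ>0 bβ≤0 = nonconstant λ x y → trans (g≈μ x) (sym (g≈μ y))
          where
          g≈μ : ∀ x → g x ≈ μ
          g≈μ x = trans (solve 2 (λ g m → g := (g :- m) :+ m) refl (g x) μ)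
            (trans (+-congʳ (h-vanishes (λ α → R.≤-trans (b≤bβ α) bβ≤0) x)) (+-identityˡ μ))
        β≢0 : β ≢ 0ᵛ
        β≢0 ≡.refl = bβ>0 (R.≤-reflexive (R.trans (∣∣-cong fourier-h-0) ∣0∣))
        atPivot : ¬ (∃[ i ] ∃[ τ ] ∃[ d ] d ≢ 0ₚ × β ≡ insertAt (d ·ᵛ τ) i d)
        atPivot (i , τ , d , d≢0 , ≡.refl) = descent p 0≤p⁻¹ p⁻¹*pᴿ a b (λ c η → ∣ fourier (g ∘ slice i τ c) η ∣)
          i τ d d≢0 (double≢0 prime 2<p d≢0) (λ α → 0≤∣∣ _) b≤a (λ α α≢0 → ∣∣-cong (sym (fourier-h-≢0 α≢0)))
          b≤bβ bβ>0 (b-sym β) (λ c η → 0≤∣∣ _) parseval-line (∣μ∣*b≤ β≢0) energy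
          λ { (c , bound) → none (i , τ , c , bound) }
          where
          parseval-line : ∀ η → sumᴿ (λ k → a (insertAt (η +ᵛ k ·ᵛ τ) i k) R.* a (insertAt (η +ᵛ k ·ᵛ τ) i k))
            R.≈ p⁻¹ R.* sumᴿ (λ c → ∣ fourier (g ∘ slice i τ c) η ∣ R.* ∣ fourier (g ∘ slice i τ c) η ∣)
          parseval-line η = ι-injective (begin
            ι (sumᴿ (λ k → a (ℓ k) R.* a (ℓ k)))  ≈⟨ ι-sum∣∣² (λ k → fourier g (ℓ k)) ⟩
            sum (λ k → fourier g (ℓ k) * conj (fourier g (ℓ k)))  ≈⟨ sum-cong {p} (λ k → *-cong (fourier-slice g i τ k η) (conj-cong (fourier-slice g i τ k η))) ⟩
            sum (λ k → dft G k * conj (dft G k))  ≈⟨ dft-parseval G G ⟩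
            ι p⁻¹ * sum (λ c → G c * conj (G c))  ≈⟨ *-congˡ (ι-sum∣∣² G) ⟨
            ι p⁻¹ * ι (sumᴿ (λ c → ∣ G c ∣ R.* ∣ G c ∣))  ≈⟨ ι-* _ _ ⟨
            ι (p⁻¹ R.* sumᴿ (λ c → ∣ G c ∣ R.* ∣ G c ∣))  ∎)
            where
            ℓ : ℤmod p → Space p (suc n)
            ℓ k = insertAt (η +ᵛ k ·ᵛ τ) i k
            G : ℤmod p → Carrier
            G c = fourier (g ∘ slice i τ c) η

-- Induction on the dimension

module CodimensionBound {R : OrderedRing} {C : ComplexExtension R} {p : ℕ} .{{_ : NonZero p}} (prime : Prime p) (2<p : 2 ℕ.< p) (character : AdditiveCharacter C p) where

  import Data.Sign.Properties as Sign
  open import Defs using (Space; ⟨_,_⟩)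
  open ModSpace p using (slice)
  open ConstantFlats p
  open SpectralStep prime 2<p character

  private module R where
    open OrderedRing R public
    open OrderedRingProperties R public
  open ComplexExtension C
  open AdditiveCharacter character
  open FourierTransform prime character
  open SpaceSum p commutativeRing using (Σₛ; Σₛ-cong)
  open SpaceSum p R.commutativeRing using () renaming (Σₛ to Σᴿ; Σₛ-cong to Σᴿ-cong)
  open Descent R using (quadruple)
  open import Algebra.Definitions.RawMonoid R.+-rawMonoid using () renaming (_×_ to _ℕ×_)

  module _ (sgn : Sign → Carrier) (sgn-real : ∀ s → conj (sgn s) ≈ sgn s) (sgn-square : ∀ s → sgn s * sgn s ≈ 1#)
           (sgn-injective : ∀ {s t} → sgn s ≈ sgn t → s ≡ t) where

    -- If f is constant, the whole space serves. Otherwise a slice with 1 + 4A′² ≤ 4A² turns a bound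
    -- k ≤ 4A′² into k + 1 ≤ 4A², and passing to the slice costs just this one codimension. `g` is
    -- tied to `sgn ∘ f` only pointwise, so it can be restricted alongside f.
    codimension-bound : ∀ n (f : Space p n → Sign) (g : Space p n → Carrier) → (∀ x → g x ≡ sgn (f x)) →
      let A = spectralNorm g in ¬ ¬ (∃[ d ] ∃[ k ] d ℕ.+ k ≡ n × HasConstantFlat f d × k ℕ× R.1# R.≤ quadruple (A R.* A))
    codimension-bound n f g g≡ none = byCases n f g g≡ none (search-all search-Space λ x → search-all search-Space λ y → f x Sign.≟ f y)
      where
      byCases : ∀ n (f : Space p n → Sign) (g : Space p n → Carrier) → (∀ x → g x ≡ sgn (f x)) → let A = spectralNorm g in
        ¬ (∃[ d ] ∃[ k ] d ℕ.+ k ≡ n × HasConstantFlat f d × k ℕ× R.1# R.≤ quadruple (A R.* A)) →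
        ¬ Dec (∀ x y → f x ≡ f y)
      byCases n f g g≡ none (yes const) = none (n , 0 , ℕ.+-identityʳ n , constant⇒flat f const , R.0≤-+ (R.0≤-+ 0≤A² 0≤A²) (R.0≤-+ 0≤A² 0≤A²))
        where 0≤A² = R.0≤x² (spectralNorm g)
      byCases zero    f g g≡ none (no ¬const) = ¬const λ { [] [] → ≡.refl }
      byCases (suc n) f g g≡ none (no ¬const) = spectral-step g
        (λ x → ≡.subst (λ z → conj z ≈ z) (≡.sym (g≡ x)) (sgn-real (f x)))
        (λ x → ≡.subst (λ z → z * z ≈ 1#) (≡.sym (g≡ x)) (sgn-square (f x)))
        (λ const → ¬const λ x y → sgn-injective (≡.subst₂ _≈_ (g≡ x) (g≡ y) (const x y))) λ { (i , τ , c , step) →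
          codimension-bound n (f ∘ slice i τ c) (g ∘ slice i τ c) (g≡ ∘ slice i τ c) λ { (d , k , d+k≡n , flat , bound) →
            none (d , suc k , ≡.trans (ℕ.+-suc d k) (≡.cong suc d+k≡n) , sliceFlat f i τ c flat ,
              R.≤-trans (R.+-mono-≤ R.≤-refl bound) step) } }

  quadruple-square-cong : ∀ {x y} → x R.≈ y → quadruple (x R.* x) R.≈ quadruple (y R.* y)
  quadruple-square-cong x≈y = R.+-cong (R.+-cong xx≈yy xx≈yy) (R.+-cong xx≈yy xx≈yy)
    where xx≈yy = R.*-cong x≈y x≈y

  -- N′, F′, E′, χ′ stand for the layers of a concrete definition of the spectral norm. Relating them layer by layer avoids
  -- comparing concrete reals by conversion, which unfolds their Cauchy proofs.
  module _ (_·_ : Carrier → Carrier → Carrier) (·≈* : ∀ z w → z · w ≈ z * w)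
           (cj : Carrier → Carrier) (cj≈conj : ∀ z → cj z ≈ conj z)
           (md : Carrier → R.Carrier) (md≈∣∣ : ∀ z → md z R.≈ ∣ z ∣)
           (v : ℕ → Carrier) (v≈ι-vol : ∀ n → v n ≈ ι (vol n))
           (ΣC : ∀ {n} → (Space p n → Carrier) → Carrier) (ΣC≈Σₛ : ∀ {n} (G : Space p n → Carrier) → ΣC G ≈ Σₛ G)
           (ΣR : ∀ {n} → (Space p n → R.Carrier) → R.Carrier) (ΣR≈Σᴿ : ∀ {n} (G : Space p n → R.Carrier) → ΣR G R.≈ Σᴿ G)
           (χ′ : ∀ {n} → Space p n → Space p n → Carrier) (χ′≈e : ∀ {n} (α x : Space p n) → χ′ α x ≈ e ⟨ α , x ⟩)
           (E′ : ∀ {n} → (Space p n → Carrier) → Carrier) (E′≈ : ∀ {n} (G : Space p n → Carrier) → E′ G ≈ v n · ΣC G)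
           (F′ : ∀ {n} → (Space p n → Carrier) → Space p n → Carrier)
           (F′≈ : ∀ {n} (g : Space p n → Carrier) α → F′ g α ≈ E′ (λ x → g x · cj (χ′ α x)))
           (N′ : ∀ {n} → (Space p n → Carrier) → R.Carrier)
           (N′≈ : ∀ {n} (g : Space p n → Carrier) → N′ g R.≈ ΣR (λ α → md (F′ g α)))
    where

    presented-norm : ∀ {n} (g : Space p n → Carrier) → spectralNorm g R.≈ N′ g
    presented-norm {n} g = R.sym (R.trans (N′≈ g) (R.trans (ΣR≈Σᴿ (λ α → md (F′ g α)))
      (Σᴿ-cong λ α → R.trans (md≈∣∣ (F′ g α)) (∣∣-cong (trans (F′≈ g α) (trans (E′≈ (λ x → g x · cj (χ′ α x)))
        (trans (·≈* _ _) (*-cong (v≈ι-vol n) (trans (ΣC≈Σₛ (λ x → g x · cj (χ′ α x)))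
          (Σₛ-cong λ x → trans (·≈* _ _) (*-congˡ (trans (cj≈conj _) (conj-cong (χ′≈e α x))))))))))))))

    -- The bound is passed on through an abstract predicate `Bounded`, so that in the result the
    -- presented norm occurs only as its argument.
    codimension-bounded : (sgn : Sign → Carrier) → (∀ s → conj (sgn s) ≈ sgn s) → (∀ s → sgn s * sgn s ≈ 1#) →
      (∀ {s t} → sgn s ≈ sgn t → s ≡ t) →
      (Bounded : ℕ → R.Carrier → Set) → (∀ k N → k ℕ× R.1# R.≤ quadruple (N R.* N) → Bounded k N) →
      ∀ n (f : Space p n → Sign) (g : Space p n → Carrier) → (∀ x → g x ≡ sgn (f x)) →
      ¬ ¬ (∃[ d ] ∃[ k ] d ℕ.+ k ≡ n × HasConstantFlat f d × Bounded k (N′ g))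
    codimension-bounded sgn sgn-real sgn-square sgn-injective Bounded bounded n f g g≡ none =
      codimension-bound sgn sgn-real sgn-square sgn-injective n f g g≡ λ { (d , k , d+k≡n , flat , bound) →
        none (d , k , d+k≡n , flat , bounded k (N′ g) (R.≤-respʳ (quadruple-square-cong (presented-norm g)) bound)) }

-- The Cauchy reals as an ordered ring

module Reals where

  open import Data.Rational.Base hiding (NonZero)
  open import Data.Rational.Properties
  open import Data.Rational.Solver using (module +-*-Solver)
  open import Data.Sum.Base using (_⊎_; inj₁; inj₂; [_,_]′)
  open import Function using (id)
  open import Relation.Binary.PropositionalEquality
  open import Defs

  open +-*-Solver using (solve; _:+_; _:*_; _:-_; :-_; _:=_)

  Eventually : (ℕ → Set) → Set
  Eventually P = ∃[ N ] ∀ n → N ℕ.≤ n → P n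

  always : ∀ {P : ℕ → Set} → (∀ n → P n) → Eventually P
  always P = 0 , λ n _ → P n

  both : ∀ {P Q : ℕ → Set} → Eventually P → Eventually Q → Eventually (λ n → P n × Q n)
  both (M , P) (N , Q) = M ℕ.⊔ N , λ n ≤n → P n (ℕ.m⊔n≤o⇒m≤o M N ≤n) , Q n (ℕ.m⊔n≤o⇒n≤o M N ≤n)

  mapᵉ : ∀ {P Q : ℕ → Set} → (∀ n → P n → Q n) → Eventually P → Eventually Q
  mapᵉ f (N , P) = N , λ n ≤n → f n (P n ≤n)

  never : ∀ {P : ℕ → Set} → Eventually P → ¬ (∀ n → ¬ P n)
  never (N , P) none = none N (P N ℕ.≤-refl)

  pointwise-≈ : ∀ {x y} → (∀ n → seq x n ≡ seq y n) → x ≈ᴿ y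
  pointwise-≈ {x} eq ε 0<ε = always λ n →
    subst (_< ε) (sym (cong ∣_∣ (trans (cong (λ z → seq x n - z) (sym (eq n))) (+-inverseʳ (seq x n))))) 0<ε

  p<q+ε : ∀ {p q ε} → p ≤ q → 0ℚ < ε → p < q + ε
  p<q+ε {p} {q} {ε} p≤q 0<ε = subst (_< q + ε) (+-identityʳ p) (+-mono-≤-< p≤q 0<ε)

  pointwise-≤ : ∀ {x y} → (∀ n → seq x n ≤ seq y n) → x ≤ᴿ y
  pointwise-≤ x≤y ε 0<ε = always λ n → p<q+ε (x≤y n) 0<ε

  ≈⇒≤ : ∀ {x y} → x ≈ᴿ y → x ≤ᴿ y
  ≈⇒≤ {x} {y} x≈y ε 0<ε = mapᵉ (λ n → q<p+ε {seq x n} {seq y n}) (x≈y ε 0<ε)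

  ≤-antisymᴿ : ∀ {x y} → x ≤ᴿ y → y ≤ᴿ x → x ≈ᴿ y
  ≤-antisymᴿ x≤y y≤x ε 0<ε = mapᵉ (λ { n (p , q) → ∣p-q∣<ε p q }) (both (x≤y ε 0<ε) (y≤x ε 0<ε))

  ≈-reflᴿ : ∀ {x} → x ≈ᴿ x
  ≈-reflᴿ {x} = pointwise-≈ {x} {x} λ _ → refl

  ≈-symᴿ : ∀ {x y} → x ≈ᴿ y → y ≈ᴿ x
  ≈-symᴿ {x} {y} x≈y ε 0<ε = mapᵉ (λ n → subst (_< ε) (∣-∣-sym (seq x n) (seq y n))) (x≈y ε 0<ε)

  ≤-transᴿ : ∀ {x y z} → x ≤ᴿ y → y ≤ᴿ z → x ≤ᴿ z
  ≤-transᴿ {x} {y} {z} x≤y y≤z ε 0<ε = mapᵉ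
    (λ { n (p , q) → <-trans p (subst (seq y n + ½ * ε <_)
      (trans (+-assoc (seq z n) (½ * ε) (½ * ε)) (cong (seq z n +_) (½+½ ε))) (+-monoˡ-< (½ * ε) q)) })
    (both (x≤y (½ * ε) (0<½ 0<ε)) (y≤z (½ * ε) (0<½ 0<ε)))

  ≈-transᴿ : ∀ {x y z} → x ≈ᴿ y → y ≈ᴿ z → x ≈ᴿ z
  ≈-transᴿ {x} {y} {z} x≈y y≈z = ≤-antisymᴿ {x} {z} (≤-transᴿ {x} {y} {z} (≈⇒≤ {x} {y} x≈y) (≈⇒≤ {y} {z} y≈z))
    (≤-transᴿ {z} {y} {x} (≈⇒≤ {z} {y} (≈-symᴿ {y} {z} y≈z)) (≈⇒≤ {y} {x} (≈-symᴿ {x} {y} x≈y)))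

  +-mono-≤ᴿ : ∀ {x y u v} → x ≤ᴿ y → u ≤ᴿ v → x +ᴿ u ≤ᴿ y +ᴿ v
  +-mono-≤ᴿ {x} {y} {u} {v} x≤y u≤v ε 0<ε = mapᵉ
    (λ { n (p , q) → subst (seq x n + seq u n <_)
      (trans (solve 3 (λ y v h → (y :+ h) :+ (v :+ h) := (y :+ v) :+ (h :+ h)) refl (seq y n) (seq v n) (½ * ε))
        (cong (seq y n + seq v n +_) (½+½ ε)))
      (+-mono-< p q) })
    (both (x≤y (½ * ε) (0<½ 0<ε)) (u≤v (½ * ε) (0<½ 0<ε)))

  +-congᴿ : ∀ {x y u v} → x ≈ᴿ y → u ≈ᴿ v → x +ᴿ u ≈ᴿ y +ᴿ v
  +-congᴿ {x} {y} {u} {v} x≈y u≈v = ≤-antisymᴿ {x +ᴿ u} {y +ᴿ v}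
    (+-mono-≤ᴿ {x} {y} {u} {v} (≈⇒≤ {x} {y} x≈y) (≈⇒≤ {u} {v} u≈v))
    (+-mono-≤ᴿ {y} {x} {v} {u} (≈⇒≤ {y} {x} (≈-symᴿ {x} {y} x≈y)) (≈⇒≤ {v} {u} (≈-symᴿ {u} {v} u≈v)))

  -‿congᴿ : ∀ {x y} → x ≈ᴿ y → -ᴿ x ≈ᴿ -ᴿ y
  -‿congᴿ {x} {y} x≈y ε 0<ε = mapᵉ (λ n → subst (_< ε) (trans (∣-∣-sym (seq x n) (seq y n))
    (cong ∣_∣ (solve 2 (λ x y → y :- x := (:- x) :- (:- y)) refl (seq x n) (seq y n))))) (x≈y ε 0<ε)

  *-congᴿ : ∀ {x y u v} → x ≈ᴿ y → u ≈ᴿ v → x *ᴿ u ≈ᴿ y *ᴿ v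
  *-congᴿ {x} {y} {u} {v} x≈y u≈v ε 0<ε =
    let a , bx       = eventually-bounded (cauchy x)
        b , bv       = eventually-bounded (cauchy v)
        δ , 0<δ , aδ = scale-down (0<fromℕsuc a) (0<½ 0<ε)
        η , 0<η , bη = scale-down (0<fromℕsuc b) (0<½ 0<ε)
    in mapᵉ (λ { n ((bx , bv) , (hu , hx)) → subst (∣ seq x n * seq u n - seq y n * seq v n ∣ <_) (trans (cong₂ _+_ aδ bη) (½+½ ε))
         (product-bound {a = seq x n} {seq y n} {seq u n} {seq v n} (0<fromℕsuc a) (0<fromℕsuc b) bx bv hu hx) })
       (both (both bx bv) (both (u≈v δ 0<δ) (x≈y η 0<η)))

  ℝ-commutativeRing : CommutativeRing 0ℓ 0ℓ
  ℝ-commutativeRing = record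
    { Carrier = ℝ ; _≈_ = _≈ᴿ_ ; _+_ = _+ᴿ_ ; _*_ = _*ᴿ_ ; -_ = -ᴿ_ ; 0# = 0ᴿ ; 1# = 1ᴿ
    ; isCommutativeRing = record
      { isRing = record
        { +-isAbelianGroup = record
          { isGroup = record
            { isMonoid = record
              { isSemigroup = record
                { isMagma = record
                  { isEquivalence = record
                    { refl = λ {x} → ≈-reflᴿ {x}
                    ; sym = λ {x} {y} → ≈-symᴿ {x} {y}
                    ; trans = λ {x} {y} {z} → ≈-transᴿ {x} {y} {z} }
                  ; ∙-cong = λ {x} {y} {u} {v} → +-congᴿ {x} {y} {u} {v} }
                ; assoc = λ x y z → pointwise-≈ {(x +ᴿ y) +ᴿ z} {x +ᴿ (y +ᴿ z)} λ n → +-assoc (seq x n) (seq y n) (seq z n) }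
              ; identity = (λ x → pointwise-≈ {0ᴿ +ᴿ x} {x} λ n → +-identityˡ (seq x n))
                         , (λ x → pointwise-≈ {x +ᴿ 0ᴿ} {x} λ n → +-identityʳ (seq x n)) }
            ; inverse = (λ x → pointwise-≈ { -ᴿ x +ᴿ x} {0ᴿ} λ n → +-inverseˡ (seq x n))
                      , (λ x → pointwise-≈ {x +ᴿ -ᴿ x} {0ᴿ} λ n → +-inverseʳ (seq x n))
            ; ⁻¹-cong = λ {x} {y} → -‿congᴿ {x} {y} }
          ; comm = λ x y → pointwise-≈ {x +ᴿ y} {y +ᴿ x} λ n → +-comm (seq x n) (seq y n) }
        ; *-cong = λ {x} {y} {u} {v} → *-congᴿ {x} {y} {u} {v}
        ; *-assoc = λ x y z → pointwise-≈ {(x *ᴿ y) *ᴿ z} {x *ᴿ (y *ᴿ z)} λ n → *-assoc (seq x n) (seq y n) (seq z n)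
        ; *-identity = (λ x → pointwise-≈ {1ᴿ *ᴿ x} {x} λ n → *-identityˡ (seq x n))
                     , (λ x → pointwise-≈ {x *ᴿ 1ᴿ} {x} λ n → *-identityʳ (seq x n))
        ; distrib = (λ x y z → pointwise-≈ {x *ᴿ (y +ᴿ z)} {x *ᴿ y +ᴿ x *ᴿ z} λ n → *-distribˡ-+ (seq x n) (seq y n) (seq z n))
                  , (λ x y z → pointwise-≈ {(y +ᴿ z) *ᴿ x} {y *ᴿ x +ᴿ z *ᴿ x} λ n → *-distribʳ-+ (seq x n) (seq y n) (seq z n)) }
      ; *-comm = λ x y → pointwise-≈ {x *ᴿ y} {y *ᴿ x} λ n → *-comm (seq x n) (seq y n) } }

  <⇒≱ᴿ : ∀ {x y} → x <ᴿ y → ¬ (y ≤ᴿ x)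
  <⇒≱ᴿ (ε , 0<ε , x+ε<y) y≤x = never (both x+ε<y (y≤x ε 0<ε)) λ { n (p , q) → <-asym p q }

  <⇒≤ᴿ : ∀ {x y} → x <ᴿ y → x ≤ᴿ y
  <⇒≤ᴿ {x} {y} (δ , 0<δ , x+δ<y) ε 0<ε = mapᵉ (λ n p → <-trans (p<q+ε ≤-refl 0<δ) (<-trans p (p<q+ε ≤-refl 0<ε))) x+δ<y

  +-cancelʳ-< : ∀ r {p q} → p + r < q + r → p < q
  +-cancelʳ-< r {p} {q} p+r<q+r = subst₂ _<_ (cancel p) (cancel q) (+-monoˡ-< (- r) p+r<q+r)
    where
    cancel : ∀ p → p + r + - r ≡ p
    cancel p = solve 2 (λ p r → p :+ r :- r := p) refl p r

  -- With a slack ε the comparison becomes decidable: one rational test at a late index K settles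
  -- it, because both sequences have almost stopped moving there.
  compare : ∀ x y {ε} → 0ℚ < ε → Eventually (λ n → seq x n < seq y n + ε) ⊎ y <ᴿ x
  compare x y {ε} 0<ε with cauchy x (½ * (½ * (½ * ε))) (0<½ (0<½ (0<½ 0<ε))) | cauchy y (½ * (½ * (½ * ε))) (0<½ (0<½ (0<½ 0<ε)))
  ... | M , hx | N , hy = decide (seq x K <? seq y K + (q + q))
    where
    -- e = ε/8 bounds the later movement of each sequence and the test uses the threshold 2q = ε/2.
    -- Two movements amount to 2e = q, so a positive answer costs at most 3q < ε and a negative one
    -- leaves the gap q.
    e = ½ * (½ * (½ * ε))
    q = ½ * (½ * ε)
    K = M ℕ.⊔ N
    e+e : e + e ≡ q
    e+e = ½+½ q
    total : (q + q) + (q + q) ≡ ε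
    total = trans (cong₂ _+_ (½+½ (½ * ε)) (½+½ (½ * ε))) (½+½ ε)
    x~ : ∀ {m n} → K ℕ.≤ m → K ℕ.≤ n → seq x m < seq x n + e
    x~ {m} {n} K≤m K≤n = q<p+ε {seq x m} {seq x n} (hx m n (ℕ.m⊔n≤o⇒m≤o M N K≤m) (ℕ.m⊔n≤o⇒m≤o M N K≤n))
    y~ : ∀ {m n} → K ℕ.≤ m → K ℕ.≤ n → seq y m < seq y n + e
    y~ {m} {n} K≤m K≤n = q<p+ε {seq y m} {seq y n} (hy m n (ℕ.m⊔n≤o⇒n≤o M N K≤m) (ℕ.m⊔n≤o⇒n≤o M N K≤n))
    decide : Dec (seq x K < seq y K + (q + q)) → Eventually (λ n → seq x n < seq y n + ε) ⊎ y <ᴿ x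
    decide (yes x<) = inj₁ (K , λ n K≤n → begin-strict
      seq x n  <⟨ x~ K≤n ℕ.≤-refl ⟩
      seq x K + e  <⟨ +-monoˡ-< e x< ⟩
      seq y K + (q + q) + e  <⟨ +-monoˡ-< e (+-monoˡ-< (q + q) (y~ ℕ.≤-refl K≤n)) ⟩
      seq y n + e + (q + q) + e  ≡⟨ solve 3 (λ y e q → y :+ e :+ (q :+ q) :+ e := y :+ ((q :+ q) :+ (e :+ e))) refl (seq y n) e q ⟩
      seq y n + ((q + q) + (e + e))  ≡⟨ cong (λ z → seq y n + ((q + q) + z)) e+e ⟩
      seq y n + ((q + q) + q)  ≤⟨ +-monoʳ-≤ (seq y n) (+-monoʳ-≤ (q + q) (<⇒≤ (p<q+ε ≤-refl (0<½ (0<½ 0<ε))))) ⟩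
      seq y n + ((q + q) + (q + q))  ≡⟨ cong (seq y n +_) total ⟩
      seq y n + ε  ∎)
      where open ≤-Reasoning
    decide (no x≮) = inj₂ (q , 0<½ (0<½ 0<ε) , K , λ n K≤n → +-cancelʳ-< e (begin-strict
      seq y n + q + e  <⟨ +-monoˡ-< e (+-monoˡ-< q (y~ K≤n ℕ.≤-refl)) ⟩
      seq y K + e + q + e  ≡⟨ solve 3 (λ y e q → y :+ e :+ q :+ e := y :+ (q :+ (e :+ e))) refl (seq y K) e q ⟩
      seq y K + (q + (e + e))  ≡⟨ cong (λ z → seq y K + (q + z)) e+e ⟩
      seq y K + (q + q)  ≤⟨ ≮⇒≥ x≮ ⟩
      seq x K  <⟨ x~ ℕ.≤-refl K≤n ⟩
      seq x n + e  ∎))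
      where open ≤-Reasoning

  -- Each ε-instance of `x ≤ᴿ y` is decided by `compare`, whose other outcome y < x contradicts the
  -- double negation.
  ≤-stableᴿ : ∀ {x y} → ¬ ¬ (x ≤ᴿ y) → x ≤ᴿ y
  ≤-stableᴿ {x} {y} ¬¬≤ ε 0<ε =
    [ id , (λ y<x → ⊥-elim (¬¬≤ (<⇒≱ᴿ {y} {x} y<x))) ]′ (compare x y 0<ε)

  ≰⇒≥ᴿ : ∀ {x y} → ¬ (x ≤ᴿ y) → y ≤ᴿ x
  ≰⇒≥ᴿ {x} {y} x≰y ε 0<ε =
    [ id , (λ x<y → ⊥-elim (x≰y (<⇒≤ᴿ {x} {y} x<y))) ]′ (compare y x 0<ε)

  -- The factors exceed -δ and -η. Expanding (p + δ)(q + η) > 0 gives p q > -(η p + δ(q + η)), and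
  -- the upper bounds A and B of the factors make the correction at most ε.
  0≤-*ᴿ : ∀ {x y} → 0ᴿ ≤ᴿ x → 0ᴿ ≤ᴿ y → 0ᴿ ≤ᴿ x *ᴿ y
  0≤-*ᴿ {x} {y} 0≤x 0≤y ε 0<ε =
    let a , bx       = eventually-bounded (cauchy x)
        b , by       = eventually-bounded (cauchy y)
        η , 0<η , aη = scale-down (0<fromℕsuc a) (0<½ 0<ε)
        -- δ is chosen after η, since its coefficient B + η involves η.
        δ , 0<δ , bδ = scale-down (<-trans (0<fromℕsuc b) (p<q+ε {fromℕ (suc b)} ≤-refl 0<η)) (0<½ 0<ε)
    in mapᵉ (λ { n ((x<A , y<B) , (-δ<x , -η<y)) → bound {A = fromℕ (suc a)} {fromℕ (suc b)} {seq x n} {seq y n} aη bδ 0<δ 0<η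
         (≤-<-trans (p≤∣p∣ (seq x n)) x<A) (≤-<-trans (p≤∣p∣ (seq y n)) y<B) -δ<x -η<y })
       (both (both bx by) (both (0≤x δ 0<δ) (0≤y η 0<η)))
    where
    open ≤-Reasoning
    bound : ∀ {A B p q δ η} → A * η ≡ ½ * ε → (B + η) * δ ≡ ½ * ε → 0ℚ < δ → 0ℚ < η → p < A → q < B →
      0ℚ < p + δ → 0ℚ < q + η → 0ℚ < p * q + ε
    bound {A} {B} {p} {q} {δ} {η} Aη Bδ 0<δ 0<η p<A q<B 0<p+δ 0<q+η = begin-strict
      0ℚ  <⟨ 0<-* 0<p+δ 0<q+η ⟩
      (p + δ) * (q + η)  ≡⟨ solve 4 (λ p q d e → (p :+ d) :* (q :+ e) := p :* q :+ (e :* p :+ d :* (q :+ e))) refl p q δ η ⟩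
      p * q + (η * p + δ * (q + η))  ≤⟨ +-monoʳ-≤ (p * q) (+-mono-≤ (*-monoˡ-≤-nonNeg η {{nonNegative (<⇒≤ 0<η)}} (<⇒≤ p<A))
                        (*-monoˡ-≤-nonNeg δ {{nonNegative (<⇒≤ 0<δ)}} (+-monoˡ-≤ η (<⇒≤ q<B)))) ⟩
      p * q + (η * A + δ * (B + η))  ≡⟨ cong (p * q +_) (trans (cong₂ _+_ (trans (*-comm η A) Aη) (trans (*-comm δ (B + η)) Bδ)) (½+½ ε)) ⟩
      p * q + ε  ∎

  -- If y < 0 with gap δ, then x ≤ 0: an approximation p ≥ ε′ of x would give p q + ε′ δ ≤ p (q + δ)
  -- ≤ 0, against x y ≥ 0.
  *-cancel-0≤ᴿ : ∀ {x y} → ¬ (x ≤ᴿ 0ᴿ) → 0ᴿ ≤ᴿ x *ᴿ y → 0ᴿ ≤ᴿ y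
  *-cancel-0≤ᴿ {x} {y} x≰0 0≤xy ε 0<ε = [ id , (λ y<0 → ⊥-elim (x≰0 (x≤0 y<0))) ]′ (compare 0ᴿ y 0<ε)
    where
    open ≤-Reasoning
    small : ∀ {δ p q ε′} → 0ℚ < δ → q + δ < 0ℚ → 0ℚ < ε′ → 0ℚ < p * q + ε′ * δ → Dec (p < 0ℚ + ε′) → p < 0ℚ + ε′
    small 0<δ q+δ<0 0<ε′ 0< (yes p<) = p<
    small {δ} {p} {q} {ε′} 0<δ q+δ<0 0<ε′ 0< (no p≮) = ⊥-elim (<-irrefl refl (begin-strict
      0ℚ  <⟨ 0< ⟩
      p * q + ε′ * δ  ≤⟨ +-monoʳ-≤ (p * q) (*-monoʳ-≤-nonNeg δ {{nonNegative (<⇒≤ 0<δ)}} ε′≤p) ⟩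
      p * q + p * δ  ≡⟨ *-distribˡ-+ p q δ ⟨
      p * (q + δ)  ≤⟨ *-monoˡ-≤-nonNeg p {{nonNegative (≤-trans (<⇒≤ 0<ε′) ε′≤p)}} (<⇒≤ q+δ<0) ⟩
      p * 0ℚ  ≡⟨ *-zeroʳ p ⟩
      0ℚ  ∎))
      where
      ε′≤p : ε′ ≤ p
      ε′≤p = subst (_≤ p) (+-identityˡ ε′) (≮⇒≥ p≮)
    x≤0 : y <ᴿ 0ᴿ → x ≤ᴿ 0ᴿ
    x≤0 (δ , 0<δ , y+δ<0) ε′ 0<ε′ = mapᵉ
      (λ { n (y+δ<0 , 0<xy+) → small {δ} {seq x n} {seq y n} 0<δ y+δ<0 0<ε′ 0<xy+ (seq x n <? 0ℚ + ε′) })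
      (both y+δ<0 (0≤xy (ε′ * δ) (0<-* 0<ε′ 0<δ)))

  ℝ-orderedRing : OrderedRing
  ℝ-orderedRing = record
    { commutativeRing = ℝ-commutativeRing
    ; _≤_         = _≤ᴿ_
    ; ≤-reflexive = λ {x} {y} → ≈⇒≤ {x} {y}
    ; ≤-trans     = λ {x} {y} {z} → ≤-transᴿ {x} {y} {z}
    ; ≤-antisym   = λ {x} {y} → ≤-antisymᴿ {x} {y}
    ; +-mono-≤    = λ {x} {y} {u} {v} → +-mono-≤ᴿ {x} {y} {u} {v}
    ; 0≤-*        = λ {x} {y} → 0≤-*ᴿ {x} {y}
    ; ≤-stable    = λ {x} {y} → ≤-stableᴿ {x} {y}
    ; ≰⇒≥         = λ {x} {y} → ≰⇒≥ᴿ {x} {y}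
    ; *-cancel-0≤ = λ {x} {y} → *-cancel-0≤ᴿ {x} {y}
    }

  0≤sqrt : ∀ x → 0ᴿ ≤ᴿ sqrt x
  0≤sqrt x = pointwise-≤ {0ᴿ} {sqrt x} λ n → 0≤sqrtℚ (seq x n) n

  -- An approximation s is short of the root by at most η = 1/(n + 1), so s² is off by at most (2B +
  -- 1)η when s < B. Nonnegativity is asked at each index, as sums of squares satisfy it, so that s²
  -- ≤ `seq x n` also holds where s is 0.
  sqrt-square : ∀ x → (∀ n → 0ℚ ≤ seq x n) → sqrt x *ᴿ sqrt x ≈ᴿ x
  sqrt-square x 0≤x ε 0<ε =
    let b , bs       = eventually-bounded (cauchy (sqrt x))
        B            = fromℕ (suc b)
        0<C          = <-trans (positive⁻¹ 1ℚ) (subst (_< (B + B) + 1ℚ) (+-identityˡ 1ℚ) (+-monoˡ-< 1ℚ (+-mono-< (0<fromℕsuc b) (0<fromℕsuc b))))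
        δ , 0<δ , Cδ = scale-down 0<C 0<ε
    in mapᵉ (λ { n (s<B , η<δ) → close {B} {δ} n (≤-<-trans (p≤∣p∣ _) s<B) η<δ Cδ 0<C }) (both bs (1/suc-small 0<δ))
    where
    open ≤-Reasoning
    close : ∀ {B δ} n → let s = sqrtℚ (seq x n) n in s < B → 1/suc n < δ → (B + B + 1ℚ) * δ ≡ ε → 0ℚ < B + B + 1ℚ →
      ∣ s * s - seq x n ∣ < ε
    close {B} {δ} n s<B η<δ Cδ 0<C = ∣p-q∣<ε (p<q+ε s²≤x 0<ε) (begin-strict
      seq x n  <⟨ sqrtℚ-upper (seq x n) n ⟩
      (s + η) * (s + η)  ≡⟨ solve 2 (λ s e → (s :+ e) :* (s :+ e) := s :* s :+ ((s :+ s) :+ e) :* e) refl s η ⟩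
      s * s + ((s + s) + η) * η  ≤⟨ +-monoʳ-≤ (s * s) (*-monoʳ-≤-nonNeg η (+-mono-≤ (+-mono-≤ (<⇒≤ s<B) (<⇒≤ s<B)) η≤1)) ⟩
      s * s + (B + B + 1ℚ) * η  ≤⟨ +-monoʳ-≤ (s * s) (*-monoˡ-≤-nonNeg (B + B + 1ℚ) {{nonNegative (<⇒≤ 0<C)}} (<⇒≤ η<δ)) ⟩
      s * s + (B + B + 1ℚ) * δ  ≡⟨ cong (s * s +_) Cδ ⟩
      s * s + ε  ∎)
      where
      s = sqrtℚ (seq x n) n
      η = 1/suc n
      η≤1 : η ≤ 1ℚ
      η≤1 = subst₂ _≤_ (*-identityˡ η) (suc*1/suc n) (*-monoʳ-≤-nonNeg η (fromℕ-mono {1} {suc n} (ℕ.s≤s ℕ.z≤n)))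
      s²≤x : s * s ≤ seq x n
      s²≤x with sqrtℚ-lower (seq x n) n
      ... | inj₁ s≡0 = subst (_≤ seq x n) (sym (trans (cong₂ _*_ s≡0 s≡0) (*-zeroˡ 0ℚ))) (0≤x n)
      ... | inj₂ s²≤ = s²≤

-- The complex numbers over the Cauchy reals

module Complexes where

  open import Data.Rational.Base as ℚ using (ℚ; 0ℚ)
  import Data.Rational.Properties as ℚ
  open import Data.Rational.Solver using (module +-*-Solver)
  open import Data.Sum.Base using (inj₁; inj₂)
  open import Defs
  open Reals

  open +-*-Solver using (solve; con; _:+_; _:*_; _:-_; :-_; _:=_)

  private module ℝᶜ = CommutativeRing ℝ-commutativeRing

  -ᶜ_ : ℂ → ℂ
  -ᶜ z = mkℂ (-ᴿ re z) (-ᴿ im z)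

  pointwise-≈ᶜ : ∀ {z w} → (∀ n → seq (re z) n ≡ seq (re w) n) → (∀ n → seq (im z) n ≡ seq (im w) n) → z ≈ᶜ w
  pointwise-≈ᶜ {z} {w} eqʳ eqⁱ = pointwise-≈ {re z} {re w} eqʳ , pointwise-≈ {im z} {im w} eqⁱ

  ℂ-commutativeRing : CommutativeRing 0ℓ 0ℓ
  ℂ-commutativeRing = record
    { Carrier = ℂ ; _≈_ = _≈ᶜ_ ; _+_ = _+ᶜ_ ; _*_ = _*ᶜ_ ; -_ = -ᶜ_ ; 0# = fromℝ 0ᴿ ; 1# = fromℝ 1ᴿ
    ; isCommutativeRing = record
      { isRing = record
        { +-isAbelianGroup = record
          { isGroup = record
            { isMonoid = record
              { isSemigroup = record
                { isMagma = record
                  { isEquivalence = record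
                    { refl = λ {z} → ≈-reflᴿ {re z} , ≈-reflᴿ {im z}
                    ; sym = λ {z} {w} (p , q) → ≈-symᴿ {re z} {re w} p , ≈-symᴿ {im z} {im w} q
                    ; trans = λ {x} {y} {z} (p , q) (p′ , q′) →
                        ≈-transᴿ {re x} {re y} {re z} p p′ , ≈-transᴿ {im x} {im y} {im z} q q′ }
                  ; ∙-cong = λ {x} {y} {u} {v} (p , q) (p′ , q′) →
                      +-congᴿ {re x} {re y} {re u} {re v} p p′ , +-congᴿ {im x} {im y} {im u} {im v} q q′ }
                ; assoc = λ x y z → ℝᶜ.+-assoc (re x) (re y) (re z) , ℝᶜ.+-assoc (im x) (im y) (im z) }
              ; identity = (λ x → ℝᶜ.+-identityˡ (re x) , ℝᶜ.+-identityˡ (im x))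
                         , (λ x → ℝᶜ.+-identityʳ (re x) , ℝᶜ.+-identityʳ (im x)) }
            ; inverse = (λ x → ℝᶜ.-‿inverseˡ (re x) , ℝᶜ.-‿inverseˡ (im x))
                      , (λ x → ℝᶜ.-‿inverseʳ (re x) , ℝᶜ.-‿inverseʳ (im x))
            ; ⁻¹-cong = λ {x} {y} (p , q) → -‿congᴿ {re x} {re y} p , -‿congᴿ {im x} {im y} q }
          ; comm = λ x y → ℝᶜ.+-comm (re x) (re y) , ℝᶜ.+-comm (im x) (im y) }
        ; *-cong = λ {x} {y} {u} {v} (p , q) (p′ , q′) →
              +-congᴿ {re x *ᴿ re u} {re y *ᴿ re v} { -ᴿ (im x *ᴿ im u)} { -ᴿ (im y *ᴿ im v)}
                (*-congᴿ {re x} {re y} {re u} {re v} p p′)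
                (-‿congᴿ {im x *ᴿ im u} {im y *ᴿ im v} (*-congᴿ {im x} {im y} {im u} {im v} q q′))
            , +-congᴿ {re x *ᴿ im u} {re y *ᴿ im v} {im x *ᴿ re u} {im y *ᴿ re v}
                (*-congᴿ {re x} {re y} {im u} {im v} p q′) (*-congᴿ {im x} {im y} {re u} {re v} q p′)
        ; *-assoc = λ x y z → pointwise-≈ᶜ {(x *ᶜ y) *ᶜ z} {x *ᶜ (y *ᶜ z)}
            (λ n → solve 6 (λ a b c d e f → (a :* c :- b :* d) :* e :- (a :* d :+ b :* c) :* f
                        := a :* (c :* e :- d :* f) :- b :* (c :* f :+ d :* e)) ≡.refl
                     (seq (re x) n) (seq (im x) n) (seq (re y) n) (seq (im y) n) (seq (re z) n) (seq (im z) n))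
            (λ n → solve 6 (λ a b c d e f → (a :* c :- b :* d) :* f :+ (a :* d :+ b :* c) :* e
                        := a :* (c :* f :+ d :* e) :+ b :* (c :* e :- d :* f)) ≡.refl
                     (seq (re x) n) (seq (im x) n) (seq (re y) n) (seq (im y) n) (seq (re z) n) (seq (im z) n))
        ; *-identity = identityˡ , λ x → pointwise-≈ᶜ {x *ᶜ fromℝ 1ᴿ} {x}
            (λ n → solve 2 (λ a b → a :* con ℚ.1ℚ :- b :* con 0ℚ := a) ≡.refl (seq (re x) n) (seq (im x) n))
            (λ n → solve 2 (λ a b → a :* con 0ℚ :+ b :* con ℚ.1ℚ := b) ≡.refl (seq (re x) n) (seq (im x) n))
        ; distrib = (λ x y z → pointwise-≈ᶜ {x *ᶜ (y +ᶜ z)} {x *ᶜ y +ᶜ x *ᶜ z}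
            (λ n → solve 6 (λ a b c d e f → a :* (c :+ e) :- b :* (d :+ f) := (a :* c :- b :* d) :+ (a :* e :- b :* f)) ≡.refl
                     (seq (re x) n) (seq (im x) n) (seq (re y) n) (seq (im y) n) (seq (re z) n) (seq (im z) n))
            (λ n → solve 6 (λ a b c d e f → a :* (d :+ f) :+ b :* (c :+ e) := (a :* d :+ b :* c) :+ (a :* f :+ b :* e)) ≡.refl
                     (seq (re x) n) (seq (im x) n) (seq (re y) n) (seq (im y) n) (seq (re z) n) (seq (im z) n)))
          , (λ x y z → pointwise-≈ᶜ {(y +ᶜ z) *ᶜ x} {y *ᶜ x +ᶜ z *ᶜ x}
            (λ n → solve 6 (λ a b c d e f → (c :+ e) :* a :- (d :+ f) :* b := (c :* a :- d :* b) :+ (e :* a :- f :* b)) ≡.refl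
                     (seq (re x) n) (seq (im x) n) (seq (re y) n) (seq (im y) n) (seq (re z) n) (seq (im z) n))
            (λ n → solve 6 (λ a b c d e f → (c :+ e) :* b :+ (d :+ f) :* a := (c :* b :+ d :* a) :+ (e :* b :+ f :* a)) ≡.refl
                     (seq (re x) n) (seq (im x) n) (seq (re y) n) (seq (im y) n) (seq (re z) n) (seq (im z) n))) }
      ; *-comm = λ x y → pointwise-≈ᶜ {x *ᶜ y} {y *ᶜ x}
            (λ n → solve 4 (λ a b c d → a :* c :- b :* d := c :* a :- d :* b) ≡.refl
                     (seq (re x) n) (seq (im x) n) (seq (re y) n) (seq (im y) n))
            (λ n → solve 4 (λ a b c d → a :* d :+ b :* c := c :* b :+ d :* a) ≡.refl
                     (seq (re x) n) (seq (im x) n) (seq (re y) n) (seq (im y) n)) } }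
    where
    identityˡ : ∀ x → fromℝ 1ᴿ *ᶜ x ≈ᶜ x
    identityˡ x = pointwise-≈ᶜ {fromℝ 1ᴿ *ᶜ x} {x}
      (λ n → solve 2 (λ a b → con ℚ.1ℚ :* a :- con 0ℚ :* b := a) ≡.refl (seq (re x) n) (seq (im x) n))
      (λ n → solve 2 (λ a b → con ℚ.1ℚ :* b :+ con 0ℚ :* a := b) ≡.refl (seq (re x) n) (seq (im x) n))

  normSq : ℂ → ℝ
  normSq z = re z *ᴿ re z +ᴿ im z *ᴿ im z

  modulus-square : ∀ z → modulus z *ᴿ modulus z ≈ᴿ normSq z
  modulus-square z = sqrt-square (normSq z) λ n → ℚ.+-mono-≤ (0≤q² (seq (re z) n)) (0≤q² (seq (im z) n))
    where
    0≤q² : ∀ q → 0ℚ ℚ.≤ q ℚ.* q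
    0≤q² q with ℚ.≤-total 0ℚ q
    ... | inj₁ 0≤q = 0≤-* 0≤q 0≤q
    ... | inj₂ q≤0 = ≡.subst (0ℚ ℚ.≤_) (solve 1 (λ q → (:- q) :* (:- q) := q :* q) ≡.refl q)
                       (0≤-* (ℚ.neg-antimono-≤ q≤0) (ℚ.neg-antimono-≤ q≤0))

  0≤modulus : ∀ z → 0ᴿ ≤ᴿ modulus z
  0≤modulus z = 0≤sqrt (normSq z)

  open OrderedRingProperties ℝ-orderedRing using (square-injective; x²+y²≈0⇒x≈0; triangle)

  ℂ-extension : ComplexExtension ℝ-orderedRing
  ℂ-extension = record
    { commutativeRing = ℂ-commutativeRing
    ; conj            = conj
    ; conj-cong       = λ {z} {w} (p , q) → p , -‿congᴿ {im z} {im w} q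
    ; conj-+          = λ z w → pointwise-≈ᶜ {conj (z +ᶜ w)} {conj z +ᶜ conj w} (λ n → ≡.refl)
                          (λ n → ℚ.neg-distrib-+ (seq (im z) n) (seq (im w) n))
    ; conj-*          = λ z w → pointwise-≈ᶜ {conj (z *ᶜ w)} {conj z *ᶜ conj w}
                          (λ n → solve 4 (λ a b c d → a :* c :- b :* d := a :* c :- (:- b) :* (:- d)) ≡.refl
                        (seq (re z) n) (seq (im z) n) (seq (re w) n) (seq (im w) n))
                          (λ n → solve 4 (λ a b c d → :- (a :* d :+ b :* c) := a :* (:- d) :+ (:- b) :* c) ≡.refl
                        (seq (re z) n) (seq (im z) n) (seq (re w) n) (seq (im w) n))
    ; conj-involutive = λ z → pointwise-≈ᶜ {conj (conj z)} {z} (λ n → ≡.refl)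
                          (λ n → solve 1 (λ b → :- (:- b) := b) ≡.refl (seq (im z) n))
    ; ι               = fromℝ
    ; ι-cong          = λ p → p , ≈-reflᴿ {0ᴿ}
    ; ι-injective     = proj₁
    ; ι-+             = λ x y → pointwise-≈ᶜ {fromℝ (x +ᴿ y)} {fromℝ x +ᶜ fromℝ y} (λ n → ≡.refl) (λ n → ≡.refl)
    ; ι-*             = λ x y → pointwise-≈ᶜ {fromℝ (x *ᴿ y)} {fromℝ x *ᶜ fromℝ y}
                          (λ n → solve 2 (λ a c → a :* c := a :* c :- con 0ℚ :* con 0ℚ) ≡.refl (seq x n) (seq y n))
                          (λ n → solve 2 (λ a c → con 0ℚ := a :* con 0ℚ :+ con 0ℚ :* c) ≡.refl (seq x n) (seq y n))
    ; ι-0             = ≈-reflᴿ {0ᴿ} , ≈-reflᴿ {0ᴿ}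
    ; ι-1             = ≈-reflᴿ {1ᴿ} , ≈-reflᴿ {0ᴿ}
    ; conj-ι          = λ x → pointwise-≈ᶜ {conj (fromℝ x)} {fromℝ x} (λ n → ≡.refl) (λ n → ≡.refl)
    ; ∣_∣             = modulus
    ; ∣∣-cong         = λ {z} {w} → modulus-cong z w
    ; 0≤∣∣            = 0≤modulus
    ; ∣∣²             = λ z → ℂᶜ.trans {fromℝ (modulus z *ᴿ modulus z)} {fromℝ (normSq z)} {z *ᶜ conj z}
                          (modulus-square z , ≈-reflᴿ {0ᴿ})
                          (pointwise-≈ᶜ {fromℝ (normSq z)} {z *ᶜ conj z}
                            (λ n → solve 2 (λ a b → a :* a :+ b :* b := a :* a :- b :* (:- b)) ≡.refl (seq (re z) n) (seq (im z) n))
                            (λ n → solve 2 (λ a b → con 0ℚ := a :* (:- b) :+ b :* a) ≡.refl (seq (re z) n) (seq (im z) n)))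
    ; ∣+∣≤            = λ z w → triangle {re z} {im z} {re w} {im w} {modulus z} {modulus w} {modulus (z +ᶜ w)}
                          (0≤modulus z) (0≤modulus w) (modulus-square z) (modulus-square w) (modulus-square (z +ᶜ w))
    ; ∣z∣≈0⇒z≈0       = λ {z} → modulus-zero z
    }
    where
    module ℂᶜ = CommutativeRing ℂ-commutativeRing
    -- Through uniqueness of nonnegative square roots, which replaces a continuity estimate for
    -- `sqrt`.
    modulus-cong : ∀ z w → z ≈ᶜ w → modulus z ≈ᴿ modulus w
    modulus-cong z w (p , q) = square-injective {modulus z} {modulus w} (0≤modulus z) (0≤modulus w)
      (ℝᶜ.trans {modulus z *ᴿ modulus z} {normSq z} {modulus w *ᴿ modulus w} (modulus-square z)
        (ℝᶜ.trans {normSq z} {normSq w} {modulus w *ᴿ modulus w}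
          (+-congᴿ {re z *ᴿ re z} {re w *ᴿ re w} {im z *ᴿ im z} {im w *ᴿ im w}
            (*-congᴿ {re z} {re w} {re z} {re w} p p) (*-congᴿ {im z} {im w} {im z} {im w} q q))
          (ℝᶜ.sym {modulus w *ᴿ modulus w} {normSq w} (modulus-square w))))
    modulus-zero : ∀ z → modulus z ≈ᴿ 0ᴿ → z ≈ᶜ fromℝ 0ᴿ
    modulus-zero z ∣z∣≈0 = x²+y²≈0⇒x≈0 {re z} {im z} normSq≈0
      , x²+y²≈0⇒x≈0 {im z} {re z} (ℝᶜ.trans {im z *ᴿ im z +ᴿ re z *ᴿ re z} {normSq z} {0ᴿ} (ℝᶜ.+-comm (im z *ᴿ im z) (re z *ᴿ re z)) normSq≈0)
      where
      normSq≈0 : normSq z ≈ᴿ 0ᴿ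
      normSq≈0 = ℝᶜ.trans {normSq z} {modulus z *ᴿ modulus z} {0ᴿ} (ℝᶜ.sym {modulus z *ᴿ modulus z} {normSq z} (modulus-square z))
        (ℝᶜ.trans {modulus z *ᴿ modulus z} {0ᴿ *ᴿ 0ᴿ} {0ᴿ} (*-congᴿ {modulus z} {0ᴿ} {modulus z} {0ᴿ} ∣z∣≈0 ∣z∣≈0) (ℝᶜ.zeroˡ 0ᴿ))

-- Cauchy products of exponential series

module ExpSeries where

  open import Data.Rational.Base hiding (NonZero)
  open import Data.Rational.Properties
  open import Data.Rational.Solver using (module +-*-Solver)
  open import Relation.Binary.PropositionalEquality
  open import Defs

  open +-*-Solver using (solve; con; _:+_; _:*_; _:-_; :-_; _:=_)

  psum : (ℕ → ℚ) → ℕ → ℚ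
  psum f zero    = 0ℚ
  psum f (suc n) = psum f n + f n

  -- Σ_{i + j = n} f i * g j
  conv : (f g : ℕ → ℚ) → ℕ → ℚ
  conv f g zero    = f 0 * g 0
  conv f g (suc n) = f 0 * g (suc n) + conv (f ∘ suc) g n

  conv-cong : ∀ {f f′ g g′} → (∀ k → f k ≡ f′ k) → (∀ k → g k ≡ g′ k) → ∀ n → conv f g n ≡ conv f′ g′ n
  conv-cong f≡ g≡ zero    = cong₂ _*_ (f≡ 0) (g≡ 0)
  conv-cong f≡ g≡ (suc n) = cong₂ _+_ (cong₂ _*_ (f≡ 0) (g≡ (suc n))) (conv-cong (f≡ ∘ suc) g≡ n)

  conv-+ˡ : ∀ f f′ g n → conv (λ k → f k + f′ k) g n ≡ conv f g n + conv f′ g n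
  conv-+ˡ f f′ g zero    = *-distribʳ-+ (g 0) (f 0) (f′ 0)
  conv-+ˡ f f′ g (suc n) = trans (cong ((f 0 + f′ 0) * g (suc n) +_) (conv-+ˡ (f ∘ suc) (f′ ∘ suc) g n))
    (solve 5 (λ a b c x y → (a :+ b) :* c :+ (x :+ y) := (a :* c :+ x) :+ (b :* c :+ y)) refl
      (f 0) (f′ 0) (g (suc n)) (conv (f ∘ suc) g n) (conv (f′ ∘ suc) g n))

  conv-*ˡ : ∀ c f g n → conv (λ k → c * f k) g n ≡ c * conv f g n
  conv-*ˡ c f g zero    = *-assoc c (f 0) (g 0)
  conv-*ˡ c f g (suc n) = trans (cong (c * f 0 * g (suc n) +_) (conv-*ˡ c (f ∘ suc) g n))
    (solve 4 (λ c a b x → c :* a :* b :+ c :* x := c :* (a :* b :+ x)) refl c (f 0) (g (suc n)) (conv (f ∘ suc) g n))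

  conv-*ʳ : ∀ c f g n → conv f (λ k → c * g k) n ≡ c * conv f g n
  conv-*ʳ c f g zero    = solve 3 (λ c a b → a :* (c :* b) := c :* (a :* b)) refl c (f 0) (g 0)
  conv-*ʳ c f g (suc n) = trans (cong (f 0 * (c * g (suc n)) +_) (conv-*ʳ c (f ∘ suc) g n))
    (solve 4 (λ c a b x → a :* (c :* b) :+ c :* x := c :* (a :* b :+ x)) refl c (f 0) (g (suc n)) (conv (f ∘ suc) g n))

  conv-suc : ∀ f g n → conv f g (suc n) ≡ conv f (g ∘ suc) n + f (suc n) * g 0
  conv-suc f g zero    = refl
  conv-suc f g (suc n) = trans (cong (f 0 * g (suc (suc n)) +_) (conv-suc (f ∘ suc) g n))
    (sym (+-assoc (f 0 * g (suc (suc n))) (conv (f ∘ suc) (g ∘ suc) n) (f (suc (suc n)) * g 0)))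

  weight : (ℕ → ℚ) → ℕ → ℚ
  weight f k = fromℕ k * f k

  -- The Leibniz rule for the Euler operator x d/dx, which multiplies the k-th coefficient by k.
  conv-weight : ∀ f g n → conv (weight f) g n + conv f (weight g) n ≡ fromℕ n * conv f g n
  conv-weight f g zero    = solve 2 (λ a b → con 0ℚ :* a :* b :+ a :* (con 0ℚ :* b) := con 0ℚ :* (a :* b)) refl (f 0) (g 0)
  conv-weight f g (suc n) = begin
    (0ℚ * f 0 * g (suc n) + conv (weight f ∘ suc) g n) + (f 0 * (fromℕ (suc n) * g (suc n)) + conv (f ∘ suc) (weight g) n)
      ≡⟨ cong₂ (λ u m → (0ℚ * f 0 * g (suc n) + u) + (f 0 * (m * g (suc n)) + conv (f ∘ suc) (weight g) n)) step (fromℕ-+ 1 n) ⟩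
    (0ℚ * f 0 * g (suc n) + (conv (weight (f ∘ suc)) g n + c)) + (f 0 * ((1ℚ + fromℕ n) * g (suc n)) + conv (f ∘ suc) (weight g) n)
      ≡⟨ solve 6 (λ a b m u v c → (con 0ℚ :* a :* b :+ (u :+ c)) :+ (a :* ((con 1ℚ :+ m) :* b) :+ v)
                             := (u :+ v) :+ (c :+ (con 1ℚ :+ m) :* (a :* b))) refl
           (f 0) (g (suc n)) (fromℕ n) (conv (weight (f ∘ suc)) g n) (conv (f ∘ suc) (weight g) n) c ⟩
    (conv (weight (f ∘ suc)) g n + conv (f ∘ suc) (weight g) n) + (c + (1ℚ + fromℕ n) * (f 0 * g (suc n)))
      ≡⟨ cong (_+ (c + (1ℚ + fromℕ n) * (f 0 * g (suc n)))) (conv-weight (f ∘ suc) g n) ⟩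
    fromℕ n * c + (c + (1ℚ + fromℕ n) * (f 0 * g (suc n)))
      ≡⟨ solve 3 (λ m c d → m :* c :+ (c :+ (con 1ℚ :+ m) :* d) := (con 1ℚ :+ m) :* (d :+ c)) refl (fromℕ n) c (f 0 * g (suc n)) ⟩
    (1ℚ + fromℕ n) * (f 0 * g (suc n) + c)
      ≡⟨ cong (_* (f 0 * g (suc n) + c)) (fromℕ-+ 1 n) ⟨
    fromℕ (suc n) * (f 0 * g (suc n) + c) ∎
    where
    open ≡-Reasoning
    c = conv (f ∘ suc) g n
    step : conv (weight f ∘ suc) g n ≡ conv (weight (f ∘ suc)) g n + c
    step = trans (conv-cong (λ k → trans (cong (_* f (suc k)) (fromℕ-+ 1 k))
             (solve 2 (λ m a → (con 1ℚ :+ m) :* a := m :* a :+ a) refl (fromℕ k) (f (suc k)))) (λ _ → refl) n)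
           (conv-+ˡ (weight (f ∘ suc)) (f ∘ suc) g n)

  weight-expTerm : ∀ q k → fromℕ (suc k) * expTerm q (suc k) ≡ q * expTerm q k
  weight-expTerm q k = trans
    (solve 4 (λ m t q r → m :* (t :* (q :* r)) := q :* t :* (m :* r)) refl (fromℕ (suc k)) (expTerm q k) q (1/suc k))
    (trans (cong (q * expTerm q k *_) (suc*1/suc k)) (*-identityʳ (q * expTerm q k)))

  -- The binomial theorem, by induction from (n + 1) tₙ₊₁(q) = q tₙ(q).
  conv-expTerm : ∀ q r n → conv (expTerm q) (expTerm r) n ≡ expTerm (q + r) n
  conv-expTerm q r zero    = refl
  conv-expTerm q r (suc n) = begin
    X  ≡⟨ *-identityˡ X ⟨
    1ℚ * X  ≡⟨ cong (_* X) (suc*1/suc n) ⟨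
    fromℕ (suc n) * 1/suc n * X  ≡⟨ solve 3 (λ m r x → m :* r :* x := m :* x :* r) refl (fromℕ (suc n)) (1/suc n) X ⟩
    fromℕ (suc n) * X * 1/suc n  ≡⟨ cong (_* 1/suc n) (conv-weight (expTerm q) (expTerm r) (suc n)) ⟨
    (conv (weight (expTerm q)) (expTerm r) (suc n) + conv (expTerm q) (weight (expTerm r)) (suc n)) * 1/suc n
                        ≡⟨ cong (_* 1/suc n) (cong₂ _+_ left right) ⟩
    (q * conv (expTerm q) (expTerm r) n + r * conv (expTerm q) (expTerm r) n) * 1/suc n
                        ≡⟨ cong (λ y → (q * y + r * y) * 1/suc n) (conv-expTerm q r n) ⟩
    (q * expTerm (q + r) n + r * expTerm (q + r) n) * 1/suc n
                        ≡⟨ solve 4 (λ q r t s → (q :* t :+ r :* t) :* s := t :* ((q :+ r) :* s)) refl q r (expTerm (q + r) n) (1/suc n) ⟩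
    expTerm (q + r) (suc n)  ∎
    where
    open ≡-Reasoning
    X = conv (expTerm q) (expTerm r) (suc n)
    left : conv (weight (expTerm q)) (expTerm r) (suc n) ≡ q * conv (expTerm q) (expTerm r) n
    left = trans (solve 2 (λ b x → con 0ℚ :* con 1ℚ :* b :+ x := x) refl (expTerm r (suc n)) (conv (weight (expTerm q) ∘ suc) (expTerm r) n))
      (trans (conv-cong {g = expTerm r} (weight-expTerm q) (λ _ → refl) n) (conv-*ˡ q (expTerm q) (expTerm r) n))
    right : conv (expTerm q) (weight (expTerm r)) (suc n) ≡ r * conv (expTerm q) (expTerm r) n
    right = trans (conv-suc (expTerm q) (weight (expTerm r)) n)
      (trans (solve 2 (λ x a → x :+ a :* (con 0ℚ :* con 1ℚ) := x) refl (conv (expTerm q) (weight (expTerm r) ∘ suc) n) (expTerm q (suc n)))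
        (trans (conv-cong {expTerm q} (λ _ → refl) (weight-expTerm r) n) (conv-*ʳ r (expTerm q) (expTerm r) n)))

  -- On the antidiagonal i + j = n the combined coefficient is the constant u n and can be taken out
  -- of the convolution.
  conv-addition : ∀ (x c y s u f g : ℕ → ℚ) → (∀ i j → x i * c j + y i * s j ≡ u (i ℕ.+ j)) → ∀ n →
    conv (λ k → x k * f k) (λ k → c k * g k) n + conv (λ k → y k * f k) (λ k → s k * g k) n ≡ u n * conv f g n
  conv-addition x c y s u f g add zero = trans
    (solve 6 (λ x c y s a b → x :* a :* (c :* b) :+ y :* a :* (s :* b) := (x :* c :+ y :* s) :* (a :* b)) refl
      (x 0) (c 0) (y 0) (s 0) (f 0) (g 0))
    (cong (_* (f 0 * g 0)) (add 0 0))
  conv-addition x c y s u f g add (suc n) = trans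
    (solve 8 (λ x c y s a b p q → (x :* a :* (c :* b) :+ p) :+ (y :* a :* (s :* b) :+ q) := (x :* c :+ y :* s) :* (a :* b) :+ (p :+ q)) refl
      (x 0) (c (suc n)) (y 0) (s (suc n)) (f 0) (g (suc n))
      (conv (λ k → x (suc k) * f (suc k)) (λ k → c k * g k) n) (conv (λ k → y (suc k) * f (suc k)) (λ k → s k * g k) n))
    (trans (cong₂ (λ p q → p * (f 0 * g (suc n)) + q) (add 0 (suc n))
        (conv-addition (x ∘ suc) c (y ∘ suc) s (u ∘ suc) (f ∘ suc) g (λ i j → add (suc i) j) n))
      (sym (*-distribˡ-+ (u (suc n)) (f 0 * g (suc n)) (conv (f ∘ suc) g n))))

  psum-cong : ∀ {f g} → (∀ k → f k ≡ g k) → ∀ n → psum f n ≡ psum g n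
  psum-cong f≡g zero    = refl
  psum-cong f≡g (suc n) = cong₂ _+_ (psum-cong f≡g n) (f≡g n)

  psum-+ : ∀ f g n → psum (λ k → f k + g k) n ≡ psum f n + psum g n
  psum-+ f g zero    = refl
  psum-+ f g (suc n) = trans (cong (_+ (f n + g n)) (psum-+ f g n))
    (solve 4 (λ a b c d → (a :+ b) :+ (c :+ d) := (a :+ c) :+ (b :+ d)) refl (psum f n) (psum g n) (f n) (g n))

  psum-suc : ∀ f n → psum f (suc n) ≡ f 0 + psum (f ∘ suc) n
  psum-suc f zero    = trans (+-identityˡ (f 0)) (sym (+-identityʳ (f 0)))
  psum-suc f (suc n) = trans (cong (_+ f (suc n)) (psum-suc f n)) (+-assoc (f 0) (psum (f ∘ suc) n) (f (suc n)))

  psum-*ˡ : ∀ c f n → psum (λ k → c * f k) n ≡ c * psum f n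
  psum-*ˡ c f zero    = sym (*-zeroʳ c)
  psum-*ˡ c f (suc n) = trans (cong (_+ c * f n) (psum-*ˡ c f n)) (sym (*-distribˡ-+ c (psum f n) (f n)))

  expSeries-psum : ∀ c q n → expSeries c q n ≡ psum (λ k → c k * expTerm q k) n
  expSeries-psum c q zero    = refl
  expSeries-psum c q (suc n) = cong (_+ c n * expTerm q n) (expSeries-psum c q n)

  -- The sum of f i · g j over the triangle i + j < n.
  triangular : (f g : ℕ → ℚ) → ℕ → ℚ
  triangular f g = psum (conv f g)

  triangular-suc : ∀ f g n → triangular f g (suc n) ≡ f 0 * psum g (suc n) + triangular (f ∘ suc) g n
  triangular-suc f g n = begin
    psum (conv f g) (suc n)  ≡⟨ psum-suc (conv f g) n ⟩
    f 0 * g 0 + psum (λ k → f 0 * g (suc k) + conv (f ∘ suc) g k) n  ≡⟨ cong (f 0 * g 0 +_) (psum-+ (λ k → f 0 * g (suc k)) (conv (f ∘ suc) g) n) ⟩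
    f 0 * g 0 + (psum (λ k → f 0 * g (suc k)) n + t)  ≡⟨ cong (λ z → f 0 * g 0 + (z + t)) (psum-*ˡ (f 0) (g ∘ suc) n) ⟩
    f 0 * g 0 + (f 0 * psum (g ∘ suc) n + t)  ≡⟨ solve 4 (λ a b c t → a :* b :+ (a :* c :+ t) := a :* (b :+ c) :+ t) refl (f 0) (g 0) (psum (g ∘ suc) n) t ⟩
    f 0 * (g 0 + psum (g ∘ suc) n) + t  ≡⟨ cong (λ z → f 0 * z + t) (psum-suc g n) ⟨
    f 0 * psum g (suc n) + t  ∎
    where
    open ≡-Reasoning
    t = triangular (f ∘ suc) g n

  0≤psum : ∀ {f} → (∀ k → 0ℚ ≤ f k) → ∀ n → 0ℚ ≤ psum f n
  0≤psum 0≤f zero    = ≤-refl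
  0≤psum 0≤f (suc n) = +-mono-≤ (0≤psum 0≤f n) (0≤f n)

  0≤conv : ∀ {f g} → (∀ k → 0ℚ ≤ f k) → (∀ k → 0ℚ ≤ g k) → ∀ n → 0ℚ ≤ conv f g n
  0≤conv 0≤f 0≤g zero    = 0≤-* (0≤f 0) (0≤g 0)
  0≤conv 0≤f 0≤g (suc n) = +-mono-≤ (0≤-* (0≤f 0) (0≤g (suc n))) (0≤conv (0≤f ∘ suc) 0≤g n)

  psum-diff : ∀ {g G} → (∀ k → ∣ g k ∣ ≤ G k) → ∀ M d → ∣ psum g (d ℕ.+ M) - psum g M ∣ ≤ psum G (d ℕ.+ M) - psum G M
  psum-diff {g} {G} g≤G M zero    = ≤-reflexive (trans (cong ∣_∣ (+-inverseʳ (psum g M))) (sym (+-inverseʳ (psum G M))))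
  psum-diff {g} {G} g≤G M (suc d) = begin
    ∣ (P + g k) - Q ∣  ≡⟨ cong ∣_∣ (solve 3 (λ p x q → (p :+ x) :- q := (p :- q) :+ x) refl P (g k) Q) ⟩
    ∣ (P - Q) + g k ∣  ≤⟨ ∣p+q∣≤∣p∣+∣q∣ (P - Q) (g k) ⟩
    ∣ P - Q ∣ + ∣ g k ∣  ≤⟨ +-mono-≤ (psum-diff g≤G M d) (g≤G k) ⟩
    (psum G k - psum G M) + G k  ≡⟨ solve 3 (λ p x q → (p :- q) :+ x := (p :+ x) :- q) refl (psum G k) (G k) (psum G M) ⟩
    (psum G k + G k) - psum G M  ∎
    where
    open ≤-Reasoning
    k = d ℕ.+ M
    P = psum g k
    Q = psum g M

  -- The sum over i < n, j < d + n outside the triangle i + j < n. The offset d is for the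
  -- induction: removing the row i = 0 leaves one row less but the same columns, so d grows by one.
  square-triangle : (f g : ℕ → ℚ) → ℕ → ℕ → ℚ
  square-triangle f g n d = psum f n * psum g (d ℕ.+ n) - triangular f g n

  square-triangle-suc : ∀ f g n d →
    square-triangle f g (suc n) d ≡ f 0 * (psum g (d ℕ.+ suc n) - psum g (suc n)) + square-triangle (f ∘ suc) g n (suc d)
  square-triangle-suc f g n d = trans
    (cong₂ (λ u v → u * psum g (d ℕ.+ suc n) - v) (psum-suc f n) (triangular-suc f g n))
    (trans (solve 5 (λ a p b c t → (a :+ p) :* b :- (a :* c :+ t) := a :* (b :- c) :+ (p :* b :- t)) refl
        (f 0) (psum (f ∘ suc) n) (psum g (d ℕ.+ suc n)) (psum g (suc n)) (triangular (f ∘ suc) g n))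
      (cong (λ m → f 0 * (psum g (d ℕ.+ suc n) - psum g (suc n)) + (psum (f ∘ suc) n * psum g m - triangular (f ∘ suc) g n))
        (ℕ.+-suc d n)))

  -- The region does not depend on the sequences, so termwise domination passes to the sums.
  -- Induction peels off the row i = 0, whose part outside the triangle is a difference of partial
  -- sums of g.
  square-triangle-bound : ∀ {f g F G} → (∀ k → ∣ f k ∣ ≤ F k) → (∀ k → ∣ g k ∣ ≤ G k) → ∀ n d →
    ∣ square-triangle f g n d ∣ ≤ square-triangle F G n d
  square-triangle-bound {f} {g} {F} {G} f≤F g≤G zero d = ≤-reflexive (trans
    (cong ∣_∣ (solve 1 (λ b → con 0ℚ :* b :- con 0ℚ := con 0ℚ) refl (psum g (d ℕ.+ 0))))
    (sym (solve 1 (λ b → con 0ℚ :* b :- con 0ℚ := con 0ℚ) refl (psum G (d ℕ.+ 0)))))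
  square-triangle-bound {f} {g} {F} {G} f≤F g≤G (suc n) d = begin
    ∣ square-triangle f g (suc n) d ∣  ≡⟨ cong ∣_∣ (square-triangle-suc f g n d) ⟩
    ∣ f 0 * Δ g + square-triangle (f ∘ suc) g n (suc d) ∣  ≤⟨ ∣p+q∣≤∣p∣+∣q∣ (f 0 * Δ g) _ ⟩
    ∣ f 0 * Δ g ∣ + ∣ square-triangle (f ∘ suc) g n (suc d) ∣  ≡⟨ cong (_+ ∣ square-triangle (f ∘ suc) g n (suc d) ∣) (∣p*q∣≡∣p∣*∣q∣ (f 0) (Δ g)) ⟩
    ∣ f 0 ∣ * ∣ Δ g ∣ + ∣ square-triangle (f ∘ suc) g n (suc d) ∣  ≤⟨ +-mono-≤ (*-mono (0≤∣p∣ (f 0)) (≤-trans (0≤∣p∣ (Δ g)) Δ≤) (f≤F 0) Δ≤)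
                        (square-triangle-bound (f≤F ∘ suc) g≤G n (suc d)) ⟩
    F 0 * Δ G + square-triangle (F ∘ suc) G n (suc d)  ≡⟨ square-triangle-suc F G n d ⟨
    square-triangle F G (suc n) d  ∎
    where
    open ≤-Reasoning
    Δ : (ℕ → ℚ) → ℚ
    Δ g = psum g (d ℕ.+ suc n) - psum g (suc n)
    Δ≤ : ∣ Δ g ∣ ≤ Δ G
    Δ≤ = psum-diff g≤G (suc n) d

  -- All terms are nonnegative, and i < m, j < n imply i + j < m + n.
  square≤triangle : ∀ {f g} → (∀ k → 0ℚ ≤ f k) → (∀ k → 0ℚ ≤ g k) → ∀ m n → psum f m * psum g n ≤ triangular f g (m ℕ.+ n)
  square≤triangle {f} {g} 0≤f 0≤g zero    n = ≤-trans (≤-reflexive (*-zeroˡ (psum g n))) (0≤psum (0≤conv 0≤f 0≤g) n)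
  square≤triangle {f} {g} 0≤f 0≤g (suc m) n = begin
    psum f (suc m) * psum g n  ≡⟨ cong (_* psum g n) (psum-suc f m) ⟩
    (f 0 + psum (f ∘ suc) m) * psum g n  ≡⟨ *-distribʳ-+ (psum g n) (f 0) (psum (f ∘ suc) m) ⟩
    f 0 * psum g n + psum (f ∘ suc) m * psum g n  ≤⟨ +-mono-≤ (*-monoˡ-≤-nonNeg (f 0) {{nonNegative (0≤f 0)}} (psum-mono (suc m)))
                        (square≤triangle (0≤f ∘ suc) 0≤g m n) ⟩
    f 0 * psum g (suc m ℕ.+ n) + triangular (f ∘ suc) g (m ℕ.+ n)  ≡⟨ triangular-suc f g (m ℕ.+ n) ⟨
    triangular f g (suc m ℕ.+ n)  ∎
    where
    open ≤-Reasoning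
    psum-mono : ∀ d → psum g n ≤ psum g (d ℕ.+ n)
    psum-mono zero    = ≤-refl
    psum-mono (suc d) = ≤-trans (psum-mono d) (subst (_≤ psum g (d ℕ.+ n) + g (d ℕ.+ n)) (+-identityʳ _) (+-monoʳ-≤ (psum g (d ℕ.+ n)) (0≤g (d ℕ.+ n))))

  one : ℕ → ℚ
  one _ = 1ℚ

  -- The part of the square of partial sums outside the triangle i + j < n is dominated by the
  -- tail of the exponential series at 2b, and therefore tends to 0.
  square-triangle-expTerm : ∀ b n → square-triangle (expTerm (fromℕ b)) (expTerm (fromℕ b)) n 0 ≤
    expSeries one (fromℕ (b ℕ.+ b)) (n ℕ.+ n) - expSeries one (fromℕ (b ℕ.+ b)) n
  square-triangle-expTerm b n = begin
    psum t n * psum t n - triangular t t n  ≤⟨ +-monoˡ-≤ (- triangular t t n) (square≤triangle (0≤expTerm b) (0≤expTerm b) n n) ⟩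
    triangular t t (n ℕ.+ n) - triangular t t n  ≡⟨ cong₂ _-_ (triangular≡ (n ℕ.+ n)) (triangular≡ n) ⟩
    expSeries one (fromℕ (b ℕ.+ b)) (n ℕ.+ n) - expSeries one (fromℕ (b ℕ.+ b)) n ∎
    where
    open ≤-Reasoning
    t = expTerm (fromℕ b)
    triangular≡ : ∀ m → triangular t t m ≡ expSeries one (fromℕ (b ℕ.+ b)) m
    triangular≡ m = trans (psum-cong (λ k → trans (conv-expTerm (fromℕ b) (fromℕ b) k)
        (trans (cong (λ z → expTerm z k) (sym (fromℕ-+ b b))) (sym (*-identityˡ _)))) m)
      (sym (expSeries-psum one (fromℕ (b ℕ.+ b)) m))

  module _ {c d : ℕ → ℚ} (c≤1 : ∀ k → ∣ c k ∣ ≤ 1ℚ) (d≤1 : ∀ k → ∣ d k ∣ ≤ 1ℚ) where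

    -- `N` is uniform over all arguments of absolute value at most b, because the n-th approximation
    -- of cos or sin evaluates its partial sum at an argument that itself changes with n.
    product-triangle : ∀ b {ε} → 0ℚ < ε → ∃[ N ] ∀ n → N ℕ.≤ n → ∀ {q r} → ∣ q ∣ ≤ fromℕ b → ∣ r ∣ ≤ fromℕ b →
      ∣ expSeries c q n * expSeries d r n - triangular (λ k → c k * expTerm q k) (λ k → d k * expTerm r k) n ∣ < ε
    product-triangle b {ε} 0<ε =
      let M , conv = expSeries-converges one (λ _ → ≤-refl) (b ℕ.+ b) (0<½ 0<ε)
      in M , λ n M≤n {q} {r} q≤b r≤b → ≤-<-trans (bound n q≤b r≤b) (tail (λ m M≤m → conv {fromℕ (b ℕ.+ b)} (≤-reflexive (0≤p⇒∣p∣≡p (0≤fromℕ (b ℕ.+ b)))) m M≤m) n M≤n)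
      where
      open ≤-Reasoning
      E : ℕ → ℚ
      E = expSeries one (fromℕ (b ℕ.+ b))
      dominated : ∀ {c : ℕ → ℚ} → (∀ k → ∣ c k ∣ ≤ 1ℚ) → ∀ {q} → ∣ q ∣ ≤ fromℕ b → ∀ k → ∣ c k * expTerm q k ∣ ≤ expTerm (fromℕ b) k
      dominated {c} c≤1 {q} q≤b k = begin
        ∣ c k * expTerm q k ∣  ≡⟨ ∣p*q∣≡∣p∣*∣q∣ (c k) (expTerm q k) ⟩
        ∣ c k ∣ * ∣ expTerm q k ∣  ≤⟨ *-mono (0≤∣p∣ (c k)) (0≤expTerm b k) (c≤1 k) (∣expTerm∣≤ b q≤b k) ⟩
        1ℚ * expTerm (fromℕ b) k  ≡⟨ *-identityˡ _ ⟩
        expTerm (fromℕ b) k  ∎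
      bound : ∀ n {q r} → ∣ q ∣ ≤ fromℕ b → ∣ r ∣ ≤ fromℕ b →
        ∣ expSeries c q n * expSeries d r n - triangular (λ k → c k * expTerm q k) (λ k → d k * expTerm r k) n ∣ ≤ E (n ℕ.+ n) - E n
      bound n {q} {r} q≤b r≤b = begin
        ∣ expSeries c q n * expSeries d r n - T ∣  ≡⟨ cong₂ (λ u v → ∣ u * v - T ∣) (expSeries-psum c q n) (expSeries-psum d r n) ⟩
        ∣ square-triangle (λ k → c k * expTerm q k) (λ k → d k * expTerm r k) n 0 ∣
                        ≤⟨ square-triangle-bound (dominated c≤1 q≤b) (dominated d≤1 r≤b) n 0 ⟩
        square-triangle (expTerm (fromℕ b)) (expTerm (fromℕ b)) n 0  ≤⟨ square-triangle-expTerm b n ⟩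
        E (n ℕ.+ n) - E n  ∎
        where T = triangular (λ k → c k * expTerm q k) (λ k → d k * expTerm r k) n
      tail : ∀ {M} → (∀ m → M ℕ.≤ m → ∣ E m - E M ∣ < ½ * ε) → ∀ n → M ℕ.≤ n → E (n ℕ.+ n) - E n < ε
      tail {M} conv n M≤n = begin-strict
        E (n ℕ.+ n) - E n  ≤⟨ p≤∣p∣ _ ⟩
        ∣ E (n ℕ.+ n) - E n ∣  ≤⟨ ∣-∣-triangle (E (n ℕ.+ n)) (E M) (E n) ⟩
        ∣ E (n ℕ.+ n) - E M ∣ + ∣ E M - E n ∣  <⟨ +-mono-< (conv (n ℕ.+ n) (ℕ.≤-trans M≤n (ℕ.m≤m+n n n))) (subst (_< ½ * ε) (∣-∣-sym (E n) (E M)) (conv n M≤n)) ⟩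
        ½ * ε + ½ * ε  ≡⟨ ½+½ ε ⟩
        ε  ∎

-- Addition theorems for cos, sin and e^{iθ}

module Trigonometry where

  open import Data.Rational.Base hiding (NonZero)
  open import Data.Rational.Properties
  open import Data.Rational.Solver using (module +-*-Solver)
  open import Relation.Binary.PropositionalEquality
  open import Defs
  open Reals
  open Complexes
  open ExpSeries

  open +-*-Solver using (solve; con; _:+_; _:*_; _:-_; :-_; _:=_)

  cosCoeff-suc : ∀ j → cosCoeff (suc j) ≡ - sinCoeff j
  cosCoeff-suc 0             = refl
  cosCoeff-suc 1             = refl
  cosCoeff-suc (suc (suc j)) = cong -_ (cosCoeff-suc j)

  sinCoeff-suc : ∀ j → sinCoeff (suc j) ≡ cosCoeff j
  sinCoeff-suc 0             = refl
  sinCoeff-suc 1             = refl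
  sinCoeff-suc (suc (suc j)) = cong -_ (sinCoeff-suc j)

  -- `cosCoeff k` and `sinCoeff k` are the real and imaginary part of the k-th power of the
  -- imaginary unit; this and `sinCoeff-+` are its law of exponents. Two base cases are required
  -- since the recursion has step two.
  cosCoeff-+ : ∀ i j → cosCoeff i * cosCoeff j + - sinCoeff i * sinCoeff j ≡ cosCoeff (i ℕ.+ j)
  cosCoeff-+ 0 j = solve 2 (λ c s → con 1ℚ :* c :+ con 0ℚ :* s := c) refl (cosCoeff j) (sinCoeff j)
  cosCoeff-+ 1 j = trans (solve 2 (λ c s → con 0ℚ :* c :+ con (- 1ℚ) :* s := :- s) refl (cosCoeff j) (sinCoeff j)) (sym (cosCoeff-suc j))
  cosCoeff-+ (suc (suc i)) j = trans
    (solve 4 (λ a b c d → (:- a) :* b :+ (:- (:- c)) :* d := :- (a :* b :+ (:- c) :* d)) refl (cosCoeff i) (cosCoeff j) (sinCoeff i) (sinCoeff j))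
    (cong -_ (cosCoeff-+ i j))

  sinCoeff-+ : ∀ i j → cosCoeff i * sinCoeff j + sinCoeff i * cosCoeff j ≡ sinCoeff (i ℕ.+ j)
  sinCoeff-+ 0 j = solve 2 (λ c s → con 1ℚ :* s :+ con 0ℚ :* c := s) refl (cosCoeff j) (sinCoeff j)
  sinCoeff-+ 1 j = trans (solve 2 (λ c s → con 0ℚ :* s :+ con 1ℚ :* c := c) refl (cosCoeff j) (sinCoeff j)) (sym (sinCoeff-suc j))
  sinCoeff-+ (suc (suc i)) j = trans
    (solve 4 (λ a b c d → (:- a) :* b :+ (:- c) :* d := :- (a :* b :+ c :* d)) refl (cosCoeff i) (sinCoeff j) (sinCoeff i) (cosCoeff j))
    (cong -_ (sinCoeff-+ i j))

  expSeries-addition : ∀ {x c y s u : ℕ → ℚ} → (∀ i j → x i * c j + y i * s j ≡ u (i ℕ.+ j)) → ∀ q r n →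
    expSeries u (q + r) n ≡
      triangular (λ k → x k * expTerm q k) (λ k → c k * expTerm r k) n + triangular (λ k → y k * expTerm q k) (λ k → s k * expTerm r k) n
  expSeries-addition {x} {c} {y} {s} {u} add q r n = trans (expSeries-psum u (q + r) n)
    (trans (psum-cong (λ k → trans (cong (u k *_) (sym (conv-expTerm q r k))) (sym (conv-addition x c y s u (expTerm q) (expTerm r) add k))) n)
      (psum-+ _ _ n))

  -- For bounded coefficients with u_{i+j} = x_i c_j + y_i s_j, the power series satisfy u(q + r) = x(q) c(r) + y(q) s(r).
  addition-theorem : ∀ {x c y s u : ℕ → ℚ} → (∀ i j → x i * c j + y i * s j ≡ u (i ℕ.+ j)) →
    (∀ k → ∣ x k ∣ ≤ 1ℚ) → (∀ k → ∣ c k ∣ ≤ 1ℚ) → (∀ k → ∣ y k ∣ ≤ 1ℚ) → (∀ k → ∣ s k ∣ ≤ 1ℚ) →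
    ∀ (v w : ℝ) ε → 0ℚ < ε → Eventually λ n → let q = seq v n; r = seq w n in
      ∣ expSeries u (q + r) n - (expSeries x q n * expSeries c r n + expSeries y q n * expSeries s r n) ∣ < ε
  addition-theorem {x} {c} {y} {s} {u} add x≤1 c≤1 y≤1 s≤1 v w ε 0<ε =
    let a , bv = eventually-bounded (cauchy v)
        b , bw = eventually-bounded (cauchy w)
        m      = suc a ℕ.⊔ suc b
    in mapᵉ (λ { n ((v< , w<) , (p₁ , p₂)) →
         let v≤ = ≤-trans (<⇒≤ v<) (fromℕ-mono (ℕ.m≤m⊔n (suc a) (suc b)))
             w≤ = ≤-trans (<⇒≤ w<) (fromℕ-mono (ℕ.m≤n⊔m (suc a) (suc b)))
         in combine n (p₁ v≤ w≤) (p₂ v≤ w≤) })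
       (both (both bv bw) (both (product-triangle x≤1 c≤1 m (0<½ 0<ε)) (product-triangle y≤1 s≤1 m (0<½ 0<ε))))
    where
    open ≤-Reasoning
    combine : ∀ n → let q = seq v n; r = seq w n in
      ∣ expSeries x q n * expSeries c r n - triangular (λ k → x k * expTerm q k) (λ k → c k * expTerm r k) n ∣ < ½ * ε →
      ∣ expSeries y q n * expSeries s r n - triangular (λ k → y k * expTerm q k) (λ k → s k * expTerm r k) n ∣ < ½ * ε →
      ∣ expSeries u (q + r) n - (expSeries x q n * expSeries c r n + expSeries y q n * expSeries s r n) ∣ < ε
    combine n p₁ p₂ = begin-strict
      ∣ expSeries u (q + r) n - (P₁ + P₂) ∣  ≡⟨ cong (λ z → ∣ z - (P₁ + P₂) ∣) (expSeries-addition {x} {c} {y} {s} {u} add q r n) ⟩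
      ∣ (T₁ + T₂) - (P₁ + P₂) ∣  ≡⟨ ∣-∣-sym (T₁ + T₂) (P₁ + P₂) ⟩
      ∣ (P₁ + P₂) - (T₁ + T₂) ∣  ≡⟨ cong ∣_∣ (solve 4 (λ a b c d → (a :+ b) :- (c :+ d) := (a :- c) :+ (b :- d)) refl P₁ P₂ T₁ T₂) ⟩
      ∣ (P₁ - T₁) + (P₂ - T₂) ∣  ≤⟨ ∣p+q∣≤∣p∣+∣q∣ (P₁ - T₁) (P₂ - T₂) ⟩
      ∣ P₁ - T₁ ∣ + ∣ P₂ - T₂ ∣  <⟨ +-mono-< p₁ p₂ ⟩
      ½ * ε + ½ * ε  ≡⟨ ½+½ ε ⟩
      ε  ∎
      where
      q = seq v n
      r = seq w n
      P₁ = expSeries x q n * expSeries c r n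
      P₂ = expSeries y q n * expSeries s r n
      T₁ = triangular (λ k → x k * expTerm q k) (λ k → c k * expTerm r k) n
      T₂ = triangular (λ k → y k * expTerm q k) (λ k → s k * expTerm r k) n

  expSeries-neg : ∀ {c d} → (∀ k → d k ≡ - c k) → ∀ q n → expSeries d q n ≡ - expSeries c q n
  expSeries-neg d≡-c q zero    = refl
  expSeries-neg {c} {d} d≡-c q (suc n) = trans (cong₂ (λ u v → u + v * expTerm q n) (expSeries-neg d≡-c q n) (d≡-c n))
    (solve 3 (λ s a t → (:- s) :+ (:- a) :* t := :- (s :+ a :* t)) refl (expSeries c q n) (c n) (expTerm q n))

  cos-+ : ∀ x y → cos (x +ᴿ y) ≈ᴿ cos x *ᴿ cos y +ᴿ -ᴿ (sin x *ᴿ sin y)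
  cos-+ x y ε 0<ε = mapᵉ (λ n → subst (_< ε) (cong (λ z → ∣ C n - (cos′ n + z) ∣)
      (trans (cong (_* S′ n) (expSeries-neg {sinCoeff} {λ k → - sinCoeff k} (λ _ → refl) (seq x n) n)) (sym (neg-distribˡ-* (S n) (S′ n))))))
    (addition-theorem {cosCoeff} {cosCoeff} {λ k → - sinCoeff k} {sinCoeff} {cosCoeff} cosCoeff-+ ∣cosCoeff∣≤1 ∣cosCoeff∣≤1
      (λ k → ≤-trans (≤-reflexive (∣-p∣≡∣p∣ (sinCoeff k))) (∣sinCoeff∣≤1 k)) ∣sinCoeff∣≤1 x y ε 0<ε)
    where
    C S S′ cos′ : ℕ → ℚ
    C n = expSeries cosCoeff (seq x n + seq y n) n
    S n = expSeries sinCoeff (seq x n) n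
    S′ n = expSeries sinCoeff (seq y n) n
    cos′ n = expSeries cosCoeff (seq x n) n * expSeries cosCoeff (seq y n) n

  sin-+ : ∀ x y → sin (x +ᴿ y) ≈ᴿ cos x *ᴿ sin y +ᴿ sin x *ᴿ cos y
  sin-+ x y = addition-theorem {cosCoeff} {sinCoeff} {sinCoeff} {cosCoeff} {sinCoeff} sinCoeff-+ ∣cosCoeff∣≤1 ∣sinCoeff∣≤1 ∣sinCoeff∣≤1 ∣cosCoeff∣≤1 x y

  expi-+ : ∀ x y → expi (x +ᴿ y) ≈ᶜ expi x *ᶜ expi y
  expi-+ x y = cos-+ x y , sin-+ x y

  expi-cong : ∀ {x y} → (∀ n → seq x n ≡ seq y n) → expi x ≈ᶜ expi y
  expi-cong {x} {y} x≡y = pointwise-≈ᶜ {expi x} {expi y} (λ n → cong (λ q → expSeries cosCoeff q n) (x≡y n)) (λ n → cong (λ q → expSeries sinCoeff q n) (x≡y n))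

  private module ℂᶜ = CommutativeRing ℂ-commutativeRing

  expi-0 : expi 0ᴿ ≈ᶜ fromℝ 1ᴿ
  expi-0 = eventually-const cosCoeff 1ℚ (λ n → cosine n) , eventually-const sinCoeff 0ℚ (λ n → sine n)
    where
    expTerm-0 : ∀ k → expTerm 0ℚ (suc k) ≡ 0ℚ
    expTerm-0 k = solve 2 (λ t r → t :* (con 0ℚ :* r) := con 0ℚ) refl (expTerm 0ℚ k) (1/suc k)
    cosine : ∀ n → expSeries cosCoeff 0ℚ (suc n) ≡ 1ℚ
    cosine zero    = refl
    cosine (suc n) = trans (cong₂ (λ u t → u + cosCoeff (suc n) * t) (cosine n) (expTerm-0 n))
      (solve 1 (λ c → con 1ℚ :+ c :* con 0ℚ := con 1ℚ) refl (cosCoeff (suc n)))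
    sine : ∀ n → expSeries sinCoeff 0ℚ (suc n) ≡ 0ℚ
    sine zero    = refl
    sine (suc n) = trans (cong₂ (λ u t → u + sinCoeff (suc n) * t) (sine n) (expTerm-0 n))
      (solve 1 (λ c → con 0ℚ :+ c :* con 0ℚ := con 0ℚ) refl (sinCoeff (suc n)))
    eventually-const : ∀ c q → (∀ n → expSeries c 0ℚ (suc n) ≡ q) → ∀ ε → 0ℚ < ε → Eventually λ n → ∣ expSeries c 0ℚ n - q ∣ < ε
    -- The index 0 is excluded: the empty partial sum is 0, also for the cosine.
    eventually-const c q eq ε 0<ε = 1 , λ { (suc n) _ → subst (_< ε) (sym (cong ∣_∣ (trans (cong (_- q) (eq n)) (+-inverseʳ q)))) 0<ε }

  expi-neg : ∀ x → expi (-ᴿ x) ≈ᶜ conj (expi x)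
  expi-neg x = pointwise-≈ᶜ {expi (-ᴿ x)} {conj (expi x)} (λ n → even n (seq x n)) (λ n → odd n (seq x n))
    where
    -- The sign (-1)^k picked up by the k-th power. The cosine has only even coefficients, where it
    -- is 1, the sine only odd ones, where it is -1.
    σ : ℕ → ℚ
    σ zero    = 1ℚ
    σ (suc k) = - σ k
    expTerm-neg : ∀ k q → expTerm (- q) k ≡ σ k * expTerm q k
    expTerm-neg zero    q = refl
    expTerm-neg (suc k) q = trans (cong (_* (- q * 1/suc k)) (expTerm-neg k q))
      (solve 4 (λ s t q r → s :* t :* ((:- q) :* r) := (:- s) :* (t :* (q :* r))) refl (σ k) (expTerm q k) q (1/suc k))
    cosCoeff-σ : ∀ k → cosCoeff k * σ k ≡ cosCoeff k
    cosCoeff-σ 0             = refl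
    cosCoeff-σ 1             = refl
    cosCoeff-σ (suc (suc k)) = trans (solve 2 (λ c s → (:- c) :* (:- (:- s)) := :- (c :* s)) refl (cosCoeff k) (σ k)) (cong -_ (cosCoeff-σ k))
    sinCoeff-σ : ∀ k → sinCoeff k * σ k ≡ - sinCoeff k
    sinCoeff-σ 0             = refl
    sinCoeff-σ 1             = refl
    sinCoeff-σ (suc (suc k)) = trans (solve 2 (λ c s → (:- c) :* (:- (:- s)) := :- (c :* s)) refl (sinCoeff k) (σ k)) (cong -_ (sinCoeff-σ k))
    even : ∀ n q → expSeries cosCoeff (- q) n ≡ expSeries cosCoeff q n
    even zero    q = refl
    even (suc n) q = cong₂ _+_ (even n q) (trans (cong (cosCoeff n *_) (expTerm-neg n q))
      (trans (sym (*-assoc (cosCoeff n) (σ n) (expTerm q n))) (cong (_* expTerm q n) (cosCoeff-σ n))))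
    odd : ∀ n q → expSeries sinCoeff (- q) n ≡ - expSeries sinCoeff q n
    odd zero    q = refl
    odd (suc n) q = trans (cong₂ _+_ (odd n q) (trans (cong (sinCoeff n *_) (expTerm-neg n q))
        (trans (sym (*-assoc (sinCoeff n) (σ n) (expTerm q n))) (cong (_* expTerm q n) (sinCoeff-σ n)))))
      (solve 3 (λ e s t → (:- e) :+ (:- s) :* t := :- (e :+ s :* t)) refl (expSeries sinCoeff q n) (sinCoeff n) (expTerm q n))

  -- cos² + sin² = 1 is the addition theorem at x and -x.
  expi-unit : ∀ x → expi x *ᶜ conj (expi x) ≈ᶜ fromℝ 1ᴿ
  expi-unit x = begin
    expi x *ᶜ conj (expi x)  ≈⟨ ℂᶜ.*-congˡ {expi x} {expi (-ᴿ x)} {conj (expi x)} (expi-neg x) ⟨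
    expi x *ᶜ expi (-ᴿ x)  ≈⟨ expi-+ x (-ᴿ x) ⟨
    expi (x +ᴿ -ᴿ x)  ≈⟨ expi-cong {x +ᴿ -ᴿ x} {0ᴿ} (λ n → +-inverseʳ (seq x n)) ⟩
    expi 0ᴿ  ≈⟨ expi-0 ⟩
    fromℝ 1ᴿ  ∎
    where open import Relation.Binary.Reasoning.Setoid ℂᶜ.setoid

-- Characters from roots of unity

module RootsOfUnity {R : OrderedRing} (C : ComplexExtension R) where

  open import Data.Nat.DivMod using (m≡m%n+[m/n]*n; m<n⇒m%n≡m; _/_; _%_)
  open import Defs using (ℤmod; _⊕_)

  private module R where
    open OrderedRing R public
    open OrderedRingProperties R public
  open ComplexExtension C
  open ComplexProperties C
  open import Algebra.Properties.Semiring.Exp semiring public using (_^_)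
  open import Algebra.Properties.Semiring.Exp semiring using (^-homo-*)
  open import Algebra.Properties.Ring ring using (-1*x≈-x)
  open import Relation.Binary.Reasoning.Setoid setoid

  -- Powers are determined by their recursion; this identifies the values of `expi` at multiples of
  -- an angle as powers.
  ^-unique : ∀ ω (z : ℕ → Carrier) → z 0 ≈ 1# → (∀ k → z (suc k) ≈ ω * z k) → ∀ k → ω ^ k ≈ z k
  ^-unique ω z z₀ zₛ zero    = sym z₀
  ^-unique ω z z₀ zₛ (suc k) = trans (*-congˡ (^-unique ω z z₀ zₛ k)) (sym (zₛ k))

  ^-unit : ∀ {ω} → ω * conj ω ≈ 1# → ∀ k → ω ^ k * conj (ω ^ k) ≈ 1#
  ^-unit unit zero    = trans (*-congˡ conj-1) (*-identityˡ 1#)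
  ^-unit {ω} unit (suc k) = begin
    ω * ω ^ k * conj (ω * ω ^ k)  ≈⟨ *-congˡ (conj-* ω (ω ^ k)) ⟩
    ω * ω ^ k * (conj ω * conj (ω ^ k))  ≈⟨ solve 4 (λ a b c d → a :* b :* (c :* d) := a :* c :* (b :* d)) refl ω (ω ^ k) (conj ω) (conj (ω ^ k)) ⟩
    ω * conj ω * (ω ^ k * conj (ω ^ k))  ≈⟨ *-cong unit (^-unit unit k) ⟩
    1# * 1#  ≈⟨ *-identityˡ 1# ⟩
    1#  ∎
    where
    open IntegerSolver commutativeRing

  module _ (p : ℕ) .{{_ : NonZero p}} (1<p : 1 ℕ.< p) {ω : Carrier} (ω^p≈1 : ω ^ p ≈ 1#) where

    open ModArith p
    open SpaceSum p commutativeRing using (sum; sum-cong; sum-translate; *-distribʳ-sum)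

    ^-% : ∀ m → ω ^ (m % p) ≈ ω ^ m
    ^-% m = begin
      ω ^ (m % p)  ≈⟨ *-identityʳ _ ⟨
      ω ^ (m % p) * 1#  ≈⟨ *-congˡ (period (m / p)) ⟨
      ω ^ (m % p) * ω ^ (m / p ℕ.* p)  ≈⟨ ^-homo-* ω (m % p) (m / p ℕ.* p) ⟨
      ω ^ (m % p ℕ.+ m / p ℕ.* p)  ≡⟨ ≡.cong (ω ^_) (m≡m%n+[m/n]*n m p) ⟨
      ω ^ m  ∎
      where
      period : ∀ k → ω ^ (k ℕ.* p) ≈ 1#
      period zero    = refl
      period (suc k) = trans (^-homo-* ω p (k ℕ.* p)) (trans (*-cong ω^p≈1 (period k)) (*-identityˡ 1#))

    e : ℤmod p → Carrier
    e a = ω ^ toℕ a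

    e-⊕ : ∀ a b → e (a ⊕ b) ≈ e a * e b
    e-⊕ a b = begin
      ω ^ toℕ (a ⊕ b)  ≡⟨ ≡.cong (ω ^_) (toℕ-mod (toℕ a ℕ.+ toℕ b)) ⟩
      ω ^ ((toℕ a ℕ.+ toℕ b) % p)  ≈⟨ ^-% (toℕ a ℕ.+ toℕ b) ⟩
      ω ^ (toℕ a ℕ.+ toℕ b)  ≈⟨ ^-homo-* ω (toℕ a) (toℕ b) ⟩
      e a * e b  ∎

    e-1 : e 1ₚ ≈ ω
    e-1 = trans (reflexive (≡.cong (ω ^_) (≡.trans (toℕ-mod 1) (m<n⇒m%n≡m 1<p)))) (*-identityʳ ω)

    -- Translation by 1 gives S = S ω for S = Σ e.
    e-sum : ¬ (ω ≈ 1#) → sum e ≈ 0#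
    e-sum ω≉1 = ∣z∣≈0⇒z≈0 (R.≤-antisym (R.*-cancelˡ-≤ w>0 (R.≤-reflexive
        (R.trans (R.trans (R.sym (∣*∣ w S)) (R.trans (∣∣-cong wS≈0) ∣0∣)) (R.sym (R.zeroʳ ∣ w ∣))))) (0≤∣∣ S))
      where
      S w : Carrier
      S = sum e
      w = ω - 1#
      w>0 : ¬ (∣ w ∣ R.≤ R.0#)
      w>0 ∣w∣≤0 = ω≉1 (begin
        ω  ≈⟨ solve 2 (λ x o → x := (x :- o) :+ o) refl ω 1# ⟩
        w + 1#  ≈⟨ +-congʳ (∣z∣≈0⇒z≈0 (R.≤-antisym ∣w∣≤0 (0≤∣∣ w))) ⟩
        0# + 1#  ≈⟨ +-identityˡ 1# ⟩
        1#  ∎)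
        where
        open IntegerSolver commutativeRing
      S≈Sω : S ≈ S * ω
      S≈Sω = begin
        sum e  ≈⟨ sum-translate 1ₚ e ⟨
        sum (λ a → e (a ⊕ 1ₚ))  ≈⟨ sum-cong {p} (λ a → trans (e-⊕ a 1ₚ) (*-congˡ e-1)) ⟩
        sum (λ a → e a * ω)  ≈⟨ *-distribʳ-sum ω e ⟨
        S * ω  ∎
      wS≈0 : w * S ≈ 0#
      wS≈0 = begin
        w * S  ≈⟨ distribʳ S ω (- 1#) ⟩
        ω * S + - 1# * S  ≈⟨ +-cong (trans (*-comm ω S) (sym S≈Sω)) (-1*x≈-x S) ⟩
        S - S  ≈⟨ -‿inverseʳ S ⟩
        0#  ∎

-- The character defined by π

module RootCharacter where

  open import Data.Integer.Base as ℤ using (+_)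
  import Data.Integer.Properties as ℤ
  open import Data.Rational.Base hiding (NonZero)
  open import Data.Rational.Properties
  import Data.Rational.Unnormalised.Base as ℚᵘ
  import Data.Rational.Unnormalised.Properties as ℚᵘ
  open import Data.Rational.Solver using (module +-*-Solver)
  open import Relation.Binary.PropositionalEquality
  open import Defs
  open Reals
  open Complexes
  open Trigonometry

  open +-*-Solver using (solve; con; _:+_; _:*_; _:-_; :-_; _:=_)

  -- `_/_` reduces to lowest terms, so the identity is checked among unnormalised fractions, where
  -- reduction is invisible.
  n*[m/n]≡m : ∀ m n .{{_ : NonZero n}} → fromℕ n * (+ m / n) ≡ fromℕ m
  n*[m/n]≡m m (suc k) = toℚᵘ-injective (begin
    toℚᵘ (fromℕ (suc k) * (+ m / suc k))  ≈⟨ toℚᵘ-homo-* (fromℕ (suc k)) (+ m / suc k) ⟩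
    toℚᵘ (fromℕ (suc k)) ℚᵘ.* toℚᵘ (+ m / suc k)  ≈⟨ ℚᵘ.*-congˡ {toℚᵘ (fromℕ (suc k))} (toℚᵘ-fromℚᵘ (ℚᵘ.mkℚᵘ (+ m) k)) ⟩
    ℚᵘ.mkℚᵘ (+ suc k) 0 ℚᵘ.* ℚᵘ.mkℚᵘ (+ m) k  ≈⟨ ℚᵘ.*≡* (trans (ℤ.*-identityʳ _) (trans (ℤ.*-comm (+ suc k) (+ m)) (cong (λ z → + m ℤ.* + z) (sym (ℕ.+-identityʳ (suc k)))))) ⟩
    toℚᵘ (fromℕ m)  ∎)
    where open import Relation.Binary.Reasoning.Setoid ℚᵘ.≃-setoid

  *-cancelˡ-≡ : ∀ {r p q} → 0ℚ < r → r * p ≡ r * q → p ≡ q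
  *-cancelˡ-≡ {r} 0<r eq = ≤-antisym (*-cancelˡ-≤-pos r (≤-reflexive eq)) (*-cancelˡ-≤-pos r (≤-reflexive (sym eq)))
    where instance _ = positive 0<r

  0<fromℕ : ∀ n .{{_ : NonZero n}} → 0ℚ < fromℕ n
  0<fromℕ (suc n) = 0<fromℕsuc n

  0<m/n : ∀ m n .{{_ : NonZero m}} .{{_ : NonZero n}} → 0ℚ < + m / n
  0<m/n m n = *-cancelˡ-<-nonNeg (fromℕ n) {{nonNegative (0≤fromℕ n)}}
    (subst₂ _<_ (sym (*-zeroʳ (fromℕ n))) (sym (n*[m/n]≡m m n)) (0<fromℕ m))

  fromℕ-strict : ∀ {m n} → m ℕ.< n → fromℕ m < fromℕ n
  fromℕ-strict {m} m<n = <-≤-trans (subst (fromℕ m <_) (trans (+-comm (fromℕ m) 1ℚ) (sym (fromℕ-+ 1 m))) (p<q+ε ≤-refl (positive⁻¹ 1ℚ))) (fromℕ-mono m<n)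

  m/n<1 : ∀ {m n} .{{_ : NonZero n}} → m ℕ.< n → + m / n < 1ℚ
  m/n<1 {m} {n} m<n = *-cancelˡ-<-nonNeg (fromℕ n) {{nonNegative (0≤fromℕ n)}}
    (subst₂ _<_ (sym (n*[m/n]≡m m n)) (sym (*-identityʳ (fromℕ n))) (fromℕ-strict m<n))

  private
    module ℝᶜ = CommutativeRing ℝ-commutativeRing
    module ℂᶜ = CommutativeRing ℂ-commutativeRing
    module ℝᵒ = OrderedRingProperties ℝ-orderedRing

  open RootsOfUnity ℂ-extension

  module _ (π : ℝ) (isPi : IsPi π) where

    open IsPi isPi

    -- sin π = 0 makes e^{iπ} equal to its conjugate, so its square is its squared modulus, which is
    -- 1. The value of cos π is never computed.
    expi-2π : expi (π +ᴿ π) ≈ᶜ fromℝ 1ᴿ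
    expi-2π = ℂᶜ.trans {expi (π +ᴿ π)} {expi π *ᶜ expi π} {fromℝ 1ᴿ} (expi-+ π π)
      (ℂᶜ.trans {expi π *ᶜ expi π} {expi π *ᶜ conj (expi π)} {fromℝ 1ᴿ}
        (ℂᶜ.*-congˡ {expi π} {expi π} {conj (expi π)} real) (expi-unit π))
      where
      real : expi π ≈ᶜ conj (expi π)
      real = ℝᶜ.refl {cos π} , ℝᶜ.trans {sin π} {0ᴿ} { -ᴿ sin π} sin-π
        (ℝᶜ.trans {0ᴿ} { -ᴿ 0ᴿ} { -ᴿ sin π} (pointwise-≈ {0ᴿ} { -ᴿ 0ᴿ} λ _ → refl) (ℝᶜ.-‿cong {0ᴿ} {sin π} (ℝᶜ.sym {sin π} {0ᴿ} sin-π)))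

    -- θ stands for tπ, up to pointwise equality only: comparing concrete reals by conversion unfolds their Cauchy proofs.
    module _ {p : ℕ} {t : ℚ} (0<t : 0ℚ < t) (t<1 : t < 1ℚ) (pt≡2 : fromℕ p * t ≡ fromℕ 2)
             (θ : ℝ) (θ≡tπ : ∀ n → seq θ n ≡ t * seq π n) where

      multiple : ℕ → ℝ
      multiple k = fromℚ (fromℕ k) *ᴿ θ

      -- 0 < t < 1 places tπ strictly between 0 and π, the least positive zero of the sine. For t =
      -- 2/p the bound t < 1 is the hypothesis 2 < p.
      sin-tπ≉0 : ¬ (sin θ ≈ᴿ 0ᴿ)
      sin-tπ≉0 = least θ
        (let ε , 0<ε , π>ε = positive-π in
          t * ε , 0<-* 0<t 0<ε , mapᵉ (λ n ε< → subst₂ _<_ (sym (+-identityˡ (t * ε))) (sym (θ≡tπ n))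
            (*-monoʳ-<-pos t {{positive 0<t}} (subst (_< seq π n) (+-identityˡ ε) ε<))) π>ε)
        (let ε , 0<ε , π>ε = positive-π in
          -- As tπ + (1 - t)π = π, a lower bound ε for π leaves the margin (1 - t)ε between tπ and
          -- π.
          c * ε , 0<-* 0<c 0<ε , mapᵉ (λ n ε< → subst₂ (λ u v → u + c * ε < v) (sym (θ≡tπ n))
            (solve 2 (λ t x → t :* x :+ (con 1ℚ :- t) :* x := x) refl t (seq π n))
            (+-monoʳ-< (t * seq π n) (*-monoʳ-<-pos c {{positive 0<c}} (subst (_< seq π n) (+-identityˡ ε) ε<)))) π>ε)
        where
        c : ℚ
        c = 1ℚ - t
        0<c : 0ℚ < c
        0<c = subst (_< c) (+-inverseʳ t) (+-monoˡ-< (- t) t<1)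

      expi-multiple-zero : expi (multiple 0) ≈ᶜ fromℝ 1ᴿ
      expi-multiple-zero = ℂᶜ.trans {expi (multiple 0)} {expi 0ᴿ} {fromℝ 1ᴿ}
        (expi-cong {multiple 0} {0ᴿ} (λ n → *-zeroˡ (seq θ n))) expi-0

      expi-multiple-suc : ∀ k → expi (multiple (suc k)) ≈ᶜ expi θ *ᶜ expi (multiple k)
      expi-multiple-suc k = ℂᶜ.trans {expi (multiple (suc k))} {expi (θ +ᴿ multiple k)} {expi θ *ᶜ expi (multiple k)}
        (expi-cong {multiple (suc k)} {θ +ᴿ multiple k} λ n → trans (cong (_* seq θ n) (fromℕ-+ 1 k))
          (solve 2 (λ t k → (con 1ℚ :+ k) :* t := t :+ k :* t) refl (seq θ n) (fromℕ k)))
        (expi-+ θ (multiple k))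

      expi-multiple-p : expi (multiple p) ≈ᶜ fromℝ 1ᴿ
      expi-multiple-p = ℂᶜ.trans {expi (multiple p)} {expi (π +ᴿ π)} {fromℝ 1ᴿ}
        (expi-cong {multiple p} {π +ᴿ π} λ n → trans (cong (fromℕ p *_) (θ≡tπ n)) (trans (sym (*-assoc (fromℕ p) t (seq π n)))
          (trans (cong (_* seq π n) pt≡2) (solve 1 (λ x → (con 1ℚ :+ con 1ℚ) :* x := x :+ x) refl (seq π n)))))
        expi-2π

      expi-tπ^p : expi θ ^ p ≈ᶜ fromℝ 1ᴿ
      expi-tπ^p = ℂᶜ.trans {expi θ ^ p} {expi (multiple p)} {fromℝ 1ᴿ}
        (^-unique (expi θ) (λ k → expi (multiple k)) expi-multiple-zero expi-multiple-suc p) expi-multiple-p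

      expi-tπ≉1 : ¬ (expi θ ≈ᶜ fromℝ 1ᴿ)
      expi-tπ≉1 (_ , sin≈0) = sin-tπ≉0 sin≈0

    module _ (p : ℕ) .{{nz : NonZero p}} (2<p : 2 ℕ.< p) where

      private
        1<p : 1 ℕ.< p
        1<p = ℕ.<-trans (ℕ.s≤s (ℕ.s≤s ℕ.z≤n)) 2<p

      ω : ℂ
      ω = Fourier.ω π p {{nz}}

      ω^p≈1 : ω ^ p ≈ᶜ fromℝ 1ᴿ
      ω^p≈1 = expi-tπ^p {p} {_/_ (+ 2) p {{nz}}} (0<m/n 2 p {{_}} {{nz}}) (m/n<1 {2} {p} {{nz}} 2<p) (n*[m/n]≡m 2 p {{nz}})
        (fromℚ (_/_ (+ 2) p {{nz}}) *ᴿ π) (λ _ → refl)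

      ω≉1 : ¬ (ω ≈ᶜ fromℝ 1ᴿ)
      ω≉1 = expi-tπ≉1 {p} {_/_ (+ 2) p {{nz}}} (0<m/n 2 p {{_}} {{nz}}) (m/n<1 {2} {p} {{nz}} 2<p) (n*[m/n]≡m 2 p {{nz}})
        (fromℚ (_/_ (+ 2) p {{nz}}) *ᴿ π) (λ _ → refl)

      ω-unit : ω *ᶜ conj ω ≈ᶜ fromℝ 1ᴿ
      ω-unit = expi-unit (fromℚ (_/_ (+ 2) p {{nz}}) *ᴿ π)

      open SpaceSum p ℂ-commutativeRing using (sum)

      1/p^ : ℕ → ℝ
      1/p^ n = fromℚ (_/_ (+ 1) (p ℕ.^ n) {{ℕ.m^n≢0 p n {{nz}}}})

      1/p^-suc : ∀ n → 1/p^ (suc n) ≈ᴿ fromℚ (_/_ (+ 1) p {{nz}}) *ᴿ 1/p^ n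
      1/p^-suc n = pointwise-≈ {1/p^ (suc n)} {fromℚ (_/_ (+ 1) p {{nz}}) *ᴿ 1/p^ n} λ _ →
        *-cancelˡ-≡ (0<fromℕ (p ℕ.* p ℕ.^ n)) (trans (n*[m/n]≡m 1 (p ℕ.* p ℕ.^ n)) (sym (begin
          fromℕ (p ℕ.* p ℕ.^ n) * (+ 1 / p * (+ 1 / (p ℕ.^ n)))  ≡⟨ cong (_* (+ 1 / p * (+ 1 / (p ℕ.^ n)))) (fromℕ-* p (p ℕ.^ n)) ⟩
          fromℕ p * fromℕ (p ℕ.^ n) * (+ 1 / p * (+ 1 / (p ℕ.^ n)))  ≡⟨ solve 4 (λ a b c d → a :* b :* (c :* d) := (a :* c) :* (b :* d)) refl (fromℕ p) (fromℕ (p ℕ.^ n)) (+ 1 / p) (+ 1 / (p ℕ.^ n)) ⟩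
          (fromℕ p * (+ 1 / p)) * (fromℕ (p ℕ.^ n) * (+ 1 / (p ℕ.^ n)))  ≡⟨ cong₂ _*_ (n*[m/n]≡m 1 p) (n*[m/n]≡m 1 (p ℕ.^ n)) ⟩
          1ℚ  ∎)))
        where
        open ≡-Reasoning
        instance
          p^n≢0 : NonZero (p ℕ.^ n)
          p^n≢0 = ℕ.m^n≢0 p n
          p*p^n≢0 : NonZero (p ℕ.* p ℕ.^ n)
          p*p^n≢0 = ℕ.m^n≢0 p (suc n)

      sum-1 : ∀ n → sum {n} (λ _ → fromℝ 1ᴿ) ≈ᶜ fromℝ (fromℚ (fromℕ n))
      sum-1 zero    = ℂᶜ.refl {fromℝ 0ᴿ}
      sum-1 (suc n) = ℂᶜ.trans {fromℝ 1ᴿ +ᶜ sum {n} (λ _ → fromℝ 1ᴿ)} {fromℝ 1ᴿ +ᶜ fromℝ (fromℚ (fromℕ n))} {fromℝ (fromℚ (fromℕ (suc n)))}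
        (ℂᶜ.+-congˡ {fromℝ 1ᴿ} {sum {n} (λ _ → fromℝ 1ᴿ)} {fromℝ (fromℚ (fromℕ n))} (sum-1 n))
        (pointwise-≈ᶜ {fromℝ 1ᴿ +ᶜ fromℝ (fromℚ (fromℕ n))} {fromℝ (fromℚ (fromℕ (suc n)))} (λ _ → sym (fromℕ-+ 1 n)) (λ _ → refl))

      character : AdditiveCharacter ℂ-extension p {{nz}}
      character = record
        { e        = e p {{nz}} 1<p {ω} ω^p≈1
        ; e-⊕      = e-⊕ p {{nz}} 1<p {ω} ω^p≈1
        ; e-unit   = λ a → ^-unit {ω} ω-unit (toℕ a)
        ; e-sum    = e-sum p {{nz}} 1<p {ω} ω^p≈1 ω≉1
        ; p⁻¹      = fromℚ (_/_ (+ 1) p {{nz}})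
        ; p⁻¹*p    = ℂᶜ.trans {fromℝ 1/p *ᶜ sum {p} (λ _ → fromℝ 1ᴿ)} {fromℝ 1/p *ᶜ fromℝ (fromℚ (fromℕ p))} {fromℝ 1ᴿ}
                       (ℂᶜ.*-congˡ {fromℝ 1/p} {sum {p} (λ _ → fromℝ 1ᴿ)} {fromℝ (fromℚ (fromℕ p))} (sum-1 p))
                       (pointwise-≈ᶜ {fromℝ 1/p *ᶜ fromℝ (fromℚ (fromℕ p))} {fromℝ 1ᴿ}
                         (λ _ → trans (solve 2 (λ a b → a :* b :- con 0ℚ :* con 0ℚ := b :* a) refl (_/_ (+ 1) p {{nz}}) (fromℕ p)) (n*[m/n]≡m 1 p {{nz}}))
                         (λ _ → solve 2 (λ a b → a :* con 0ℚ :+ con 0ℚ :* b := con 0ℚ) refl (_/_ (+ 1) p {{nz}}) (fromℕ p)))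
        ; 0≤p⁻¹    = pointwise-≤ {0ᴿ} {fromℚ (_/_ (+ 1) p {{nz}})} λ _ → <⇒≤ (0<m/n 1 p {{_}} {{nz}})
        ; vol      = 1/p^
        ; vol-zero = pointwise-≈ {1/p^ 0} {1ᴿ} λ _ → refl
        ; vol-suc  = 1/p^-suc
        }
        where 1/p = fromℚ (_/_ (+ 1) p {{nz}})

      ^ᶜ≈^ : ∀ z k → z ^ᶜ k ≈ᶜ z ^ k
      ^ᶜ≈^ z k = ℂᶜ.refl {z ^ k}

      χ≈e : ∀ {n} (α x : Space p n) → Fourier.χ π p {{nz}} α x ≈ᶜ AdditiveCharacter.e character (⟨_,_⟩ {p} {{nz}} α x)
      χ≈e α x = ^ᶜ≈^ ω (toℕ (⟨_,_⟩ {p} {{nz}} α x))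

-- The constant 4 for the concrete spectral norm

open import Defs
open import Data.Nat using (_<_; _≤_)
open import Algebra.Bundles using (CommutativeRing; RawSemiring)
open import Data.Integer.Base using (+_)
open import Data.Rational.Base using (_/_)
import Data.Rational.Base as ℚ
import Data.Rational.Properties as ℚ
open import Data.Rational.Solver using (module +-*-Solver)
open Reals
open Complexes
open RootCharacter
open CodimensionBound
open ConstantFlats
open Descent ℝ-orderedRing using (quadruple)
open import Algebra.Definitions.RawMonoid (CommutativeRing.+-rawMonoid ℝ-commutativeRing) using () renaming (_×_ to _ℕ×_)

private module ℂᶜ = CommutativeRing ℂ-commutativeRing

fromSign-real : ∀ s → conj (fromSign s) ≈ᶜ fromSign s
fromSign-real Sign.+ = pointwise-≈ᶜ {conj (fromSign Sign.+)} {fromSign Sign.+} (λ _ → ≡.refl) (λ _ → ≡.refl)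
fromSign-real Sign.- = pointwise-≈ᶜ {conj (fromSign Sign.-)} {fromSign Sign.-} (λ _ → ≡.refl) (λ _ → ≡.refl)

fromSign-square : ∀ s → fromSign s *ᶜ fromSign s ≈ᶜ fromℝ 1ᴿ
fromSign-square Sign.+ = pointwise-≈ᶜ {fromSign Sign.+ *ᶜ fromSign Sign.+} {fromℝ 1ᴿ} (λ _ → ≡.refl) (λ _ → ≡.refl)
fromSign-square Sign.- = pointwise-≈ᶜ {fromSign Sign.- *ᶜ fromSign Sign.-} {fromℝ 1ᴿ} (λ _ → ≡.refl) (λ _ → ≡.refl)

1≉-1 : ¬ (1ᴿ ≈ᴿ -ᴿ 1ᴿ)
1≉-1 1≈-1 = never (1≈-1 ℚ.1ℚ (ℚ.positive⁻¹ ℚ.1ℚ)) λ _ 2<1 → ℚ.<-asym 2<1 (p<q+ε ℚ.≤-refl (ℚ.positive⁻¹ ℚ.1ℚ))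

fromSign-injective : ∀ {s t} → fromSign s ≈ᶜ fromSign t → s ≡ t
fromSign-injective {Sign.+} {Sign.+} _ = ≡.refl
fromSign-injective {Sign.-} {Sign.-} _ = ≡.refl
fromSign-injective {Sign.+} {Sign.-} (1≈-1 , _) = ⊥-elim (1≉-1 1≈-1)
fromSign-injective {Sign.-} {Sign.+} (-1≈1 , _) = ⊥-elim (1≉-1 (≈-symᴿ { -ᴿ 1ᴿ} {1ᴿ} -1≈1))

ℕ×1≈fromℕ : ∀ k → fromℚ (fromℕ k) ≈ᴿ k ℕ× 1ᴿ
ℕ×1≈fromℕ zero    = ≈-reflᴿ {0ᴿ}
ℕ×1≈fromℕ (suc k) = ≈-transᴿ {fromℚ (fromℕ (suc k))} {1ᴿ +ᴿ fromℚ (fromℕ k)} {1ᴿ +ᴿ k ℕ× 1ᴿ}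
  (pointwise-≈ {fromℚ (fromℕ (suc k))} {1ᴿ +ᴿ fromℚ (fromℕ k)} λ _ → fromℕ-+ 1 k)
  (+-congᴿ {1ᴿ} {1ᴿ} {fromℚ (fromℕ k)} {k ℕ× 1ᴿ} (≈-reflᴿ {1ᴿ}) (ℕ×1≈fromℕ k))

quadruple-cong : ∀ {x y} → x ≈ᴿ y → quadruple (x *ᴿ x) ≈ᴿ fromℚ (fromℕ 4) *ᴿ (y *ᴿ y)
quadruple-cong {x} {y} x≈y = ≈-transᴿ {quadruple (x *ᴿ x)} {fromℚ (fromℕ 4) *ᴿ (x *ᴿ x)} {fromℚ (fromℕ 4) *ᴿ (y *ᴿ y)}
  (pointwise-≈ {quadruple (x *ᴿ x)} {fromℚ (fromℕ 4) *ᴿ (x *ᴿ x)} λ n →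
    solve 1 (λ a → (a :* a :+ a :* a) :+ (a :* a :+ a :* a) := con (fromℕ 4) :* (a :* a)) ≡.refl (seq x n))
  (*-congᴿ {fromℚ (fromℕ 4)} {fromℚ (fromℕ 4)} {x *ᴿ x} {y *ᴿ y} (≈-reflᴿ {fromℚ (fromℕ 4)}) (*-congᴿ {x} {y} {x} {y} x≈y x≈y))
  where open +-*-Solver using (solve; con; _:+_; _:*_; _:=_)

-- The quantifier over `A` matches the theorem, in which A is any real equal to the norm up to
-- `_≈ᴿ_`.
AtMost4× : ℕ → ℝ → Set
AtMost4× k N = ∀ A → N ≈ᴿ A → fromℚ (fromℕ k) ≤ᴿ fromℚ (fromℕ 4) *ᴿ (A *ᴿ A)

atMost4× : ∀ k N → k ℕ× 1ᴿ ≤ᴿ quadruple (N *ᴿ N) → AtMost4× k N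
atMost4× k N bound A N≈A = ≤-transᴿ {fromℚ (fromℕ k)} {k ℕ× 1ᴿ} {fromℚ (fromℕ 4) *ᴿ (A *ᴿ A)}
  (≈⇒≤ {fromℚ (fromℕ k)} {k ℕ× 1ᴿ} (ℕ×1≈fromℕ k))
  (≤-transᴿ {k ℕ× 1ᴿ} {quadruple (N *ᴿ N)} {fromℚ (fromℕ 4) *ᴿ (A *ᴿ A)} bound
    (≈⇒≤ {quadruple (N *ᴿ N)} {fromℚ (fromℕ 4) *ᴿ (A *ᴿ A)} (quadruple-cong {N} {A} N≈A)))

fromℕ-mono-≤ᴿ : ∀ {m k y} → m ≤ k → fromℚ (fromℕ k) ≤ᴿ y → fromℚ (fromℕ m) ≤ᴿ y
fromℕ-mono-≤ᴿ {m} {k} {y} m≤k = ≤-transᴿ {fromℚ (fromℕ m)} {fromℚ (fromℕ k)} {y}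
  (pointwise-≤ {fromℚ (fromℕ m)} {fromℚ (fromℕ k)} λ _ → fromℕ-mono m≤k)

module _ (π : ℝ) (isPi : IsPi π) (p : ℕ) .{{nz : NonZero p}} (prime : Prime p) (2<p : 2 < p) where

  𝔼-unfold : ∀ {n} (G : Space p n → ℂ) →
    Fourier.𝔼 π p {{nz}} G ≈ᶜ fromℝ (fromℚ (_/_ (+ 1) (p ℕ.^ n) {{ℕ.m^n≢0 p n {{nz}}}})) *ᶜ sumOver (RawSemiring.+-rawMonoid ℂ-rawSemiring) p n G
  𝔼-unfold G = ℂᶜ.refl {Fourier.𝔼 π p {{nz}} G}

  fourier-unfold : ∀ {n} (g : Space p n → ℂ) α → Fourier.fourier π p {{nz}} g α ≈ᶜ Fourier.𝔼 π p {{nz}} (λ x → g x *ᶜ conj (Fourier.χ π p {{nz}} α x))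
  fourier-unfold g α = ℂᶜ.refl {Fourier.fourier π p {{nz}} g α}

  spectralNorm-unfold : ∀ {n} (g : Space p n → ℂ) →
    Fourier.spectralNorm π p {{nz}} g ≈ᴿ sumOver (RawSemiring.+-rawMonoid ℝ-rawSemiring) p n (λ α → modulus (Fourier.fourier π p {{nz}} g α))
  spectralNorm-unfold g = ≈-reflᴿ {Fourier.spectralNorm π p {{nz}} g}

  flat-of-small-codimension : ∀ n (f : Space p n → Sign) (g : Space p n → ℂ) → (∀ x → g x ≡ fromSign (f x)) →
    ¬ ¬ (∃[ d ] ∃[ k ] d ℕ.+ k ≡ n × HasConstantFlat p {{nz}} f d × AtMost4× k (Fourier.spectralNorm π p {{nz}} g))
  flat-of-small-codimension n f g g≡ =
    codimension-bounded {R = ℝ-orderedRing} {C = ℂ-extension} {p = p} {{nz}} prime 2<p (character π isPi p {{nz}} 2<p)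
      _*ᶜ_ (λ z w → ℂᶜ.refl {z *ᶜ w})
      conj (λ z → ℂᶜ.refl {conj z})
      modulus (λ z → ≈-reflᴿ {modulus z})
      (λ n → fromℝ (fromℚ (_/_ (+ 1) (p ℕ.^ n) {{ℕ.m^n≢0 p n {{nz}}}}))) (λ n → ℂᶜ.refl {fromℝ (fromℚ (_/_ (+ 1) (p ℕ.^ n) {{ℕ.m^n≢0 p n {{nz}}}}))})
      (λ {n} → sumOver (RawSemiring.+-rawMonoid ℂ-rawSemiring) p n) (λ {n} G → ℂᶜ.refl {sumOver (RawSemiring.+-rawMonoid ℂ-rawSemiring) p n G})
      (λ {n} → sumOver (RawSemiring.+-rawMonoid ℝ-rawSemiring) p n) (λ {n} G → ≈-reflᴿ {sumOver (RawSemiring.+-rawMonoid ℝ-rawSemiring) p n G})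
      (λ {n} → Fourier.χ π p {{nz}} {n}) (χ≈e π isPi p {{nz}} 2<p)
      (λ {n} → Fourier.𝔼 π p {{nz}} {n}) 𝔼-unfold
      (λ {n} → Fourier.fourier π p {{nz}} {n}) fourier-unfold
      (λ {n} → Fourier.spectralNorm π p {{nz}} {n}) spectralNorm-unfold
      fromSign fromSign-real fromSign-square fromSign-injective AtMost4× atMost4× n f g g≡

  -- A flat of codimension k ≤ 4A² exists only up to double negation, but its dimension d′ is at
  -- most the maximal d, so n - d ≤ k. The resulting inequality between reals is stable, which
  -- removes the double negation.
  codimension≤4A² : ∀ n (f : Space p n → Sign) (g : Space p n → ℂ) → (∀ x → g x ≡ fromSign (f x)) →
    ∀ (A : ℝ) → Fourier.spectralNorm π p {{nz}} g ≈ᴿ A →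
    ∀ d → (∀ d′ → d′ ≤ n → HasConstantFlat p {{nz}} f d′ → d′ ≤ d) → fromℚ (fromℕ (n ℕ.∸ d)) ≤ᴿ fromℚ (fromℕ 4) *ᴿ (A *ᴿ A)
  codimension≤4A² n f g g≡ A norm≈A d max = ≤-stableᴿ {fromℚ (fromℕ (n ℕ.∸ d))} {fromℚ (fromℕ 4) *ᴿ (A *ᴿ A)} λ ≰ →
    flat-of-small-codimension n f g g≡ λ { (d′ , k , d′+k≡n , flat , bound) → ≰ (fromℕ-mono-≤ᴿ {n ℕ.∸ d} {k} {fromℚ (fromℕ 4) *ᴿ (A *ᴿ A)}
      (ℕ.m≤n+o⇒m∸n≤o n d (ℕ.≤-trans (ℕ.≤-reflexive (≡.sym d′+k≡n))
        (ℕ.+-monoˡ-≤ k (max d′ (ℕ.m+n≤o⇒m≤o d′ (ℕ.≤-reflexive d′+k≡n)) flat)))) (bound A norm≈A)) }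

-- Stated separately because _∘_ is inlined in terms but not in types, and the two forms must not meet below a real.
∘-inline : ∀ {p n} (f : Space p n → Sign) → _≡_ {A = Space p n → ℂ} (fromSign ∘ f) (λ x → fromSign (f x))
∘-inline f = ≡.refl

theorem4p7 : ∃[ K ] 0ᴿ <ᴿ K ×
    (∀ (π : ℝ) → IsPi π →
    ∀ (p : ℕ) .{{_ : NonZero p}} → Prime p → 2 < p →
    ∀ (n : ℕ) → 1 ≤ n →
    ∀ (f : Space p n → Sign) (A : ℝ) → Fourier.spectralNorm π p (fromSign ∘ f) ≈ᴿ A →
    ∃[ V ] ∃[ k ] HasCodimension V k ×
    fromℚ (fromℕ k) ≤ᴿ K *ᴿ (A *ᴿ A) ×
    IsConstantOn f V)
-- 4 is the constant of `descent`; the gap 1 witnesses 0 < 4.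
theorem4p7 = fromℚ (fromℕ 4) , (ℚ.1ℚ , ℚ.positive⁻¹ ℚ.1ℚ , always λ _ → fromℕ-strict {1} {4} (ℕ.s≤s (ℕ.s≤s ℕ.z≤n)))
  , λ π isPi p {{nz}} prime 2<p n _ f A norm≈A →
    -- The search uses f alone; A enters only in the estimate of the codimension n - d.
    let d , d≤n , (base , b , flat) , max = largest p {{nz}} (hasConstantFlat? p {{nz}} f) (pointFlat p {{nz}} f) n
    in flatSubspace p {{nz}} base b , n ℕ.∸ d , flat-codimension p {{nz}} base b (proj₁ flat) d≤n
      , codimension≤4A² π isPi p {{nz}} prime 2<p n f (λ x → fromSign (f x)) (λ _ → ≡.refl) A
          (≡.subst (λ g → Fourier.spectralNorm π p {{nz}} g ≈ᴿ A) (∘-inline f) norm≈A) d max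
      , flat-constant p {{nz}} flat
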